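{- Let $m$ be a positive integer. For every $\delta>0$ there exists $N\in\mathbb{N}$ such that every $N$-partitioned hypergraph with density at least $4/27+\delta$ embeds the tight $3$-uniform cycle $C_{3m+2}^{(3)}$.
   Context: An $N$-partitioned hypergraph $H$ is a $3$-uniform hypergraph whose vertex set is partitioned into nonempty finite sets $V_{ij}$, $1\le i<j\le N$ (we also write $V_{ji}=V_{ij}$), such that every edge has one vertex in each of $V_{ij},V_{ik},V_{jk}$ for some $1\le i<j<k\le N$. For $i<j<k$, the $(i,j,k)$-triad is the set of edges with one vertex in each of $V_{ij},V_{ik},V_{jk}$; its density is its number of edges divided by $|V_{ij}||V_{ik}||V_{jk}|$, and the density of $H$ is the minimum density over all triads. $H$ embeds a $3$-uniform hypergraph $H_0$ with vertex set $[n]$ if there are distinct $a_1,\dots,a_n\in[N]$ and vertices $v_{ij}\in V_{a_ia_j}$ for $1\le i<j\le n$ such that whenever $\{i,j,k\}$ ($i<j<k$) is an edge of $H_0$, the set $\{v_{ij},v_{ik},v_{jk}\}$ is an edge of $H$ (in the triad on the indices $a_i,a_j,a_k$). The tight cycle $C_\ell^{(3)}$ ($\ell\ge5$) has vertices $v_1,\dots,v_\ell$ and edges $\{v_i,v_{i+1},v_{i+2}\}$, indices modulo $\ell$. -}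

module Defs where

open import Data.Nat as ℕ using (ℕ; zero; suc; _+_; _*_; NonZero)
open import Data.Nat.DivMod using (_mod_)
open import Data.Fin as Fin using (Fin; toℕ)
open import Data.Fin.Properties using () renaming (_≟_ to _≟ᶠ_)
open import Data.Bool using (Bool; true; false; if_then_else_)
open import Data.Product using (Σ; ∃; ∃-syntax; _×_; _,_)
open import Data.Product.Properties using (≡-dec)
open import Data.Sum using (_⊎_)
open import Data.List using (List; tabulate)
open import Data.List.Relation.Unary.All using (All)
open import Data.Integer using (+_)
open import Data.Rational as ℚ using (ℚ; 0ℚ)
open import Relation.Binary.PropositionalEquality using (_≡_; _≢_)
open import Relation.Nullary.Decidable using (⌊_⌋)
open import Function.Definitions using (Injective)

sumFin : (n : ℕ) → (Fin n → ℕ) → ℕ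
sumFin zero    f = 0
sumFin (suc n) f = f Fin.zero + sumFin n (λ x → f (Fin.suc x))

count : (n : ℕ) → (Fin n → Bool) → ℕ
count n f = sumFin n (λ x → if f x then 1 else 0)

Pair : ℕ → Set
Pair N = Fin N × Fin N

_≟ₚ_ : ∀ {N} (p q : Pair N) → Bool
p ≟ₚ q = ⌊ ≡-dec _≟ᶠ_ _≟ᶠ_ p q ⌋

-- An N-partitioned 3-uniform hypergraph on the finite vertex set Fin M.
-- A vertex x lies in V_ij (i < j) iff  part x ≡ (i , j).
-- Edges are 3-sets, encoded as a symmetric boolean predicate on ordered triples.
record PartitionedHypergraph (N : ℕ) : Set where
  field
    M      : ℕ
    part   : Fin M → Pair N
    partOrdered : ∀ x → Fin._<_ (Data.Product.proj₁ (part x)) (Data.Product.proj₂ (part x))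
    nonempty : ∀ i j → Fin._<_ i j → ∃[ x ] part x ≡ (i , j)
    edge   : Fin M → Fin M → Fin M → Bool
    edgeSym₁ : ∀ x y z → edge x y z ≡ edge y x z
    edgeSym₂ : ∀ x y z → edge x y z ≡ edge x z y
    edgeTriad : ∀ x y z → edge x y z ≡ true →
      ∃[ i ] ∃[ j ] ∃[ k ] (Fin._<_ i j × Fin._<_ j k ×
        ((part x ≡ (i , j) ⊎ part x ≡ (i , k) ⊎ part x ≡ (j , k)) ×
         (part y ≡ (i , j) ⊎ part y ≡ (i , k) ⊎ part y ≡ (j , k)) ×
         (part z ≡ (i , j) ⊎ part z ≡ (i , k) ⊎ part z ≡ (j , k)) ×
         part x ≢ part y × part x ≢ part z × part y ≢ part z))

-- m / n as a rational, (with the junk value 0 when n = 0; never used as such,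
-- since all parts are nonempty).
_÷_ : ℕ → ℕ → ℚ
m ÷ zero  = 0ℚ
m ÷ suc n = (+ m) ℚ./ suc n

module _ {N : ℕ} (H : PartitionedHypergraph N) where
  open PartitionedHypergraph H

  partSize : Fin N → Fin N → ℕ
  partSize i j = count M (λ x → part x ≟ₚ (i , j))

  triadEdges : Fin N → Fin N → Fin N → ℕ
  triadEdges i j k =
    sumFin M λ x → sumFin M λ y → count M λ z →
      Data.Bool._∧_ (part x ≟ₚ (i , j))
        (Data.Bool._∧_ (part y ≟ₚ (i , k))
          (Data.Bool._∧_ (part z ≟ₚ (j , k)) (edge x y z)))

  triadDensity : Fin N → Fin N → Fin N → ℚ
  triadDensity i j k = triadEdges i j k ÷ (partSize i j * partSize i k * partSize j k)

  -- density of H is at least d  (density = minimum over triads)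
  DensityAtLeast : ℚ → Set
  DensityAtLeast d = ∀ i j k → Fin._<_ i j → Fin._<_ j k → d ℚ.≤ triadDensity i j k

  -- H embeds the 3-graph on vertex set Fin n whose edges are the sets {i,j,k}
  -- listed (as triples of distinct vertices) in es.
  Embeds : (n : ℕ) → List (Fin n × Fin n × Fin n) → Set
  Embeds n es =
    Σ (Fin n → Fin N) λ a → Injective _≡_ _≡_ a ×
    Σ (Fin n → Fin n → Fin M) λ v →
      -- v i j ∈ V_{a_i a_j} for i < j (V_ji = V_ij)
      (∀ i j → Fin._<_ i j → part (v i j) ≡ (a i , a j) ⊎ part (v i j) ≡ (a j , a i)) ×
      let vv : Fin n → Fin n → Fin M
          vv i j = if ⌊ Fin._<?_ i j ⌋ then v i j else v j i
      in All (λ { (i , j , k) → edge (vv i j) (vv i k) (vv j k) ≡ true }) es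

tightCycleEdges : (ℓ : ℕ) → .{{_ : NonZero ℓ}} → List (Fin ℓ × Fin ℓ × Fin ℓ)
tightCycleEdges ℓ = tabulate λ t →
  (t , ((toℕ t + 1) mod ℓ) , ((toℕ t + 2) mod ℓ))

{-# OPTIONS --safe #-}
-- After blowing up the parts to a common size L and passing to large index subsets by Ramsey's theorem, vertices
-- are replaced by colours: a colour picks one vertex in each V_ij, and edges among colours are required on all
-- triads at once.  A positive proportion of good configurations on every triad yields such colours.
--
-- Stage one: by Cauchy-Schwarz, density above 4/27 gives an edge αβγ of colours whose nine degrees (of α, β, γ, each
-- in the roles ij, ik, jk of a triad) sum to more than 4/3.
-- Stage two: the type of a vertex records in which of these nine links it has positive degree.  Every combination of
-- types on a link edge is either sparse or produces a few coloured edges that contain the pattern of C₅, whence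
-- C_{3m+2}, because C_{3m+2} maps to C₅ by winding m times around one of its edges.  The remaining combinations are governed
-- by two potentials in {0,1,2}, so the sum of the nine degrees is at most the maximum 4/3 of a quadratic form.
module Submission where

open import Defs

-- The value 4/27 enters through a second moment. Let s(x) be the sum of the degrees of a vertex x
-- in its three roles. If triads have density d, then s has mean 3d and mean square at least 9d².
-- Ramsey makes the share of each role in this mean square independent of the indices, so the three
-- vertices of an edge, which lie in different parts, contribute the same three shares: the nine
-- degrees, summed over the edges of a triad, reach 9d², on average 9d per edge, and 9 · 4/27 = 4/3.
--
-- The main obstacle is the order of quantifiers. Many good vertices for each single choice of
-- further indices do not give one vertex that is good for all indices of a large set. Thickening
-- overcomes this for one pair of indices, but an edge couples three pairs, and the vertex of ij
-- must be fixed before the indices are known that test the vertices of ik and jk. Those tests are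
-- first made against reserved reference indices and then transferred to other indices, which works
-- because the correlations of tests are constant up to rounding.
--
-- All quantities are counts in ℕ: proportions are rounded to a fixed grid and estimates are
-- cross-multiplied.

module Development where
  open import Data.Nat using (ℕ; zero; suc; _+_; _*_; _∸_; _≤_; _<_; z≤n; s≤s; _≤?_; _<?_; _≤ᵇ_; NonZero; >-nonZero; _/_; _%_; _≥_; _<ᵇ_; _≡ᵇ_; _!)
  open import Data.Nat.Properties
  open import Data.Nat.Tactic.RingSolver using (solve-∀)
  open import Data.Bool using (Bool; true; false; if_then_else_; _∧_; not; T; _∨_; T?)
  open import Data.Bool.Properties as Bool using (∧-assoc; T-≡; ∧-comm; ∨-zeroʳ)
  open import Data.Fin as Fin using (Fin; zero; suc; fromℕ<; toℕ; #_)
  open import Data.List as List using (List; []; _∷_; _++_; length; take; map; drop; upTo; [_]; zip; cartesianProduct; concat; replicate; filterᵇ; tabulate; allFin)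
  open import Data.Bool.ListAction using (all; any)
  open import Data.List.Properties using (length-++; length-map; ++-identityʳ; take++drop≡id; length-drop; map-++; length-upTo)
  open import Data.List.Membership.Propositional using (_∈_)
  open import Data.List.Relation.Unary.Any using (here; there)
  open import Data.List.Membership.Propositional.Properties using (∈-++⁻; ∈-++⁺ˡ; ∈-++⁺ʳ; ∈-map⁻; ∈-map⁺; ∈-upTo⁺; ∈-allFin; ∈-cartesianProduct⁺; ∈-upTo⁻; ∈-filter⁻)
  open import Data.List.Relation.Binary.Sublist.Propositional using (_⊆_; []; _∷_; _∷ʳ_; ⊆-refl; ⊆-trans; minimum; ⊆-reflexive; lookup)
  open import Data.List.Relation.Binary.Sublist.Propositional.Properties using (take-⊆; ++⁺)
  open import Data.Vec as Vec using (Vec; []; _∷_; toList)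
  open import Data.Vec.Relation.Binary.Pointwise.Inductive using (Pointwise; []; _∷_)
  open import Data.Maybe using (Maybe; just; nothing)
  open import Data.Product using (Σ; ∃-syntax; _×_; _,_; proj₁; proj₂)
  open import Data.Sum using (_⊎_; inj₁; inj₂; [_,_]′)
  open import Data.Empty using (⊥; ⊥-elim)
  open import Relation.Binary.PropositionalEquality hiding ([_]; J)
  open import Relation.Binary.Definitions using (DecidableEquality; tri<; tri≈; tri>)
  open import Relation.Nullary using (¬_; yes; no)
  open import Relation.Nullary.Decidable using (⌊_⌋; toWitness; fromWitness)
  open import Function using (_∘_; id)
  import Data.Fin.Properties as Fin
  open import Data.List.Relation.Unary.All as All using (All; []; _∷_)
  open import Data.List.Relation.Unary.AllPairs using (AllPairs; []; _∷_)
  open import Data.Nat.DivMod using (m/n*n≤m; m≡m%n+[m/n]*n; m%n<n; m*n/n≡m; /-monoˡ-≤; _mod_; _%_; m<n⇒m%n≡m; n%n≡0; [m+n]%n≡m%n; m/n*n≡m)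
  open import Data.Product.Properties using (≡-dec)
  import Data.Vec.Properties as Vec

  -- Summation functionals and sums over lists.

  module Summation where
    ind : Bool → ℕ
    ind b = if b then 1 else 0

    ind≤1 : ∀ b → ind b ≤ 1
    ind≤1 true  = ≤-refl
    ind≤1 false = z≤n

    ind-∧ : ∀ a b → ind (a ∧ b) ≡ ind a * ind b
    ind-∧ true  b = sym (+-identityʳ (ind b))
    ind-∧ false b = refl

    ind-true : ∀ {b} → 1 ≤ ind b → b ≡ true
    ind-true {true} _ = refl

    ≤ᵇ-true : ∀ {m n} → (m ≤ᵇ n) ≡ true → m ≤ n
    ≤ᵇ-true {m} {n} h = ≤ᵇ⇒≤ m n (subst T (sym h) _)

    ≤ᵇ-false : ∀ {m n} → (m ≤ᵇ n) ≡ false → n < m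
    ≤ᵇ-false {m} {n} h = ≰⇒> (λ p → subst T h (≤⇒≤ᵇ p))

    amgm : ∀ a b → 2 * (a * b) ≤ a * a + b * b
    amgm a b = [ half a b , (λ p → subst₂ _≤_ (cong (2 *_) (*-comm b a)) (+-comm (b * b) (a * a)) (half b a p)) ]′
      (≤-total a b)
      where
      half : ∀ a b → a ≤ b → 2 * (a * b) ≤ a * a + b * b
      half a b p = subst (λ b → 2 * (a * b) ≤ a * a + b * b) (m+[n∸m]≡n p)
        (≤-trans (m≤m+n _ ((b ∸ a) * (b ∸ a))) (≤-reflexive (e a (b ∸ a))))
        where
        e : ∀ a d → 2 * (a * (a + d)) + d * d ≡ a * a + (a + d) * (a + d)
        e = solve-∀

    -- Sums are used only through these laws, so that vertices, tuples of vertices and types are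
    -- counted by the same lemmas. `∑-witness` is the source of all existence statements.
    record Measure (Ω : Set) : Set where
      field
        ∑         : (Ω → ℕ) → ℕ
        ∑-mono    : ∀ {f g} → (∀ ω → f ω ≤ g ω) → ∑ f ≤ ∑ g
        ∑-+       : ∀ f g → ∑ (λ ω → f ω + g ω) ≡ ∑ f + ∑ g
        ∑-*       : ∀ k f → ∑ (λ ω → k * f ω) ≡ k * ∑ f
        ∑-witness : ∀ f → 1 ≤ ∑ f → ∃[ ω ] 1 ≤ f ω

      ∑-cong : ∀ {f g} → (∀ ω → f ω ≡ g ω) → ∑ f ≡ ∑ g
      ∑-cong eq = ≤-antisym (∑-mono (≤-reflexive ∘ eq)) (∑-mono (≤-reflexive ∘ sym ∘ eq))

      ∑-*ʳ : ∀ f k → ∑ (λ ω → f ω * k) ≡ ∑ f * k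
      ∑-*ʳ f k = trans (∑-cong (λ ω → *-comm (f ω) k)) (trans (∑-* k f) (*-comm k (∑ f)))

      ∑-0 : ∑ (λ _ → 0) ≡ 0
      ∑-0 = ∑-* 0 (λ _ → 0)

      mass : ℕ
      mass = ∑ (λ _ → 1)

      ∑-const : ∀ k → ∑ (λ _ → k) ≡ k * mass
      ∑-const k = trans (∑-cong (λ _ → sym (*-identityʳ k))) (∑-* k (λ _ → 1))

    open Measure

    -- Summing 2 · s u · s v ≤ (s u)² + (s v)² over all pairs avoids the variance and thereby
    -- subtraction.
    cauchy-schwarz : ∀ {Ω} (μ : Measure Ω) (s : Ω → ℕ) → ∑ μ s * ∑ μ s ≤ mass μ * ∑ μ (λ ω → s ω * s ω)
    cauchy-schwarz μ s = *-cancelˡ-≤ 2 (begin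
      2 * (∑ μ s * ∑ μ s)                                      ≡⟨ cong (2 *_) (∑-*ʳ μ s (∑ μ s)) ⟨
      2 * ∑ μ (λ u → s u * ∑ μ s)                              ≡⟨ ∑-* μ 2 _ ⟨
      ∑ μ (λ u → 2 * (s u * ∑ μ s))                            ≡⟨ ∑-cong μ (λ u → trans (cong (2 *_) (sym (∑-* μ (s u) s))) (sym (∑-* μ 2 _))) ⟩
      ∑ μ (λ u → ∑ μ (λ v → 2 * (s u * s v)))                  ≤⟨ ∑-mono μ (λ u → ∑-mono μ (λ v → amgm (s u) (s v))) ⟩
      ∑ μ (λ u → ∑ μ (λ v → s u * s u + s v * s v))            ≡⟨ ∑-cong μ (λ u → trans (∑-+ μ _ _) (cong (_+ Q) (∑-const μ (s u * s u)))) ⟩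
      ∑ μ (λ u → s u * s u * mass μ + Q)                       ≡⟨ ∑-+ μ _ _ ⟩
      ∑ μ (λ u → s u * s u * mass μ) + ∑ μ (λ _ → Q)           ≡⟨ cong₂ _+_ (∑-*ʳ μ _ (mass μ)) (∑-const μ Q) ⟩
      Q * mass μ + Q * mass μ                                  ≡⟨ double Q (mass μ) ⟩
      2 * (mass μ * Q)                                         ∎)
      where
      open ≤-Reasoning
      Q = ∑ μ (λ v → s v * s v)
      double : ∀ Q t → Q * t + Q * t ≡ 2 * (t * Q)
      double = solve-∀

    sumFin-mono : ∀ n {f g : Fin n → ℕ} → (∀ i → f i ≤ g i) → sumFin n f ≤ sumFin n g
    sumFin-mono zero    h = z≤n
    sumFin-mono (suc n) h = +-mono-≤ (h zero) (sumFin-mono n (h ∘ suc))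

    sumFin-+ : ∀ n (f g : Fin n → ℕ) → sumFin n (λ i → f i + g i) ≡ sumFin n f + sumFin n g
    sumFin-+ zero    f g = refl
    sumFin-+ (suc n) f g rewrite sumFin-+ n (f ∘ suc) (g ∘ suc) = lemma (f zero) (g zero) _ _
      where
      lemma : ∀ a b c d → a + b + (c + d) ≡ a + c + (b + d)
      lemma = solve-∀

    sumFin-* : ∀ n k (f : Fin n → ℕ) → sumFin n (λ i → k * f i) ≡ k * sumFin n f
    sumFin-* zero    k f = sym (*-zeroʳ k)
    sumFin-* (suc n) k f rewrite sumFin-* n k (f ∘ suc) = sym (*-distribˡ-+ k _ _)

    sumFin-witness : ∀ n (f : Fin n → ℕ) → 1 ≤ sumFin n f → ∃[ i ] 1 ≤ f i
    sumFin-witness (suc n) f h with f zero in eq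
    ... | suc k = zero , subst (1 ≤_) (sym eq) (s≤s z≤n)
    ... | zero with sumFin-witness n (f ∘ suc) h
    ...   | i , q = suc i , q

    sumFin-1 : ∀ n → sumFin n (λ _ → 1) ≡ n
    sumFin-1 zero    = refl
    sumFin-1 (suc n) = cong suc (sumFin-1 n)

    uniform : ∀ n → Measure (Fin n)
    uniform n = record
      { ∑ = sumFin n ; ∑-mono = sumFin-mono n ; ∑-+ = sumFin-+ n ; ∑-* = sumFin-* n
      ; ∑-witness = sumFin-witness n }

    infixr 6 _⊗_

    _⊗_ : ∀ {A B} → Measure A → Measure B → Measure (A × B)
    μ ⊗ ν = record
      { ∑         = λ f → ∑ μ λ a → ∑ ν λ b → f (a , b)
      ; ∑-mono    = λ h → ∑-mono μ λ a → ∑-mono ν λ b → h (a , b)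
      ; ∑-+       = λ f g → trans (∑-cong μ λ a → ∑-+ ν _ _) (∑-+ μ _ _)
      ; ∑-*       = λ k f → trans (∑-cong μ λ a → ∑-* ν k _) (∑-* μ k _)
      ; ∑-witness = λ f h → let (a , h′) = ∑-witness μ _ h ; (b , h″) = ∑-witness ν _ h′ in (a , b) , h″
      }

    sumList : ∀ {A : Set} → List A → (A → ℕ) → ℕ
    sumList []       f = 0
    sumList (x ∷ xs) f = f x + sumList xs f

    module _ {A : Set} where

      sumList-mono : ∀ (xs : List A) {f g} → (∀ x → x ∈ xs → f x ≤ g x) → sumList xs f ≤ sumList xs g
      sumList-mono []       h = z≤n
      sumList-mono (x ∷ xs) h = +-mono-≤ (h x (here refl)) (sumList-mono xs (λ y y∈ → h y (there y∈)))

      sumList-cong : ∀ (xs : List A) {f g} → (∀ x → x ∈ xs → f x ≡ g x) → sumList xs f ≡ sumList xs g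
      sumList-cong []       h = refl
      sumList-cong (x ∷ xs) h = cong₂ _+_ (h x (here refl)) (sumList-cong xs (λ y y∈ → h y (there y∈)))

      sumList-*ʳ : ∀ (xs : List A) f k → sumList xs (λ x → f x * k) ≡ sumList xs f * k
      sumList-*ʳ []       f k = refl
      sumList-*ʳ (x ∷ xs) f k rewrite sumList-*ʳ xs f k = sym (*-distribʳ-+ k (f x) _)

      sumList-* : ∀ (xs : List A) k f → sumList xs (λ x → k * f x) ≡ k * sumList xs f
      sumList-* []       k f = sym (*-zeroʳ k)
      sumList-* (x ∷ xs) k f rewrite sumList-* xs k f = sym (*-distribˡ-+ k (f x) _)

      sumList-const : ∀ (xs : List A) k → sumList xs (λ _ → k) ≡ length xs * k
      sumList-const []       k = refl
      sumList-const (x ∷ xs) k = cong (k +_) (sumList-const xs k)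

      sumList-++ : ∀ (xs ys : List A) f → sumList (xs ++ ys) f ≡ sumList xs f + sumList ys f
      sumList-++ []       ys f = refl
      sumList-++ (x ∷ xs) ys f rewrite sumList-++ xs ys f = sym (+-assoc (f x) _ _)

      ∑-sumList : ∀ {Ω} (μ : Measure Ω) (xs : List A) (f : A → Ω → ℕ) →
        ∑ μ (λ ω → sumList xs (λ x → f x ω)) ≡ sumList xs (λ x → ∑ μ (f x))
      ∑-sumList μ []       f = ∑-0 μ
      ∑-sumList μ (x ∷ xs) f = trans (∑-+ μ _ _) (cong (∑ μ (f x) +_) (∑-sumList μ xs f))

      sumList-max : ∀ x (xs : List A) v → ∃[ y ] (y ∈ x ∷ xs × sumList (x ∷ xs) v ≤ suc (length xs) * v y)
      sumList-max x []        v = x , here refl , ≤-refl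
      sumList-max x (x′ ∷ xs) v with sumList-max x′ xs v
      ... | y , y∈ , p with v x ≤? v y
      ...   | yes q = y , there y∈ , +-mono-≤ q p
      ...   | no q  = x , here refl , +-monoʳ-≤ (v x) (≤-trans p (*-monoʳ-≤ (suc (length xs)) (≰⇒≥ q)))

      -- The largest term serves; `1 ≤ X` rules out the empty list.
      pigeonhole : ∀ (xs : List A) v {X k} → 1 ≤ X → X ≤ k * sumList xs v →
        ∃[ x ] (x ∈ xs × X ≤ k * length xs * v x)
      pigeonhole []       v {X} {k} 1≤X h = ⊥-elim (<-irrefl refl (≤-trans 1≤X (≤-trans h (≤-reflexive (*-zeroʳ k)))))
      pigeonhole (x ∷ xs) v {X} {k} 1≤X h with sumList-max x xs v
      ... | y , y∈ , p = y , y∈ , ≤-trans h (≤-trans (*-monoʳ-≤ k p) (≤-reflexive (sym (*-assoc k _ (v y)))))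

    all-++ : ∀ {A : Set} (p : A → Bool) xs ys → all p (xs ++ ys) ≡ all p xs ∧ all p ys
    all-++ p []       ys = refl
    all-++ p (x ∷ xs) ys rewrite all-++ p xs ys = sym (∧-assoc (p x) _ _)

    all-∈ : ∀ {A : Set} (p : A → Bool) {xs x} → all p xs ≡ true → x ∈ xs → p x ≡ true
    all-∈ p {y ∷ xs} h (here refl) with p y
    ... | true = refl
    all-∈ p {y ∷ xs} h (there x∈) with p y
    ... | true = all-∈ p h x∈

    all-intro : ∀ {A : Set} (p : A → Bool) xs → (∀ x → x ∈ xs → p x ≡ true) → all p xs ≡ true
    all-intro p []       h = refl
    all-intro p (x ∷ xs) h rewrite h x (here refl) = all-intro p xs (λ y y∈ → h y (there y∈))

    ∧-true : ∀ {a b} → a ∧ b ≡ true → a ≡ true × b ≡ true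
    ∧-true {true} h = refl , h

    -- Ramsey's theorem, with sublists of a list in the role of subsets.

    module _ {I : Set} where

      Mono : ℕ → List I → (List I → Bool) → Bool → Set
      Mono s W f v = ∀ Q → Q ⊆ W → length Q ≡ s → f Q ≡ v

      length-take-≡ : ∀ n (W : List I) → n ≤ length W → length (take n W) ≡ n
      length-take-≡ zero    W       h       = refl
      length-take-≡ (suc n) (x ∷ W) (s≤s h) = cong suc (length-take-≡ n W h)

      -- Double induction: split off the first index x, use the case `s` to make the colour of
      -- `x ∷ Q` independent of `Q`, and recurse with the target of that colour lowered by one. The
      -- colour is not known beforehand, hence the room `N₁ + N₂` for both recursive calls.
      ramsey₂ : ∀ s a b → ∃[ N ] ∀ W → N ≤ length W → (f : List I → Bool) →
        (∃[ W′ ] (W′ ⊆ W × length W′ ≡ a × Mono s W′ f true)) ⊎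
        (∃[ W′ ] (W′ ⊆ W × length W′ ≡ b × Mono s W′ f false))
      ramsey₂ zero a b = a + b , λ W h f → go W h f
        where
        go : ∀ W → a + b ≤ length W → (f : List I → Bool) → _
        go W h f with f [] in eq
        ... | true  = inj₁ (take a W , take-⊆ a W , length-take-≡ a W (≤-trans (m≤m+n a b) h) , λ { [] _ _ → eq })
        ... | false = inj₂ (take b W , take-⊆ b W , length-take-≡ b W (≤-trans (m≤n+m b a) h) , λ { [] _ _ → eq })
      ramsey₂ (suc s) zero    b       = 0 , λ W h f → inj₁ ([] , minimum W , refl , λ { [] _ () ; (_ ∷ _) () _ })
      ramsey₂ (suc s) (suc a) zero    = 0 , λ W h f → inj₂ ([] , minimum W , refl , λ { [] _ () ; (_ ∷ _) () _ })
      ramsey₂ (suc s) (suc a) (suc b) with ramsey₂ (suc s) a (suc b) | ramsey₂ (suc s) (suc a) b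
      ... | N₁ , r₁ | N₂ , r₂ with ramsey₂ s (N₁ + N₂) (N₁ + N₂)
      ...   | N , r = suc N , go
        where
        extend : ∀ {x W f v} → Mono s W (f ∘ (x ∷_)) v → ∀ {W′} → W′ ⊆ W → Mono (suc s) W′ f v →
          Mono (suc s) (x ∷ W′) f v
        extend hx W′⊆W hW Q       (_ ∷ʳ p)   l = hW Q p l
        extend hx W′⊆W hW (_ ∷ Q) (refl ∷ p) l = hx Q (⊆-trans p W′⊆W) (suc-injective l)

        go : ∀ W → suc N ≤ length W → ∀ f → _
        go (x ∷ W) (s≤s h) f with r W h (f ∘ (x ∷_))
        ... | inj₁ (V , V⊆W , lV , mV) with r₁ V (≤-trans (m≤m+n N₁ N₂) (≤-reflexive (sym lV))) f
        ...   | inj₁ (U , U⊆V , lU , mU) = inj₁ (x ∷ U , refl ∷ ⊆-trans U⊆V V⊆W , cong suc lU , extend mV U⊆V mU)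
        ...   | inj₂ (U , U⊆V , lU , mU) = inj₂ (U , _ ∷ʳ ⊆-trans U⊆V V⊆W , lU , mU)
        go (x ∷ W) (s≤s h) f | inj₂ (V , V⊆W , lV , mV) with r₂ V (≤-trans (m≤n+m N₂ N₁) (≤-reflexive (sym lV))) f
        ...   | inj₁ (U , U⊆V , lU , mU) = inj₁ (U , _ ∷ʳ ⊆-trans U⊆V V⊆W , lU , mU)
        ...   | inj₂ (U , U⊆V , lU , mU) = inj₂ (x ∷ U , refl ∷ ⊆-trans U⊆V V⊆W , cong suc lU , extend mV U⊆V mU)

      ramsey′ : ∀ s n → ∃[ N ] ∀ W → N ≤ length W → (f : List I → Bool) →
        ∃[ W′ ] (W′ ⊆ W × length W′ ≡ n × ∃[ v ] Mono s W′ f v)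
      ramsey′ s n with ramsey₂ s n n
      ... | N , r = N , λ W h f → go W h f
        where
        go : ∀ W → N ≤ length W → ∀ f → _
        go W h f with r W h f
        ... | inj₁ (V , p , l , m) = V , p , l , true , m
        ... | inj₂ (V , p , l , m) = V , p , l , false , m

      -- Abstract, because evaluating the Ramsey bounds is infeasible.
      abstract
        ramsey : ∀ s n → ∃[ N ] ∀ W → N ≤ length W → (f : List I → Bool) →
          ∃[ W′ ] (W′ ⊆ W × length W′ ≡ n × ∃[ v ] Mono s W′ f v)
        ramsey = ramsey′

      -- Induction on the colours, the first one being separated from all others by two-colour
      -- Ramsey. With no colours at all a single set of size `s` is contradictory, hence the bound
      -- `s`.
      ramseyList′ : ∀ {A : Set} → DecidableEquality A → (xs : List A) → ∀ s n → ∃[ N ] ∀ W → N ≤ length W →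
        (f : List I → A) → (∀ Q → Q ⊆ W → length Q ≡ s → f Q ∈ xs) →
        ∃[ W′ ] (W′ ⊆ W × length W′ ≡ n × ∃[ a ] (a ∈ xs × ∀ Q → Q ⊆ W′ → length Q ≡ s → f Q ≡ a))
      ramseyList′ _≟_ [] s n = s , λ W h f f∈ → ⊥-elim (empty (f∈ (take s W) (take-⊆ s W) (length-take-≡ s W h)))
        where
        empty : ∀ {A : Set} {x : A} → x ∈ [] → ⊥
        empty ()
      ramseyList′ {A} _≟_ (x ∷ xs) s n with ramseyList′ _≟_ xs s n
      ... | N₁ , r₁ with ramsey s (n + N₁)
      ...   | N , r = N , go
        where
        elim-yes : ∀ {y} → ⌊ y ≟ x ⌋ ≡ true → y ≡ x
        elim-yes {y} h with y ≟ x
        ... | yes e = e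
        elim-no : ∀ {y} → ⌊ y ≟ x ⌋ ≡ false → y ∈ x ∷ xs → y ∈ xs
        elim-no {y} h y∈ with y ≟ x
        elim-no h (here e)   | no ne = ⊥-elim (ne e)
        elim-no h (there y∈) | no ne = y∈
        go : ∀ W → N ≤ length W → (f : List I → A) → _ → _
        go W h f f∈ with r W h (λ Q → ⌊ f Q ≟ x ⌋)
        ... | V , V⊆W , lV , true , mV =
              take n V , ⊆-trans (take-⊆ n V) V⊆W ,
              length-take-≡ n V (≤-trans (m≤m+n n N₁) (≤-reflexive (sym lV))) , x , here refl ,
              λ Q Q⊆ lQ → elim-yes (mV Q (⊆-trans Q⊆ (take-⊆ n V)) lQ)
        ... | V , V⊆W , lV , false , mV with r₁ V (≤-trans (m≤n+m N₁ n) (≤-reflexive (sym lV))) f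
                (λ Q Q⊆ lQ → elim-no (mV Q Q⊆ lQ) (f∈ Q (⊆-trans Q⊆ V⊆W) lQ))
        ...   | U , U⊆V , lU , a , a∈ , e = U , ⊆-trans U⊆V V⊆W , lU , a , there a∈ , e

      abstract
        ramseyList : ∀ {A : Set} → DecidableEquality A → (xs : List A) → ∀ s n → ∃[ N ] ∀ W → N ≤ length W →
          (f : List I → A) → (∀ Q → Q ⊆ W → length Q ≡ s → f Q ∈ xs) →
          ∃[ W′ ] (W′ ⊆ W × length W′ ≡ n × ∃[ a ] (a ∈ xs × ∀ Q → Q ⊆ W′ → length Q ≡ s → f Q ≡ a))
        ramseyList = ramseyList′

  open Summation

  -- From one extra index per gap to all indices of a large set.

  module Thickening where
    open Measure

    subs : ∀ {I : Set} → ℕ → List I → List (List I)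
    subs zero    xs       = [] ∷ []
    subs (suc n) []       = []
    subs (suc n) (x ∷ xs) = map (x ∷_) (subs n xs) ++ subs (suc n) xs

    choose : ℕ → ℕ → ℕ
    choose zero    m       = 1
    choose (suc n) zero    = 0
    choose (suc n) (suc m) = choose n m + choose (suc n) m

    allVecs : ∀ {A : Set} → List A → ∀ n → List (Vec A n)
    allVecs xs zero    = [] ∷ []
    allVecs xs (suc n) = List.concatMap (λ v → map (_∷ v) xs) (allVecs xs n)

    ∈-allVecs : ∀ {A : Set} {xs : List A} {n} (v : Vec A n) → (∀ i → Vec.lookup v i ∈ xs) → v ∈ allVecs xs n
    ∈-allVecs []      h = here refl
    ∈-allVecs (a ∷ v) h = ∈-concatMap⁺ (∈-allVecs v (h ∘ suc)) (∈-map⁺ (_∷ v) (h zero))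
      where
      ∈-concatMap⁺ : ∀ {A B : Set} {f : A → List B} {xs x y} → x ∈ xs → y ∈ f x → y ∈ List.concatMap f xs
      ∈-concatMap⁺ {f = f} {x ∷ xs} (here refl) y∈ = ∈-++⁺ˡ y∈
      ∈-concatMap⁺ {f = f} {x ∷ xs} (there x∈)  y∈ = ∈-++⁺ʳ (f x) (∈-concatMap⁺ x∈ y∈)

    -- More than 2bn indices, so that points satisfying fewer than n of them make up at most half of
    -- an average of size 1/b.
    gapSize : ℕ → ℕ → ℕ
    gapSize b n = suc (2 * b * n)

    nextBound : ℕ → ℕ → ℕ
    nextBound b n = 2 * b * choose n (gapSize b n)

    gapSizes : ℕ → ∀ {k} → Vec ℕ k → Vec ℕ k
    gapSizes b []       = []
    gapSizes b (n ∷ ns) = gapSize b n ∷ gapSizes (nextBound b n) ns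

    finalBound : ℕ → ∀ {k} → Vec ℕ k → ℕ
    finalBound b []       = b
    finalBound b (n ∷ ns) = finalBound (nextBound b n) ns

    module _ {I : Set} where

      subs-⊆ : ∀ n (K : List I) {T} → T ∈ subs n K → T ⊆ K × length T ≡ n
      subs-⊆ zero    K       (here refl) = minimum K , refl
      subs-⊆ (suc n) (x ∷ K) T∈ with ∈-++⁻ (map (x ∷_) (subs n K)) T∈
      ... | inj₂ q = let (a , b) = subs-⊆ (suc n) K q in _ ∷ʳ a , b
      ... | inj₁ q with ∈-map⁻ (x ∷_) q
      ...   | U , U∈ , refl = let (a , b) = subs-⊆ n K U∈ in refl ∷ a , cong suc b

      length-subs : ∀ n (K : List I) → length (subs n K) ≡ choose n (length K)
      length-subs zero    K       = refl
      length-subs (suc n) []      = refl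
      length-subs (suc n) (x ∷ K) = trans (length-++ (map (x ∷_) (subs n K)))
        (cong₂ _+_ (trans (length-map (x ∷_) (subs n K)) (length-subs n K)) (length-subs (suc n) K))

      sumList-map : ∀ {A B : Set} (g : A → B) (xs : List A) f → sumList (map g xs) f ≡ sumList xs (f ∘ g)
      sumList-map g []       f = refl
      sumList-map g (x ∷ xs) f = cong (f (g x) +_) (sumList-map g xs f)

      subs-full : ∀ n (K : List I) (p : I → Bool) → n ≤ sumList K (ind ∘ p) →
        1 ≤ sumList (subs n K) (λ T → ind (all p T))
      subs-full zero    K       p h = ≤-refl
      subs-full (suc n) (x ∷ K) p h
        rewrite sumList-++ (map (x ∷_) (subs n K)) (subs (suc n) K) (λ T → ind (all p T))
              | sumList-map (x ∷_) (subs n K) (λ T → ind (all p T)) with p x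
      ... | true  = ≤-trans (subs-full n K p (≤-pred h)) (m≤m+n _ _)
      ... | false = ≤-trans (subs-full (suc n) K p h) (m≤n+m _ _)

      count≤length : ∀ (K : List I) (p : I → Bool) → sumList K (ind ∘ p) ≤ length K
      count≤length []      p = z≤n
      count≤length (x ∷ K) p = +-mono-≤ (ind≤1 (p x)) (count≤length K p)

      module _ {Ω : Set} (μ : Measure Ω) (G : I → Ω → Bool) where

        cnt : List I → Ω → ℕ
        cnt K ω = sumList K (λ t → ind (G t ω))

        holds : List I → Ω → Bool
        holds T ω = all (λ t → G t ω) T

        -- Points good for fewer than `n` indices of `K` contribute at most n · M each, together at
        -- most half of the total because |K| > 2bn. Every other point is good for a whole n-subset
        -- of `K`, and pigeonhole over the `choose n` |K| subsets yields `T`. The weight φ stands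
        -- for the gaps still to be treated.
        gap-lemma : ∀ b n (K : List I) (h : Ω → Bool) (φ : Ω → ℕ) M →
          length K ≡ gapSize b n → (∀ ω → φ ω ≤ M) → 1 ≤ M → 1 ≤ mass μ →
          mass μ * (length K * M) ≤ b * ∑ μ (λ ω → ind (h ω) * (cnt K ω * φ ω)) →
          ∃[ T ] (T ⊆ K × length T ≡ n ×
            mass μ * M ≤ nextBound b n * ∑ μ (λ ω → ind (h ω ∧ holds T ω) * φ ω))
        gap-lemma b n K h φ M lK φ≤M 1≤M 1≤T hyp = result
          where
          m = length K
          w : List I → Ω → ℕ
          w T ω = ind (h ω ∧ holds T ω) * φ ω
          V = sumList (subs n K) (λ T → ∑ μ (w T))

          pointwise : ∀ ω → ind (h ω) * (cnt K ω * φ ω) ≤ n * M + m * sumList (subs n K) (λ T → w T ω)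
          pointwise ω with h ω
          ... | false = z≤n
          ... | true rewrite +-identityʳ (cnt K ω * φ ω) with n ≤? cnt K ω
          ...   | no q  = ≤-trans (*-mono-≤ (<⇒≤ (≰⇒> q)) (φ≤M ω)) (m≤m+n _ _)
          ...   | yes q = ≤-trans (*-mono-≤ (count≤length K (λ t → G t ω)) step) (m≤n+m _ (n * M))
            where
            step : φ ω ≤ sumList (subs n K) (λ T → ind (holds T ω) * φ ω)
            step = begin
              φ ω                                                    ≡⟨ *-identityˡ (φ ω) ⟨
              1 * φ ω                                                ≤⟨ *-monoˡ-≤ (φ ω) (subs-full n K (λ t → G t ω) q) ⟩
              sumList (subs n K) (λ T → ind (holds T ω)) * φ ω       ≡⟨ sumList-*ʳ (subs n K) _ (φ ω) ⟨
              sumList (subs n K) (λ T → ind (holds T ω) * φ ω)       ∎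
              where open ≤-Reasoning

          total : ∑ μ (λ ω → ind (h ω) * (cnt K ω * φ ω)) ≤ n * M * mass μ + m * V
          total = begin
            ∑ μ (λ ω → ind (h ω) * (cnt K ω * φ ω))
              ≤⟨ ∑-mono μ pointwise ⟩
            ∑ μ (λ ω → n * M + m * sumList (subs n K) (λ T → w T ω))
              ≡⟨ ∑-+ μ _ _ ⟩
            ∑ μ (λ _ → n * M) + ∑ μ (λ ω → m * sumList (subs n K) (λ T → w T ω))
              ≡⟨ cong₂ _+_ (∑-const μ (n * M)) (trans (∑-* μ m _) (cong (m *_) (∑-sumList μ (subs n K) w))) ⟩
            n * M * mass μ + m * V ∎
            where open ≤-Reasoning

          doubled : m * (mass μ * M) ≤ m * (2 * b * V)
          doubled = +-cancelˡ-≤ (m * (mass μ * M)) _ _ (begin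
            m * (mass μ * M) + m * (mass μ * M)
              ≡⟨ e₁ m (mass μ) M ⟩
            2 * (mass μ * (m * M))
              ≤⟨ *-monoʳ-≤ 2 (≤-trans hyp (*-monoʳ-≤ b total)) ⟩
            2 * (b * (n * M * mass μ + m * V))
              ≡⟨ e₂ b n M (mass μ) m V ⟩
            2 * b * n * (mass μ * M) + m * (2 * b * V)
              ≤⟨ +-monoˡ-≤ _ (*-monoˡ-≤ (mass μ * M) (≤-trans (n≤1+n _) (≤-reflexive (sym lK)))) ⟩
            m * (mass μ * M) + m * (2 * b * V) ∎)
            where
            open ≤-Reasoning
            e₁ : ∀ m t M → m * (t * M) + m * (t * M) ≡ 2 * (t * (m * M))
            e₁ = solve-∀
            e₂ : ∀ b n M t m V → 2 * (b * (n * M * t + m * V)) ≡ 2 * b * n * (t * M) + m * (2 * b * V)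
            e₂ = solve-∀

          bound : mass μ * M ≤ 2 * b * V
          bound = *-cancelˡ-≤ (gapSize b n) (subst (λ z → z * (mass μ * M) ≤ z * (2 * b * V)) lK doubled)

          result : _
          result with pigeonhole (subs n K) (λ T → ∑ μ (w T)) {k = 2 * b} (*-mono-≤ 1≤T 1≤M) bound
          ... | T , T∈ , p = T , proj₁ (subs-⊆ n K T∈) , proj₂ (subs-⊆ n K T∈) ,
                ≤-trans p (≤-reflexive (cong (λ z → 2 * b * z * ∑ μ (w T)) (trans (length-subs n K) (cong (choose n) lK))))

        prodLength : ∀ {k} → Vec (List I) k → ℕ
        prodLength []       = 1
        prodLength (K ∷ Ks) = length K * prodLength Ks

        prodCount : ∀ {k} → Vec (List I) k → Ω → ℕ
        prodCount []       ω = 1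
        prodCount (K ∷ Ks) ω = cnt K ω * prodCount Ks ω

        prodCount≤ : ∀ {k} (Ks : Vec (List I) k) ω → prodCount Ks ω ≤ prodLength Ks
        prodCount≤ []       ω = ≤-refl
        prodCount≤ (K ∷ Ks) ω = *-mono-≤ (count≤length K (λ t → G t ω)) (prodCount≤ Ks ω)

        -- One gap at a time: the set chosen in a gap is absorbed into the event `h`, while the
        -- later gaps remain in averaged form as the weight `prodCount`.
        gaps-lemma : ∀ b {k} (ns : Vec ℕ k) (Ks : Vec (List I) k) (h : Ω → Bool) →
          Vec.map length Ks ≡ gapSizes b ns → 1 ≤ mass μ →
          mass μ * prodLength Ks ≤ b * ∑ μ (λ ω → ind (h ω) * prodCount Ks ω) →
          ∃[ Ts ] (Pointwise _⊆_ Ts Ks × Vec.map length Ts ≡ ns ×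
            mass μ ≤ finalBound b ns * ∑ μ (λ ω → ind (h ω ∧ holds (List.concat (toList Ts)) ω)))
        gaps-lemma b [] [] h e 1≤T hyp = [] , [] , refl , ≤-trans (≤-reflexive (sym (*-identityʳ _)))
          (≤-trans hyp (*-monoʳ-≤ b (∑-mono μ λ ω → ≤-reflexive
            (trans (*-identityʳ (ind (h ω))) (cong ind (sym (Data.Bool.Properties.∧-identityʳ (h ω))))))))
          where import Data.Bool.Properties
        gaps-lemma b (n ∷ ns) (K ∷ Ks) h e 1≤T hyp =
          let (T , T⊆K , lT , p) = gap-lemma b n K h (prodCount Ks) (prodLength Ks) (cong Vec.head e) (prodCount≤ Ks)
                                     (positive (nextBound b n) ns Ks (cong Vec.tail e)) 1≤T hyp
              (Ts , Ts⊆ , lTs , q) = gaps-lemma (nextBound b n) ns Ks (λ ω → h ω ∧ holds T ω) (cong Vec.tail e) 1≤T p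
          in T ∷ Ts , T⊆K ∷ Ts⊆ , cong₂ _∷_ lT lTs ,
             ≤-trans q (≤-reflexive (cong (finalBound (nextBound b n) ns *_) (∑-cong μ λ ω → cong ind
               (trans (∧-assoc (h ω) _ _) (cong (h ω ∧_) (sym (all-++ (λ t → G t ω) T _)))))))
          where
          positive : ∀ b {k} (ns : Vec ℕ k) (Ks : Vec (List I) k) → Vec.map length Ks ≡ gapSizes b ns → 1 ≤ prodLength Ks
          positive b []       []       e = ≤-refl
          positive b (n ∷ ns) (K ∷ Ks) e = *-mono-≤ (≤-trans (s≤s z≤n) (≤-reflexive (sym (cong Vec.head e))))
            (positive (nextBound b n) ns Ks (cong Vec.tail e))

        -- Summed over all transversals of the `Ks`, the hypothesis counts each point as often as it
        -- has good transversals, which is the product of its numbers of good indices in the single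
        -- gaps.
        average : ∀ b {k} (Ks : Vec (List I) k) (h : Ω → Bool) →
          (∀ (ts : Vec I k) → Pointwise _∈_ ts Ks → mass μ ≤ b * ∑ μ (λ ω → ind (h ω ∧ holds (toList ts) ω))) →
          mass μ * prodLength Ks ≤ b * ∑ μ (λ ω → ind (h ω) * prodCount Ks ω)
        average b [] h hyp = ≤-trans (≤-reflexive (*-identityʳ _)) (≤-trans (hyp [] [])
          (≤-reflexive (cong (b *_) (∑-cong μ λ ω → trans (ind-∧ (h ω) true) refl))))
        average b (K ∷ Ks) h hyp = begin
          mass μ * (length K * prodLength Ks)
            ≡⟨ e₁ (mass μ) (length K) (prodLength Ks) ⟩
          length K * (mass μ * prodLength Ks)
            ≡⟨ sumList-const K _ ⟨
          sumList K (λ _ → mass μ * prodLength Ks)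
            ≤⟨ sumList-mono K (λ t t∈ → average b Ks (λ ω → h ω ∧ G t ω) (λ ts ts∈ →
                 ≤-trans (hyp (t ∷ ts) (t∈ ∷ ts∈)) (≤-reflexive (cong (b *_) (∑-cong μ λ ω →
                   cong ind (sym (∧-assoc (h ω) _ _))))))) ⟩
          sumList K (λ t → b * ∑ μ (λ ω → ind (h ω ∧ G t ω) * prodCount Ks ω))
            ≡⟨ sumList-* K b _ ⟩
          b * sumList K (λ t → ∑ μ (λ ω → ind (h ω ∧ G t ω) * prodCount Ks ω))
            ≡⟨ cong (b *_) (∑-sumList μ K _) ⟨
          b * ∑ μ (λ ω → sumList K (λ t → ind (h ω ∧ G t ω) * prodCount Ks ω))
            ≡⟨ cong (b *_) (∑-cong μ step) ⟩
          b * ∑ μ (λ ω → ind (h ω) * (cnt K ω * prodCount Ks ω)) ∎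
          where
          open ≤-Reasoning
          e₁ : ∀ t m M → t * (m * M) ≡ m * (t * M)
          e₁ = solve-∀
          step : ∀ ω → sumList K (λ t → ind (h ω ∧ G t ω) * prodCount Ks ω) ≡ ind (h ω) * (cnt K ω * prodCount Ks ω)
          step ω = trans (sumList-*ʳ K _ (prodCount Ks ω)) (trans (cong (_* prodCount Ks ω)
            (trans (sumList-cong K (λ t _ → ind-∧ (h ω) (G t ω))) (sumList-* K (ind (h ω)) _)))
            (*-assoc (ind (h ω)) _ _))

      -- A set of indices with a distinguished core: the lists are the gaps before, between and
      -- after the core indices.
      interleave : ∀ {s} → Vec (List I) (suc s) → Vec I s → List I
      interleave (T ∷ [])         []       = T
      interleave (T ∷ Ts@(_ ∷ _)) (c ∷ cs) = T ++ c ∷ interleave Ts cs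

      split : ∀ {s} → Vec ℕ (suc s) → List I → Maybe (Vec (List I) (suc s) × Vec I s)
      split (n ∷ [])          Q = just (Q ∷ [] , [])
      split (n ∷ ns@(_ ∷ _))  Q with drop n Q
      ... | []     = nothing
      ... | c ∷ Q′ with split ns Q′
      ...   | nothing       = nothing
      ...   | just (Ts , cs) = just (take n Q ∷ Ts , c ∷ cs)

      take-++ : ∀ (T U : List I) → take (length T) (T ++ U) ≡ T
      take-++ []      U = refl
      take-++ (x ∷ T) U = cong (x ∷_) (take-++ T U)

      drop-++ : ∀ (T U : List I) → drop (length T) (T ++ U) ≡ U
      drop-++ []      U = refl
      drop-++ (x ∷ T) U = drop-++ T U

      split-interleave : ∀ {s} (Ts : Vec (List I) (suc s)) cs → split (Vec.map length Ts) (interleave Ts cs) ≡ just (Ts , cs)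
      split-interleave (T ∷ [])         []       = refl
      split-interleave (T ∷ Ts@(_ ∷ _)) (c ∷ cs)
        rewrite drop-++ T (c ∷ interleave Ts cs) | split-interleave Ts cs | take-++ T (c ∷ interleave Ts cs) = refl

      length-interleave : ∀ {s} (Ts : Vec (List I) (suc s)) cs → length (interleave Ts cs) ≡ Vec.sum (Vec.map length Ts) + s
      length-interleave (T ∷ []) [] = sym (trans (+-identityʳ _) (+-identityʳ _))
      length-interleave {suc s} (T ∷ Ts@(_ ∷ _)) (c ∷ cs) = trans (length-++ T)
        (trans (cong (λ z → length T + suc z) (length-interleave Ts cs)) (lemma (length T) (Vec.sum (Vec.map length Ts)) s))
        where
        lemma : ∀ a b s → a + suc (b + s) ≡ a + b + suc s
        lemma = solve-∀

      interleave-⊆ : ∀ {s} {Ts Ks : Vec (List I) (suc s)} (cs : Vec I s) → Pointwise _⊆_ Ts Ks → interleave Ts cs ⊆ interleave Ks cs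
      interleave-⊆ []       (p ∷ [])           = p
      interleave-⊆ (c ∷ cs) (p ∷ ps@(_ ∷ _))   = ++⁺ p (refl ∷ interleave-⊆ cs ps)

      carve : ∀ {s} (ms : Vec ℕ (suc s)) W → Vec.sum ms + s ≤ length W →
        ∃[ Ks ] ∃[ cs ] (Vec.map length Ks ≡ ms × interleave Ks cs ⊆ W)
      carve (m ∷ []) W h = take m W ∷ [] , [] , cong (_∷ []) (length-take-≡ m W h′) , take-⊆ m W
        where h′ = ≤-trans (≤-reflexive (sym (trans (+-identityʳ _) (+-identityʳ _)))) h
      carve {suc s} (m ∷ ms@(_ ∷ _)) W h with drop m W in eq
      ... | [] = ⊥-elim (<-irrefl refl (<-≤-trans lt (≤-trans (≤-reflexive (trans (sym (length-drop m W)) (cong length eq))) z≤n)))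
        where
        lt : 0 < length W ∸ m
        lt = m<n⇒0<n∸m (≤-trans (≤-trans (s≤s (≤-trans (m≤m+n m (Vec.sum ms)) (m≤m+n (m + Vec.sum ms) s))) (≤-reflexive (sym (+-suc (m + Vec.sum ms) s)))) h)
      ... | c ∷ W′ with carve ms W′ h′
        where
        h′ : Vec.sum ms + s ≤ length W′
        h′ = +-cancelˡ-≤ (suc m) _ _ (begin
          suc m + (Vec.sum ms + s)   ≡⟨ lemma m (Vec.sum ms) s ⟩
          m + Vec.sum ms + suc s     ≤⟨ h ⟩
          length W                   ≡⟨ cong length (take++drop≡id m W) ⟨
          length (take m W ++ drop m W) ≡⟨ length-++ (take m W) ⟩
          length (take m W) + length (drop m W) ≡⟨ cong₂ _+_ (length-take-≡ m W m≤) (cong length eq) ⟩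
          m + suc (length W′)        ≡⟨ +-suc m _ ⟩
          suc m + length W′          ∎)
          where
          open ≤-Reasoning
          m≤ : m ≤ length W
          m≤ = ≤-trans (≤-trans (m≤m+n m (Vec.sum ms)) (m≤m+n _ (suc s))) h
          lemma : ∀ a b s → suc a + (b + s) ≡ a + b + suc s
          lemma = solve-∀
      ... | Ks , cs , l , p = take m W ∷ Ks , c ∷ cs , cong₂ _∷_ (length-take-≡ m W m≤) l , glue Ks cs p
        where
        m≤ : m ≤ length W
        m≤ = ≤-trans (≤-trans (m≤m+n m (Vec.sum ms)) (m≤m+n _ (suc s))) h
        glue : ∀ {s} (Ks : Vec (List I) (suc s)) cs → interleave Ks cs ⊆ W′ → interleave (take m W ∷ Ks) (c ∷ cs) ⊆ W
        glue Ks@(_ ∷ _) cs p = ⊆-trans (++⁺ ⊆-refl (refl ∷ p))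
          (⊆-reflexive (trans (cong (take m W ++_) (sym eq)) (take++drop≡id m W)))

      singles : ∀ {s} → Vec I s → Vec (List I) s
      singles = Vec.map [_]

      singles-⊆ : ∀ {s} {ts : Vec I s} {Ks : Vec (List I) s} → Pointwise _∈_ ts Ks → Pointwise _⊆_ (singles ts) Ks
      singles-⊆ []       = []
      singles-⊆ (p ∷ ps) = single p ∷ singles-⊆ ps
        where
        single : ∀ {x : I} {xs} → x ∈ xs → [ x ] ⊆ xs
        single (here refl) = refl ∷ minimum _
        single (there p)   = _ ∷ʳ single p

      module _ {Ω : Set} (μ : Measure Ω) {s : ℕ} where

        measure : (Vec I s → Ω → Bool) → (Vec I s → I → Ω → Bool) → Vec I s → List I → ℕ
        measure E G c T = ∑ μ (λ ω → ind (E c ω ∧ all (λ t → G c t ω) T))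

        Alternating : (Vec I s → Ω → Bool) → (Vec I s → I → Ω → Bool) → ℕ → List I → Set
        Alternating E G b W = ∀ c ts → interleave (singles ts) c ⊆ W → mass μ ≤ b * measure E G c (toList ts)

        Gap : ℕ → (Vec I s → Ω → Bool) → (Vec I s → I → Ω → Bool) → Vec ℕ (suc s) → List I → Set
        Gap b E G ns Q = ∀ c Ts → Vec.map length Ts ≡ ns → interleave Ts c ≡ Q →
          mass μ ≤ finalBound b ns * measure E G c (List.concat (toList Ts))

        -- For a fixed shape `ns` the set `Q` determines its core, recovered by `split`. This turns
        -- `Gap` into a colouring of sets, as Ramsey requires.
        test : ℕ → (Vec I s → Ω → Bool) → (Vec I s → I → Ω → Bool) → Vec ℕ (suc s) → List I → Bool
        test b E G ns Q with split ns Q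
        ... | nothing       = false
        ... | just (Ts , c) = mass μ ≤ᵇ finalBound b ns * measure E G c (List.concat (toList Ts))

        test-true : ∀ b E G ns Q → test b E G ns Q ≡ true → Gap b E G ns Q
        test-true b E G _ _ h c Ts refl refl with split (Vec.map length Ts) (interleave Ts c) | split-interleave Ts c
        ... | _ | refl = ≤ᵇ-true h

        test-false : ∀ b E G c Ts → test b E G (Vec.map length Ts) (interleave Ts c) ≡ false →
          ¬ mass μ ≤ finalBound b (Vec.map length Ts) * measure E G c (List.concat (toList Ts))
        test-false b E G c Ts h with split (Vec.map length Ts) (interleave Ts c) | split-interleave Ts c
        ... | _ | refl = <⇒≱ (≤ᵇ-false h)

      module _ {s : ℕ} where

        private
          -- The colour `false` cannot be homogeneous: blocks of sizes `gapSizes b ns` carved out of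
          -- such a set would, by `gaps-lemma`, contain a set of shape `ns` that leaves a positive
          -- proportion.
          one-gap : ∀ n b (ns : Vec ℕ (suc s)) → Vec.sum ns + s ≡ n → ∀ n′ → ∃[ N ] ∀ {Ω : Set} (μ : Measure Ω) → 1 ≤ mass μ → ∀ E G W → N ≤ length W → Alternating μ E G b W →
            ∃[ W′ ] (W′ ⊆ W × length W′ ≡ n′ × ∀ Q → Q ⊆ W′ → length Q ≡ n → Gap μ b E G ns Q)
          one-gap n b ns ln n′ with ramsey {I} n (n′ + (Vec.sum (gapSizes b ns) + s))
          ... | N , r = N , go
            where
            go : ∀ {Ω : Set} (μ : Measure Ω) → 1 ≤ mass μ → ∀ E G W → N ≤ length W → Alternating μ E G b W → _
            go μ 1≤mass E G W hW alt with r W hW (test μ b E G ns)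
            ... | V , V⊆W , lV , true , mV = take n′ V , ⊆-trans (take-⊆ n′ V) V⊆W ,
                  length-take-≡ n′ V (≤-trans (m≤m+n n′ _) (≤-reflexive (sym lV))) ,
                  λ Q Q⊆ lQ → test-true μ b E G ns Q (mV Q (⊆-trans Q⊆ (take-⊆ n′ V)) lQ)
            ... | V , V⊆W , lV , false , mV with carve (gapSizes b ns) V (≤-trans (m≤n+m _ n′) (≤-reflexive (sym lV)))
            ...   | Ks , c , lKs , K⊆V with gaps-lemma μ (G c) b ns Ks (E c) lKs 1≤mass
                      (average μ (G c) b Ks (E c) (λ ts ts∈ →
                        alt c ts (⊆-trans (interleave-⊆ c (singles-⊆ ts∈)) (⊆-trans K⊆V V⊆W))))
            ...     | Ts , Ts⊆Ks , refl , p = ⊥-elim (test-false μ b E G c Ts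
                      (mV (interleave Ts c) (⊆-trans (interleave-⊆ c Ts⊆Ks) K⊆V) (trans (length-interleave Ts c) ln)) p)

          all-gaps : ∀ n b (nss : List (Vec ℕ (suc s))) → ∀ n′ → ∃[ N ] ∀ {Ω : Set} (μ : Measure Ω) → 1 ≤ mass μ → ∀ E G W → N ≤ length W → Alternating μ E G b W →
            ∃[ W′ ] (W′ ⊆ W × length W′ ≡ n′ × ∀ Q → Q ⊆ W′ → length Q ≡ n → ∀ ns → ns ∈ nss → Vec.sum ns + s ≡ n → Gap μ b E G ns Q)
          all-gaps n b [] n′ = n′ , λ μ 1≤mass E G W hW alt → take n′ W , take-⊆ n′ W , length-take-≡ n′ W hW , λ Q _ _ ns ()
          all-gaps n b (ns ∷ nss) n′ with all-gaps n b nss n′ | Vec.sum ns + s ≟ n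
          ... | N , r | no q = N , λ μ 1≤mass E G W hW alt → let (V , V⊆ , lV , p) = r μ 1≤mass E G W hW alt in V , V⊆ , lV ,
                  λ { Q Q⊆ lQ .ns (here refl) e → ⊥-elim (q e) ; Q Q⊆ lQ ns (there ns∈) e → p Q Q⊆ lQ ns ns∈ e }
          ... | N , r | yes q with one-gap n b ns q N
          ...   | N₁ , r₁ = N₁ , λ μ 1≤mass E G W hW alt →
                  let (V , V⊆ , lV , p) = r₁ μ 1≤mass E G W hW alt
                      (U , U⊆ , lU , p′) = r μ 1≤mass E G V (≤-reflexive (sym lV)) (λ c ts i → alt c ts (⊆-trans i V⊆))
                  in U , ⊆-trans U⊆ V⊆ , lU ,
                     λ { Q Q⊆ lQ .ns (here refl) e → p Q (⊆-trans Q⊆ U⊆) lQ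
                       ; Q Q⊆ lQ ns (there ns∈) e → p′ Q Q⊆ lQ ns ns∈ e }

        -- If every choice of one extra index per gap leaves a positive proportion of Ω, then some
        -- large set of indices does so for all of its cores simultaneously.
        thicken′ : ∀ n b → ∃[ N ] ∃[ b′ ] ∀ {Ω : Set} (μ : Measure Ω) → 1 ≤ mass μ →
            (E : Vec I s → Ω → Bool) (G : Vec I s → I → Ω → Bool) → ∀ W → N ≤ length W → Alternating μ E G b W →
          ∃[ Q ] (Q ⊆ W × length Q ≡ n × ∀ c Ts → interleave Ts c ≡ Q →
            mass μ ≤ b′ * measure μ E G c (List.concat (toList Ts)))
        thicken′ n b with allVecs (upTo (suc n)) (suc s) in eq
        ... | nss with all-gaps n b nss n
        ...   | N , r = N , sumList nss (finalBound b) , go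
          where
          bound : ∀ {ns} (nss : List (Vec ℕ (suc s))) → ns ∈ nss → finalBound b ns ≤ sumList nss (finalBound b)
          bound (_ ∷ nss) (here refl) = m≤m+n _ _
          bound (_ ∷ nss) (there p)   = ≤-trans (bound nss p) (m≤n+m _ _)
          lookup≤sum : ∀ {k} (ns : Vec ℕ k) i → Vec.lookup ns i ≤ Vec.sum ns
          lookup≤sum (n ∷ ns) zero    = m≤m+n n _
          lookup≤sum (n ∷ ns) (suc i) = ≤-trans (lookup≤sum ns i) (m≤n+m _ n)
          go : ∀ {Ω : Set} (μ : Measure Ω) → 1 ≤ mass μ → ∀ E G W → N ≤ length W → Alternating μ E G b W → _
          go μ 1≤mass E G W hW alt with r μ 1≤mass E G W hW alt
          ... | Q , Q⊆W , lQ , p = Q , Q⊆W , lQ , λ c Ts e →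
                let ns = Vec.map length Ts
                    ln = trans (sym (length-interleave Ts c)) (trans (cong length e) lQ)
                    ns∈ = subst (ns ∈_) eq (∈-allVecs ns (λ i → ∈-upTo⁺ (s≤s (≤-trans (lookup≤sum ns i)
                            (≤-trans (m≤m+n _ s) (≤-reflexive ln))))))
                in ≤-trans (p Q ⊆-refl lQ ns ns∈ ln c Ts refl e) (*-monoˡ-≤ _ (bound nss ns∈))

        abstract
          thicken : ∀ n b → ∃[ N ] ∃[ b′ ] ∀ {Ω : Set} (μ : Measure Ω) → 1 ≤ mass μ →
            (E : Vec I s → Ω → Bool) (G : Vec I s → I → Ω → Bool) → ∀ W → N ≤ length W → Alternating μ E G b W →
            ∃[ Q ] (Q ⊆ W × length Q ≡ n × ∀ c Ts → interleave Ts c ≡ Q →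
              mass μ ≤ b′ * measure μ E G c (List.concat (toList Ts)))
          thicken = thicken′

  open Thickening

  -- Choosing one vertex for each pair of indices.

  module Selecting where
    open Measure

    ∑-swap : ∀ n m (f : Fin n → Fin m → ℕ) →
      sumFin n (λ i → sumFin m (f i)) ≡ sumFin m (λ j → sumFin n (λ i → f i j))
    ∑-swap zero    m f = sym (∑-0 (uniform m))
    ∑-swap (suc n) m f = trans (cong (sumFin m (f zero) +_) (∑-swap n m (f ∘ suc)))
      (sym (sumFin-+ m (f zero) _))

    -- A reverse Markov inequality: points with 2b · h < K contribute at most half of the weighted
    -- sum, so the points with large `h` carry weight at least M / 2b.
    markov : ∀ {Ω} (μ : Measure Ω) (w h : Ω → ℕ) M K b → 1 ≤ K → ∑ μ w ≤ M →
      M * K ≤ b * ∑ μ (λ ω → w ω * h ω) → (∀ ω → h ω ≤ K) →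
      M ≤ 2 * b * ∑ μ (λ ω → w ω * ind (K ≤ᵇ 2 * b * h ω))
    markov μ w h M K@(suc _) b _ w≤M hyp h≤K = *-cancelˡ-≤ K (+-cancelˡ-≤ (K * M) _ _ (begin
      K * M + K * M                                      ≡⟨ e₁ K M ⟩
      2 * (M * K)                                        ≤⟨ *-monoʳ-≤ 2 hyp ⟩
      2 * (b * ∑ μ (λ ω → w ω * h ω))                    ≡⟨ *-assoc 2 b _ ⟨
      2 * b * ∑ μ (λ ω → w ω * h ω)                      ≡⟨ ∑-* μ (2 * b) _ ⟨
      ∑ μ (λ ω → 2 * b * (w ω * h ω))                    ≤⟨ ∑-mono μ pointwise ⟩
      ∑ μ (λ ω → K * w ω + 2 * b * K * good ω)           ≡⟨ ∑-+ μ _ _ ⟩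
      ∑ μ (λ ω → K * w ω) + ∑ μ (λ ω → 2 * b * K * good ω) ≡⟨ cong₂ _+_ (∑-* μ K w) (∑-* μ (2 * b * K) good) ⟩
      K * ∑ μ w + 2 * b * K * ∑ μ good                   ≤⟨ +-monoˡ-≤ _ (*-monoʳ-≤ K w≤M) ⟩
      K * M + 2 * b * K * ∑ μ good                       ≡⟨ cong (K * M +_) (e₂ b K (∑ μ good)) ⟩
      K * M + K * (2 * b * ∑ μ good)                     ∎))
      where
      open ≤-Reasoning
      good : _ → ℕ
      good ω = w ω * ind (K ≤ᵇ 2 * b * h ω)
      e₁ : ∀ K t → K * t + K * t ≡ 2 * (t * K)
      e₁ = solve-∀
      e₂ : ∀ b K S → 2 * b * K * S ≡ K * (2 * b * S)
      e₂ = solve-∀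
      e₃ : ∀ b w h → 2 * b * (w * h) ≡ w * (2 * b * h)
      e₃ = solve-∀
      e₄ : ∀ b w K → w * (2 * b * K) ≡ 2 * b * K * (w * 1)
      e₄ = solve-∀
      pointwise : ∀ ω → 2 * b * (w ω * h ω) ≤ K * w ω + 2 * b * K * good ω
      pointwise ω with K ≤ᵇ 2 * b * h ω in eq
      ... | true  = ≤-trans (≤-trans (≤-reflexive (e₃ b (w ω) (h ω)))
                      (≤-trans (*-monoʳ-≤ (w ω) (*-monoʳ-≤ (2 * b) (h≤K ω))) (≤-reflexive (e₄ b (w ω) K)))) (m≤n+m _ (K * w ω))
      ... | false = ≤-trans (≤-trans (≤-reflexive (e₃ b (w ω) (h ω)))
                      (≤-trans (*-monoʳ-≤ (w ω) (<⇒≤ (≤ᵇ-false eq))) (≤-reflexive (*-comm (w ω) K)))) (m≤m+n _ _)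

    module _ {I : Set} where

      decompose : ∀ {s} (c : Vec I s) {Q} → toList c ⊆ Q → ∃[ Ts ] interleave Ts c ≡ Q
      decompose []       {Q} _ = Q ∷ [] , refl
      decompose (c ∷ cs) (x ∷ʳ p) with decompose (c ∷ cs) p
      ... | (T ∷ Ts@(_ ∷ _)) , refl = (x ∷ T) ∷ Ts , refl
      decompose (c ∷ cs) (refl ∷ p) with decompose cs p
      ... | Ts@(_ ∷ _) , refl = [] ∷ Ts , refl

      ∈-interleave : ∀ {s} (Ts : Vec (List I) (suc s)) c {t} → t ∈ interleave Ts c →
        t ∈ List.concat (toList Ts) ⊎ t ∈ toList c
      ∈-interleave (T ∷ []) [] t∈ = inj₁ (∈-++⁺ˡ t∈)
      ∈-interleave (T ∷ Ts@(_ ∷ _)) (c ∷ cs) t∈ with ∈-++⁻ T t∈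
      ... | inj₁ p = inj₁ (∈-++⁺ˡ p)
      ... | inj₂ (here refl) = inj₂ (here refl)
      ... | inj₂ (there p) with ∈-interleave Ts cs p
      ...   | inj₁ q = inj₁ (∈-++⁺ʳ T q)
      ...   | inj₂ q = inj₂ (there q)

    -- The choice is total, with a default vertex if none qualifies, because the selected vertices
    -- form a function on all pairs of indices, ordered or not.
    choose-fin : ∀ {n} → 1 ≤ n → (Fin n → Bool) → Fin n
    choose-fin 1≤n p with Fin.any? (λ x → p x Bool.≟ true)
    ... | yes (x , _) = x
    ... | no _        = fromℕ< 1≤n

    choose-fin-true : ∀ {n} (1≤n : 1 ≤ n) (p : Fin n → Bool) x → p x ≡ true → p (choose-fin 1≤n p) ≡ true
    choose-fin-true 1≤n p x px with Fin.any? (λ x → p x Bool.≟ true)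
    ... | yes (_ , q) = q
    ... | no q        = ⊥-elim (q (x , px))

    module Selection (I : Set) (lt : I → I → Bool) (lt-irrefl : ∀ i → lt i i ≡ false) where

      Sorted : List I → Set
      Sorted W = ∀ {i j} → i ∷ j ∷ [] ⊆ W → lt i j ≡ true × lt j i ≡ false

      module _ {V : Set} (G₀ G₁ G₂ : I → I → I → V → Bool) where

        -- Gathers the three tests into one predicate of the extra index t by its position relative
        -- to p < q. At p and q themselves it is true, so that it may be required throughout the
        -- chosen index set.
        byGap : I → I → I → V → Bool
        byGap p q t x =
          if lt t p then G₀ t p q x else if lt p t ∧ lt t q then G₁ p t q x else if lt q t then G₂ p q t x else true

        module _ {Q} (sorted : Sorted Q) where

          byGap₀ : ∀ {t p q x} → t ∷ p ∷ q ∷ [] ⊆ Q → byGap p q t x ≡ G₀ t p q x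
          byGap₀ sub rewrite proj₁ (sorted (⊆-trans (refl ∷ refl ∷ _ ∷ʳ []) sub)) = refl

          byGap₁ : ∀ {p t q x} → p ∷ t ∷ q ∷ [] ⊆ Q → byGap p q t x ≡ G₁ p t q x
          byGap₁ sub rewrite proj₂ (sorted (⊆-trans (refl ∷ refl ∷ _ ∷ʳ []) sub))
                           | proj₁ (sorted (⊆-trans (refl ∷ refl ∷ _ ∷ʳ []) sub))
                           | proj₁ (sorted (⊆-trans (_ ∷ʳ refl ∷ refl ∷ []) sub)) = refl

          byGap₂ : ∀ {p q t x} → p ∷ q ∷ t ∷ [] ⊆ Q → byGap p q t x ≡ G₂ p q t x
          byGap₂ {p} {q} {t} sub rewrite proj₂ (sorted (⊆-trans (refl ∷ _ ∷ʳ refl ∷ []) sub))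
                           | proj₂ (sorted (⊆-trans (_ ∷ʳ refl ∷ refl ∷ []) sub))
                           | Bool.∧-zeroʳ (lt p t)
                           | proj₁ (sorted (⊆-trans (_ ∷ʳ refl ∷ refl ∷ []) sub)) = refl

          byGap-core : ∀ {p q} → p ∷ q ∷ [] ⊆ Q → ∀ x → byGap p q p x ≡ true × byGap p q q x ≡ true
          byGap-core {p} {q} sub x
            rewrite lt-irrefl p | lt-irrefl q | proj₂ (sorted sub) | Bool.∧-zeroʳ (lt p q) = refl , refl

      record Choice {V : Set} (G₀ G₁ G₂ : I → I → I → V → Bool) (W : List I) (n : ℕ) : Set where
        field
          S      : List I
          S⊆     : S ⊆ W
          size   : length S ≡ n
          pick   : I → I → V
          chosen₀ : ∀ {t p q} → t ∷ p ∷ q ∷ [] ⊆ S → G₀ t p q (pick p q) ≡ true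
          chosen₁ : ∀ {p t q} → p ∷ t ∷ q ∷ [] ⊆ S → G₁ p t q (pick p q) ≡ true
          chosen₂ : ∀ {p q t} → p ∷ q ∷ t ∷ [] ⊆ S → G₂ p q t (pick p q) ≡ true

      -- Thickening with the pair p, q as core: the vertices of V_pq that pass the tests of all
      -- other indices form a positive proportion, so one of them can be picked.
      select′ : ∀ n b → ∃[ N ] ∀ L → 1 ≤ L → (G₀ G₁ G₂ : I → I → I → Fin L → Bool) → ∀ W → Sorted W → N ≤ length W →
        (∀ {t₀ p t₁ q t₂} → t₀ ∷ p ∷ t₁ ∷ q ∷ t₂ ∷ [] ⊆ W →
          L ≤ b * sumFin L (λ x → ind (G₀ t₀ p q x ∧ (G₁ p t₁ q x ∧ G₂ p q t₂ x)))) →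
        Choice G₀ G₁ G₂ W n
      select′ n b with thicken {I} {2} n b
      ... | N , b′ , thick = N , go
        where
        module _ (L : ℕ) (1≤L : 1 ≤ L) (G₀ G₁ G₂ : I → I → I → Fin L → Bool) (W : List I) (sorted : Sorted W) (hW : N ≤ length W)
          (hyp : ∀ {t₀ p t₁ q t₂} → t₀ ∷ p ∷ t₁ ∷ q ∷ t₂ ∷ [] ⊆ W →
            L ≤ b * sumFin L (λ x → ind (G₀ t₀ p q x ∧ (G₁ p t₁ q x ∧ G₂ p q t₂ x)))) where
          V = Fin L
          μ = uniform L
          1≤mass : 1 ≤ mass μ
          1≤mass = ≤-trans 1≤L (≤-reflexive (sym (sumFin-1 L)))
          E : Vec I 2 → V → Bool
          E _ _ = true
          G : Vec I 2 → I → V → Bool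
          G (p ∷ q ∷ []) = byGap G₀ G₁ G₂ p q
          alt : Alternating μ E G b W
          alt (p ∷ q ∷ []) (t₀ ∷ t₁ ∷ t₂ ∷ []) sub = ≤-trans (≤-reflexive (sumFin-1 L)) (≤-trans (hyp sub)
            (*-monoʳ-≤ b (∑-mono μ λ x → ≤-reflexive (cong ind (sym (cong₂ _∧_
              (byGap₀ G₀ G₁ G₂ sorted (⊆-trans (refl ∷ refl ∷ _ ∷ʳ refl ∷ _ ∷ʳ []) sub)) (cong₂ _∧_
              (byGap₁ G₀ G₁ G₂ sorted (⊆-trans (_ ∷ʳ refl ∷ refl ∷ refl ∷ _ ∷ʳ []) sub))
              (trans (Bool.∧-identityʳ _)
              (byGap₂ G₀ G₁ G₂ sorted (⊆-trans (_ ∷ʳ refl ∷ _ ∷ʳ refl ∷ refl ∷ []) sub))))))))))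
          result : _
          result with thick μ 1≤mass E G W hW alt
          ... | Q , Q⊆W , lQ , big = record
            { S = Q ; S⊆ = Q⊆W ; size = lQ ; pick = X
            ; chosen₀ = λ {t} {p} {q} sub → trans (sym (byGap₀ G₀ G₁ G₂ sortedQ sub))
                (prop (⊆-trans (_ ∷ʳ refl ∷ refl ∷ []) sub) (lookup sub (here refl)))
            ; chosen₁ = λ {p} {t} {q} sub → trans (sym (byGap₁ G₀ G₁ G₂ sortedQ sub))
                (prop (⊆-trans (refl ∷ _ ∷ʳ refl ∷ []) sub) (lookup sub (there (here refl))))
            ; chosen₂ = λ {p} {q} {t} sub → trans (sym (byGap₂ G₀ G₁ G₂ sortedQ sub))
                (prop (⊆-trans (refl ∷ refl ∷ _ ∷ʳ []) sub) (lookup sub (there (there (here refl)))))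
            }
            where
            sortedQ : Sorted Q
            sortedQ s = sorted (⊆-trans s Q⊆W)
            good : I → I → V → Bool
            good p q x = all (λ t → byGap G₀ G₁ G₂ p q t x) Q
            X : I → I → V
            X p q = choose-fin 1≤L (good p q)
            1≤ : ∀ {k} → L ≤ b′ * k → 1 ≤ k
            1≤ {zero}  h = ⊥-elim (<-irrefl refl (≤-trans (≤-trans 1≤L h) (≤-reflexive (*-zeroʳ b′))))
            1≤ {suc k} h = s≤s z≤n
            exists : ∀ {p q} → p ∷ q ∷ [] ⊆ Q → ∃[ x ] good p q x ≡ true
            exists {p} {q} sub with decompose (p ∷ q ∷ []) sub
            ... | Ts , e with ∑-witness μ _ (1≤ (≤-trans (≤-reflexive (sym (sumFin-1 L))) (big (p ∷ q ∷ []) Ts e)))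
            ...   | x , h = x , all-intro (λ t → byGap G₀ G₁ G₂ p q t x) Q each
              where
              each : ∀ t → t ∈ Q → byGap G₀ G₁ G₂ p q t x ≡ true
              each t t∈ with ∈-interleave Ts (p ∷ q ∷ []) (subst (t ∈_) (sym e) t∈)
              ... | inj₁ i                   = all-∈ (λ t → byGap G₀ G₁ G₂ p q t x) (ind-true h) i
              ... | inj₂ (here refl)         = proj₁ (byGap-core G₀ G₁ G₂ sortedQ sub x)
              ... | inj₂ (there (here refl)) = proj₂ (byGap-core G₀ G₁ G₂ sortedQ sub x)
            prop : ∀ {p q} → p ∷ q ∷ [] ⊆ Q → ∀ {t} → t ∈ Q → byGap G₀ G₁ G₂ p q t (X p q) ≡ true
            prop {p} {q} sub with exists sub
            ... | x , gx = λ t∈ → all-∈ (λ t → byGap G₀ G₁ G₂ p q t (X p q)) (choose-fin-true 1≤L (good p q) x gx) t∈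
        go : _
        go = result

      abstract
        select : ∀ n b → ∃[ N ] ∀ L → 1 ≤ L → (G₀ G₁ G₂ : I → I → I → Fin L → Bool) → ∀ W → Sorted W → N ≤ length W →
          (∀ {t₀ p t₁ q t₂} → t₀ ∷ p ∷ t₁ ∷ q ∷ t₂ ∷ [] ⊆ W →
            L ≤ b * sumFin L (λ x → ind (G₀ t₀ p q x ∧ (G₁ p t₁ q x ∧ G₂ p q t₂ x)))) →
          Choice G₀ G₁ G₂ W n
        select = select′

    -- Transfer from reference tests to other tests with the same correlations.

    module _ {L : ℕ} where
      private
        V = Fin L
        μ = uniform L

      corr : (V → Bool) → (V → Bool) → ℕ
      corr f g = sumFin L (λ v → ind (f v) * ind (g v))

      ind² : ∀ b → ind b * ind b ≡ ind b
      ind² true  = refl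
      ind² false = refl

      tally : ∀ {A : Set} → (A → V → Bool) → List A → V → ℕ
      tally f as v = sumList as (λ a → ind (f a v))

      module _ {A : Set} (f : A → V → Bool) (K C : ℕ) where

        Upper : A → A → Set
        Upper a b = K * corr (f a) (f b) ≤ suc C * L

        corr-tally : ∀ a bs → sumFin L (λ v → ind (f a v) * tally f bs v) ≡ sumList bs (λ b → corr (f a) (f b))
        corr-tally a bs = trans (∑-cong μ (λ v → sym (sumList-* bs (ind (f a v)) _))) (∑-sumList μ bs _)

        square-upper : ∀ {as} → AllPairs Upper as →
          K * sumFin L (λ v → tally f as v * tally f as v) ≤ K * length as * L + length as * length as * (suc C * L)
        square-upper [] = ≤-trans (≤-reflexive (trans (cong (K *_) (∑-0 μ)) (*-zeroʳ K))) z≤n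
        square-upper {a ∷ as} (px ∷ ps) = begin
          K * sumFin L (λ v → tally f (a ∷ as) v * tally f (a ∷ as) v)
            ≡⟨ cong (K *_) (∑-cong μ expand) ⟩
          K * sumFin L (λ v → ind (f a v) + (2 * (ind (f a v) * tally f as v) + tally f as v * tally f as v))
            ≡⟨ cong (K *_) (trans (∑-+ μ _ _) (cong (sumFin L (λ v → ind (f a v)) +_)
                 (trans (∑-+ μ _ _) (cong (_+ S) (∑-* μ 2 _))))) ⟩
          K * (sumFin L (λ v → ind (f a v)) + (2 * M + S))
            ≡⟨ distr K _ M S ⟩
          K * sumFin L (λ v → ind (f a v)) + (2 * (K * M) + K * S)
            ≤⟨ +-mono-≤ (*-monoʳ-≤ K (≤-trans (∑-mono μ (λ v → ind≤1 (f a v))) (≤-reflexive (sumFin-1 L))))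
                 (+-mono-≤ (*-monoʳ-≤ 2 cross) (square-upper ps)) ⟩
          K * L + (2 * (length as * (suc C * L)) + (K * length as * L + length as * length as * (suc C * L)))
            ≤⟨ m≤m+n _ (suc C * L) ⟩
          K * L + (2 * (length as * (suc C * L)) + (K * length as * L + length as * length as * (suc C * L))) + suc C * L
            ≡⟨ collect K L (length as) (suc C * L) ⟩
          K * length (a ∷ as) * L + length (a ∷ as) * length (a ∷ as) * (suc C * L) ∎
          where
          open ≤-Reasoning
          M = sumFin L (λ v → ind (f a v) * tally f as v)
          S = sumFin L (λ v → tally f as v * tally f as v)
          expand : ∀ v → tally f (a ∷ as) v * tally f (a ∷ as) v ≡
            ind (f a v) + (2 * (ind (f a v) * tally f as v) + tally f as v * tally f as v)
          expand v = trans (e (ind (f a v)) (tally f as v)) (cong (_+ (2 * (ind (f a v) * tally f as v) + tally f as v * tally f as v)) (ind² (f a v)))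
            where
            e : ∀ x X → (x + X) * (x + X) ≡ x * x + (2 * (x * X) + X * X)
            e = solve-∀
          distr : ∀ K x M S → K * (x + (2 * M + S)) ≡ K * x + (2 * (K * M) + K * S)
          distr = solve-∀
          collect : ∀ K L n D → K * L + (2 * (n * D) + (K * n * L + n * n * D)) + D ≡ K * suc n * L + suc n * suc n * D
          collect = solve-∀
          cross : K * M ≤ length as * (suc C * L)
          cross = begin
            K * M                                        ≡⟨ cong (K *_) (corr-tally a as) ⟩
            K * sumList as (λ b → corr (f a) (f b))      ≡⟨ sumList-* as K _ ⟨
            sumList as (λ b → K * corr (f a) (f b))      ≤⟨ sumList-mono as (λ b b∈ → All.lookup px b∈) ⟩
            sumList as (λ _ → suc C * L)                 ≡⟨ sumList-const as _ ⟩
            length as * (suc C * L)                      ∎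

        cross-lower : ∀ as bs → (∀ {a b} → a ∈ as → b ∈ bs → C * L ≤ K * corr (f a) (f b)) →
          length as * length bs * (C * L) ≤ K * sumFin L (λ v → tally f as v * tally f bs v)
        cross-lower as bs h = begin
          length as * length bs * (C * L)                  ≡⟨ *-assoc (length as) _ _ ⟩
          length as * (length bs * (C * L))                ≡⟨ sumList-const as _ ⟨
          sumList as (λ _ → length bs * (C * L))           ≤⟨ sumList-mono as (λ a a∈ → ≤-trans
              (≤-trans (≤-reflexive (sym (sumList-const bs _))) (sumList-mono bs (λ b b∈ → h a∈ b∈)))
              (≤-reflexive (trans (sumList-* bs K _) (cong (K *_) (sym (corr-tally a bs)))))) ⟩
          sumList as (λ a → K * sumFin L (λ v → ind (f a v) * tally f bs v))   ≡⟨ sumList-* as K _ ⟩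
          K * sumList as (λ a → sumFin L (λ v → ind (f a v) * tally f bs v))   ≡⟨ cong (K *_) (∑-sumList μ as _) ⟨
          K * sumFin L (λ v → sumList as (λ a → ind (f a v) * tally f bs v))   ≡⟨ cong (K *_) (∑-cong μ (λ v → sumList-*ʳ as _ _)) ⟩
          K * sumFin L (λ v → tally f as v * tally f bs v)     ∎
          where open ≤-Reasoning

        -- (X - Y - κ)² ≥ 0, arranged so that no subtraction occurs.
        square-gap : ∀ b X Y κ → ind b * (2 * κ * X) + 2 * (X * Y) ≤ ind b * (2 * κ * Y) + (X * X + Y * Y + κ * κ)
        square-gap false X Y κ = ≤-trans (amgm X Y) (m≤m+n _ _)
        square-gap true  X Y κ = ≤-trans (≤-reflexive (e₁ X Y κ)) (≤-trans (amgm X (Y + κ)) (≤-reflexive (e₂ X Y κ)))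
          where
          e₁ : ∀ X Y κ → 1 * (2 * κ * X) + 2 * (X * Y) ≡ 2 * (X * (Y + κ))
          e₁ = solve-∀
          e₂ : ∀ X Y κ → X * X + (Y + κ) * (Y + κ) ≡ 1 * (2 * κ * Y) + (X * X + Y * Y + κ * κ)
          e₂ = solve-∀

        module _ (as bs : List A) (las : length as ≡ K) (lbs : length bs ≡ K)
          (pas : AllPairs Upper as) (pbs : AllPairs Upper bs)
          (low : ∀ {a b} → a ∈ as → b ∈ bs → C * L ≤ K * corr (f a) (f b)) (g : V → Bool) where

          gX gY : ℕ
          gX = sumFin L (λ v → ind (g v) * tally f as v)
          gY = sumFin L (λ v → ind (g v) * tally f bs v)

          -- Correlations inside `as`, inside `bs` and across agree up to L / K. Hence ∑ (X - Y)² is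
          -- at most 4KL for the two tallies X and Y, against the trivial K²L. Through `square-gap`
          -- the tallies then have nearly the same sum over the set `g`.
          compare : ∀ κ → K * (2 * κ * gX) ≤ K * (2 * κ * gY) + (4 * (K * (K * L)) + K * (κ * κ * L))
          compare κ = +-cancelʳ-≤ (2 * (K * K * (C * L))) _ _ (begin
            K * (2 * κ * gX) + 2 * (K * K * (C * L))
              ≤⟨ +-monoʳ-≤ (K * (2 * κ * gX)) (*-monoʳ-≤ 2 (subst₂ (λ x y → x * y * (C * L) ≤ K * XY) las lbs (cross-lower as bs low))) ⟩
            K * (2 * κ * gX) + 2 * (K * XY)
              ≡⟨ e₁ K (2 * κ * gX) XY ⟩
            K * (2 * κ * gX + 2 * XY)
              ≤⟨ *-monoʳ-≤ K summed ⟩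
            K * (2 * κ * gY + (XX + YY + κ * κ * L))
              ≡⟨ e₂ K (2 * κ * gY) XX YY (κ * κ * L) ⟩
            K * (2 * κ * gY) + (K * XX + K * YY + K * (κ * κ * L))
              ≤⟨ +-monoʳ-≤ (K * (2 * κ * gY)) (+-monoˡ-≤ _ (+-mono-≤
                   (subst (λ n → K * XX ≤ K * n * L + n * n * (suc C * L)) las (square-upper pas))
                   (subst (λ n → K * YY ≤ K * n * L + n * n * (suc C * L)) lbs (square-upper pbs)))) ⟩
            K * (2 * κ * gY) + (K * K * L + K * K * (suc C * L) + (K * K * L + K * K * (suc C * L)) + K * (κ * κ * L))
              ≡⟨ e₃ K L C (K * (2 * κ * gY)) (K * (κ * κ * L)) ⟩
            K * (2 * κ * gY) + (4 * (K * (K * L)) + K * (κ * κ * L)) + 2 * (K * K * (C * L)) ∎)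
            where
            open ≤-Reasoning
            XX = sumFin L (λ v → tally f as v * tally f as v)
            YY = sumFin L (λ v → tally f bs v * tally f bs v)
            XY = sumFin L (λ v → tally f as v * tally f bs v)
            e₁ : ∀ K x y → K * x + 2 * (K * y) ≡ K * (x + 2 * y)
            e₁ = solve-∀
            e₂ : ∀ K a x y c → K * (a + (x + y + c)) ≡ K * a + (K * x + K * y + K * c)
            e₂ = solve-∀
            e₃ : ∀ K L C a c → a + (K * K * L + K * K * (suc C * L) + (K * K * L + K * K * (suc C * L)) + c) ≡
              a + (4 * (K * (K * L)) + c) + 2 * (K * K * (C * L))
            e₃ = solve-∀
            pull : ∀ h → sumFin L (λ v → ind (g v) * (2 * κ * h v)) ≡ 2 * κ * sumFin L (λ v → ind (g v) * h v)
            pull h = trans (∑-cong μ (λ v → trans (sym (*-assoc (ind (g v)) (2 * κ) (h v)))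
              (trans (cong (_* h v) (*-comm (ind (g v)) (2 * κ))) (*-assoc (2 * κ) _ _)))) (∑-* μ (2 * κ) _)
            summed : 2 * κ * gX + 2 * XY ≤ 2 * κ * gY + (XX + YY + κ * κ * L)
            summed = begin
              2 * κ * gX + 2 * XY
                ≡⟨ cong₂ _+_ (sym (pull (tally f as))) (sym (∑-* μ 2 _)) ⟩
              sumFin L (λ v → ind (g v) * (2 * κ * tally f as v)) + sumFin L (λ v → 2 * (tally f as v * tally f bs v))
                ≡⟨ ∑-+ μ _ _ ⟨
              sumFin L (λ v → ind (g v) * (2 * κ * tally f as v) + 2 * (tally f as v * tally f bs v))
                ≤⟨ ∑-mono μ (λ v → square-gap (g v) (tally f as v) (tally f bs v) κ) ⟩
              sumFin L (λ v → ind (g v) * (2 * κ * tally f bs v) + (tally f as v * tally f as v + tally f bs v * tally f bs v + κ * κ))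
                ≡⟨ trans (∑-+ μ _ _) (cong₂ _+_ (pull (tally f bs)) (trans (∑-+ μ _ _) (cong₂ _+_ (∑-+ μ _ _)
                     (trans (∑-const μ (κ * κ)) (cong (κ * κ *_) (sumFin-1 L)))))) ⟩
              2 * κ * gY + (XX + YY + κ * κ * L) ∎

          -- A set correlating with the tests of `as` correlates with some test of `bs`. Otherwise
          -- gX and gY would differ by at least KL/4b - KL/8b = 4KL/32b. But `compare` allows only
          -- 4KL/2κ + κL/2, which is 3KL/32b for κ = 32b and K = 512b². After clearing denominators
          -- this is 128 against 112.
          promote : 1 ≤ L → ∀ b₀ → let b = suc b₀ in K ≡ 512 * (b * b) → K * L ≤ 4 * b * gX →
            (∀ {c} → c ∈ bs → 8 * b * sumFin L (λ v → ind (g v) * ind (f c v)) ≤ L) → ⊥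
          promote 1≤L b₀ eK big small = <-irrefl refl (begin-strict
            112 * b * (K * L)                                  <⟨ *-monoˡ-< (K * L) ⦃ KL≢0 ⦄ (*-monoˡ-< b (from112 )) ⟩
            128 * b * (K * L)                                  ≡⟨ e₁ b (K * L) ⟩
            4 * κ * (K * L)                                    ≤⟨ *-monoʳ-≤ (4 * κ) big ⟩
            4 * κ * (4 * b * gX)                               ≡⟨ e₂ κ b gX ⟩
            8 * b * (2 * κ * gX)                               ≤⟨ *-monoʳ-≤ (8 * b) divided ⟩
            8 * b * (2 * κ * gY + (4 * (K * L) + κ * κ * L))   ≡⟨ e₃ b κ gY (K * L) (κ * κ * L) ⟩
            2 * κ * (8 * b * gY) + (32 * b * (K * L) + 8 * b * (κ * κ * L))
              ≤⟨ +-monoˡ-≤ _ (*-monoʳ-≤ (2 * κ) smallY) ⟩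
            2 * κ * (K * L) + (32 * b * (K * L) + 8 * b * (κ * κ * L))
              ≡⟨ cong (λ z → 2 * κ * (K * L) + (32 * b * (K * L) + z)) (trans (e₄ b L) (cong (λ z → 16 * b * (z * L)) (sym eK))) ⟩
            2 * κ * (K * L) + (32 * b * (K * L) + 16 * b * (K * L))   ≡⟨ e₅ b (K * L) ⟩
            112 * b * (K * L)                                  ∎)
            where
            open ≤-Reasoning
            b = suc b₀
            κ = 32 * b
            from112 : 112 < 128
            from112 = ≤ᵇ⇒≤ 113 128 _
            K≢0 : NonZero K
            K≢0 = subst NonZero (sym eK) _
            KL≢0 : NonZero (K * L)
            KL≢0 = m*n≢0 K L ⦃ K≢0 ⦄ ⦃ >-nonZero 1≤L ⦄
            e₁ : ∀ b x → 128 * b * x ≡ 4 * (32 * b) * x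
            e₁ = solve-∀
            e₂ : ∀ κ b x → 4 * κ * (4 * b * x) ≡ 8 * b * (2 * κ * x)
            e₂ = solve-∀
            e₃ : ∀ b κ y k c → 8 * b * (2 * κ * y + (4 * k + c)) ≡ 2 * κ * (8 * b * y) + (32 * b * k + 8 * b * c)
            e₃ = solve-∀
            e₄ : ∀ b l → 8 * b * (32 * b * (32 * b) * l) ≡ 16 * b * (512 * (b * b) * l)
            e₄ = solve-∀
            e₅ : ∀ b k → 2 * (32 * b) * k + (32 * b * k + 16 * b * k) ≡ 112 * b * k
            e₅ = solve-∀
            divided : 2 * κ * gX ≤ 2 * κ * gY + (4 * (K * L) + κ * κ * L)
            divided = *-cancelˡ-≤ K ⦃ K≢0 ⦄ (≤-trans (compare κ) (≤-reflexive (e K (2 * κ * gY) (K * L) (κ * κ * L))))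
              where
              e : ∀ K a x c → K * a + (4 * (K * x) + K * c) ≡ K * (a + (4 * x + c))
              e = solve-∀
            smallY : 8 * b * gY ≤ K * L
            smallY = begin
              8 * b * gY
                ≡⟨ cong (8 * b *_) (trans (∑-cong μ (λ v → sym (sumList-* bs (ind (g v)) _))) (∑-sumList μ bs _)) ⟩
              8 * b * sumList bs (λ c → sumFin L (λ v → ind (g v) * ind (f c v)))
                ≡⟨ sumList-* bs (8 * b) _ ⟨
              sumList bs (λ c → 8 * b * sumFin L (λ v → ind (g v) * ind (f c v)))
                ≤⟨ sumList-mono bs (λ c c∈ → small c∈) ⟩
              sumList bs (λ _ → L)  ≡⟨ sumList-const bs L ⟩
              length bs * L         ≡⟨ cong (_* L) lbs ⟩
              K * L                 ∎

  open Selecting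

  -- Choosing the vertices of all triads simultaneously.

  module Extracting where
    open Measure

    single : ∀ {A : Set} {x : A} {xs} → x ∈ xs → [ x ] ⊆ xs
    single (here refl) = refl ∷ minimum _
    single (there p)   = _ ∷ʳ single p

    skip : ∀ {A : Set} (zs : List A) {xs ys} → xs ⊆ ys → xs ⊆ zs ++ ys
    skip zs p = ++⁺ (minimum zs) p

    cut : ∀ {A : Set} a b (W : List A) → length W ≡ a + b → ∃[ U ] ∃[ V ] (U ++ V ≡ W × length U ≡ a × length V ≡ b)
    cut zero    b W       h = [] , W , refl , refl , h
    cut (suc a) b (x ∷ W) h with cut a b W (suc-injective h)
    ... | U , V , refl , lU , lV = x ∷ U , V , refl , cong suc lU , lV

    ∈-zip : ∀ {A B : Set} {x : A} {y : B} {xs ys} → (x , y) ∈ zip xs ys → x ∈ xs × y ∈ ys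
    ∈-zip {xs = _ ∷ _} {_ ∷ _} (here refl) = here refl , here refl
    ∈-zip {xs = _ ∷ _} {_ ∷ _} (there p)   = let (a , b) = ∈-zip p in there a , there b

    zip-AllPairs : ∀ {A B : Set} {P : A × B → A × B → Set} (xs : List A) (ys : List B) →
      (∀ {x x′ y y′} → x ∷ x′ ∷ [] ⊆ xs → y ∷ y′ ∷ [] ⊆ ys → P (x , y) (x′ , y′)) → AllPairs P (zip xs ys)
    zip-AllPairs []       ys       h = []
    zip-AllPairs (x ∷ xs) []       h = []
    zip-AllPairs (x ∷ xs) (y ∷ ys) h =
      All.tabulate (λ p → let (a , b) = ∈-zip p in h (refl ∷ single a) (refl ∷ single b)) ∷
      zip-AllPairs xs ys (λ p q → h (_ ∷ʳ p) (_ ∷ʳ q))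

    length-zip : ∀ {A B : Set} (xs : List A) (ys : List B) {k} → length xs ≡ k → length ys ≡ k → length (zip xs ys) ≡ k
    length-zip []       []       refl e = refl
    length-zip (x ∷ xs) (y ∷ ys) refl e = cong suc (length-zip xs ys refl (suc-injective e))

    floor-bounds : ∀ (K x L : ℕ) .⦃ _ : NonZero L ⦄ {C} → (K * x) / L ≡ C → C * L ≤ K * x × K * x ≤ suc C * L
    floor-bounds K x L refl = m/n*n≤m (K * x) L , ≤-trans (≤-reflexive (m≡m%n+[m/n]*n (K * x) L))
      (+-monoˡ-≤ _ (<⇒≤ (m%n<n (K * x) L)))

    ∧-swap : ∀ a b c d → ind (a ∧ b) * ind (c ∧ d) ≡ ind (a ∧ d) * ind (c ∧ b)
    ∧-swap a b c d rewrite ind-∧ a b | ind-∧ c d | ind-∧ a d | ind-∧ c b = e (ind a) (ind b) (ind c) (ind d)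
      where
      e : ∀ a b c d → a * b * (c * d) ≡ a * d * (c * b)
      e = solve-∀

    module Extraction (I : Set) (lt : I → I → Bool) (lt-irrefl : ∀ i → lt i i ≡ false) where

      module Size (L : ℕ) (1≤L : 1 ≤ L) where

        private instance
          L≢0 : NonZero L
          L≢0 = >-nonZero 1≤L

        V : Set
        V = Fin L

        μ : Measure V
        μ = uniform L

        ⟨_⟩ : (V → ℕ) → ℕ
        ⟨_⟩ = sumFin L

        -- The relation `F` concerns vertices x, y, z of ij, ik, jk in the triad ijk. The other
        -- tests concern each vertex in the two roles that it does not play there, with one extra
        -- index: `leftR`, for instance, tests the left vertex x as the right vertex of a triad
        -- t₀ij.
        record Tests : Set where
          field
            F : I → I → I → V → V → V → Bool
            leftR leftM midR midL rightM rightL : I → I → I → V → Bool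

        open Tests public

        weight : Tests → (r t₀ i t₁ j m k l l′ : I) → V → V → V → ℕ
        weight Te r t₀ i t₁ j m k l l′ x y z = ind (leftR Te t₀ i j x ∧ leftM Te i t₁ j x) *
          (ind (F Te i j k x y z) * (ind (midR Te r i k y ∧ midL Te i k l y) * ind (rightM Te j m k z ∧ rightL Te j k l′ z)))

        -- The six extra indices are placed where their tests need them: r and t₀ before i, t₁
        -- between i and j, m between j and k, l and l′ after k. One such order suffices as
        -- hypothesis.
        Dense : Tests → ℕ → List I → Set
        Dense Te b W = ∀ {r t₀ i t₁ j m k l l′} → r ∷ t₀ ∷ i ∷ t₁ ∷ j ∷ m ∷ k ∷ l ∷ l′ ∷ [] ⊆ W →
          L * (L * L) ≤ b * ⟨ (λ x → ⟨ (λ y → ⟨ (λ z → weight Te r t₀ i t₁ j m k l l′ x y z) ⟩) ⟩) ⟩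

        record System (Te : Tests) (S : List I) : Set where
          field
            X Y Z : I → I → V
            edge   : ∀ {i j k} → i ∷ j ∷ k ∷ [] ⊆ S → F Te i j k (X i j) (Y i k) (Z j k) ≡ true
            testLR : ∀ {t p q} → t ∷ p ∷ q ∷ [] ⊆ S → leftR Te t p q (X p q) ≡ true
            testLM : ∀ {p t q} → p ∷ t ∷ q ∷ [] ⊆ S → leftM Te p t q (X p q) ≡ true
            testMR : ∀ {t p q} → t ∷ p ∷ q ∷ [] ⊆ S → midR Te t p q (Y p q) ≡ true
            testML : ∀ {p q t} → p ∷ q ∷ t ∷ [] ⊆ S → midL Te p q t (Y p q) ≡ true
            testRM : ∀ {p t q} → p ∷ t ∷ q ∷ [] ⊆ S → rightM Te p t q (Z p q) ≡ true
            testRL : ∀ {p q t} → p ∷ q ∷ t ∷ [] ⊆ S → rightL Te p q t (Z p q) ≡ true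

        pairβ pairγ : Tests → I → I → I × I → V → Bool
        pairβ Te i k (r , l) y = midR Te r i k y ∧ midL Te i k l y
        pairγ Te j k (m , l) z = rightM Te j m k z ∧ rightL Te j k l z

        -- Correlation of the tests of one vertex for two pairs of extra indices, in units of 1/K
        -- and rounded down. Ramsey makes it constant, as `promote` demands.
        twinβ twinγ : Tests → ℕ → List I → ℕ
        twinβ Te K (r ∷ r′ ∷ i ∷ k ∷ l ∷ l′ ∷ []) = (K * corr (pairβ Te i k (r , l)) (pairβ Te i k (r′ , l′))) / L
        twinβ Te K _ = 0
        twinγ Te K (j ∷ m ∷ m′ ∷ k ∷ l ∷ l′ ∷ []) = (K * corr (pairγ Te j k (m , l)) (pairγ Te j k (m′ , l′))) / L
        twinγ Te K _ = 0

        floor-∈ : ∀ K (f g : V → Bool) → (K * corr f g) / L ∈ upTo (suc K)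
        floor-∈ K f g = ∈-upTo⁺ (s≤s (≤-trans (/-monoˡ-≤ L (*-monoʳ-≤ K
          (≤-trans (∑-mono μ (λ v → *-mono-≤ (ind≤1 (f v)) (ind≤1 (g v)))) (≤-reflexive (sumFin-1 L)))))
          (≤-reflexive (m*n/n≡m K L))))

        twinβ-∈ : ∀ Te K Q → length Q ≡ 6 → twinβ Te K Q ∈ upTo (suc K)
        twinβ-∈ Te K (r ∷ r′ ∷ i ∷ k ∷ l ∷ l′ ∷ []) refl = floor-∈ K (pairβ Te i k (r , l)) (pairβ Te i k (r′ , l′))

        twinγ-∈ : ∀ Te K Q → length Q ≡ 6 → twinγ Te K Q ∈ upTo (suc K)
        twinγ-∈ Te K (j ∷ m ∷ m′ ∷ k ∷ l ∷ l′ ∷ []) refl = floor-∈ K (pairγ Te j k (m , l)) (pairγ Te j k (m′ , l′))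

      -- An index together with the reference indices following it.
      J : Set
      J = I × List I

      ι : J → I
      ι = proj₁

      open Selection J (λ a b → lt (ι a) (ι b)) (λ a → lt-irrefl (ι a)) using (select; Choice)
      open Choice

      SortedI : List I → Set
      SortedI W = ∀ {i j} → i ∷ j ∷ [] ⊆ W → lt i j ≡ true × lt j i ≡ false

      flat : List J → List I
      flat []            = []
      flat ((i , B) ∷ Q) = i ∷ B ++ flat Q

      flat-⊆ : ∀ {Q Q′} → Q ⊆ Q′ → flat Q ⊆ flat Q′
      flat-⊆ []                     = []
      flat-⊆ ((i , B) ∷ʳ p)         = _ ∷ʳ skip B (flat-⊆ p)
      flat-⊆ {(i , B) ∷ _} (refl ∷ p) = refl ∷ ++⁺ ⊆-refl (flat-⊆ p)

      head : ∀ q Q {xs} → xs ⊆ flat Q → ι q ∷ xs ⊆ flat (q ∷ Q)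
      head (i , B) Q p = refl ∷ skip B p

      head+ : ∀ q Q {xs ms} → ms ⊆ proj₂ q → xs ⊆ flat Q → ι q ∷ ms ++ xs ⊆ flat (q ∷ Q)
      head+ q Q ms⊆ p = refl ∷ ++⁺ ms⊆ p

      heads : ∀ Q → map ι Q ⊆ flat Q
      heads []            = []
      heads ((i , B) ∷ Q) = refl ∷ skip B (heads Q)

      chunk : ∀ K n W → length W ≡ n * suc K →
        ∃[ Ws ] (flat Ws ≡ W × length Ws ≡ n × ∀ {q} → q ∈ Ws → length (proj₂ q) ≡ K)
      chunk K zero    []      h = [] , refl , refl , λ ()
      chunk K (suc n) (x ∷ W) h with cut K (n * suc K) W (suc-injective h)
      ... | B , W′ , refl , lB , lW with chunk K n W′ lW
      ...   | Ws , refl , lWs , lBs = (x , B) ∷ Ws , refl , cong suc lWs , λ { (here refl) → lB ; (there p) → lBs p }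

      -- Indices are recovered up to incomparability, which in sorted lists is equality.
      find : List J → I → J
      find []      i = i , []
      find (q ∷ S) i = if lt (ι q) i then find S i else q

      find-∈ : ∀ {S} → (∀ {i j} → i ∷ j ∷ [] ⊆ S → lt (ι i) (ι j) ≡ true) → ∀ {q} → q ∈ S → find S (ι q) ≡ q
      find-∈ {p ∷ S} h (here refl) rewrite lt-irrefl (ι p) = refl
      find-∈ {p ∷ S} h (there q∈) rewrite h (refl ∷ single q∈) = find-∈ (λ s → h (_ ∷ʳ s)) q∈

      map-ι-⊆ : ∀ {S Q} → Q ⊆ map ι S → ∃[ Q′ ] (Q′ ⊆ S × map ι Q′ ≡ Q)
      map-ι-⊆ {[]}    []         = [] , [] , refl
      map-ι-⊆ {p ∷ S} (_ ∷ʳ s)   = let (Q , a , e) = map-ι-⊆ s in Q , _ ∷ʳ a , e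
      map-ι-⊆ {p ∷ S} (refl ∷ s) = let (Q , a , e) = map-ι-⊆ s in p ∷ Q , refl ∷ a , cong (ι p ∷_) e

      module Sized (n b₀ K : ℕ) (eK : K ≡ 512 * (suc b₀ * suc b₀)) where

        b = suc b₀
        -- Two blocks of K test indices and a core of three indices, the configuration that refutes
        -- a homogeneous negative colour.
        spare = K + K + 3

        -- The bounds are composed backwards. First x is chosen by `σ₁`, then z by `σ₂`, finally y
        -- by `σ₃`; before the last two choices `ρ₂` and `ρ₃` pass from reference indices to actual
        -- ones. The loss 2b comes from `markov`, the loss 8b from `promote`.
        σ₃ = select n (8 * b)
        ρ₃ = ramsey {J} 5 (proj₁ σ₃ + spare)
        σ₂ = select (proj₁ ρ₃) (8 * b)
        ρ₂ = ramsey {J} 5 (proj₁ σ₂ + spare)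
        σ₁ = select (proj₁ ρ₂) (2 * b)
        -- Layout: K references in front for r, then indices each followed by K references for m,
        -- then K references for l and K for l′.
        room = K + (proj₁ σ₁ * suc K + (K + K))
        τγ = ramseyList {I} _≟_ (upTo (suc K)) 6 room
        τβ = ramseyList {I} _≟_ (upTo (suc K)) 6 (proj₁ τγ)

        N₀ : ℕ
        N₀ = proj₁ τβ

        1≤K : 1 ≤ K
        1≤K = ≤-trans (s≤s z≤n) (≤-reflexive (sym eK))

        module Run (L : ℕ) (1≤L : 1 ≤ L) (Te : Size.Tests L 1≤L) (W : List I) (sorted : SortedI W) (dense : Size.Dense L 1≤L Te b W)
          (Cβ Cγ : ℕ)
          (R₀ : List I) (Ws : List J) (E₁ E₂ : List I)
          (whole : R₀ ++ flat Ws ++ E₁ ++ E₂ ⊆ W)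
          (constβ : ∀ Q → Q ⊆ R₀ ++ flat Ws ++ E₁ ++ E₂ → length Q ≡ 6 → Size.twinβ L 1≤L Te K Q ≡ Cβ)
          (constγ : ∀ Q → Q ⊆ R₀ ++ flat Ws ++ E₁ ++ E₂ → length Q ≡ 6 → Size.twinγ L 1≤L Te K Q ≡ Cγ)
          (lR₀ : length R₀ ≡ K) (lWs : length Ws ≡ proj₁ σ₁) (lE₁ : length E₁ ≡ K) (lE₂ : length E₂ ≡ K)
          (lB : ∀ {q} → q ∈ Ws → length (proj₂ q) ≡ K) where
          open Size L 1≤L

          inside : ∀ {Q as bs cs ds} → Q ⊆ Ws → as ⊆ R₀ → bs ⊆ flat Q → cs ⊆ E₁ → ds ⊆ E₂ →
            as ++ bs ++ cs ++ ds ⊆ R₀ ++ flat Ws ++ E₁ ++ E₂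
          inside Q⊆ a b c d = ++⁺ a (++⁺ (⊆-trans b (flat-⊆ Q⊆)) (++⁺ c d))

          -- Stand-ins for (r , l). Zipping makes any two reference pairs increase in both entries,
          -- so that their correlation is one of those controlled on 6-tuples. The analogous pairs
          -- for z depend on j, since m has to lie between j and k.
          refsβ : List (I × I)
          refsβ = zip R₀ E₁

          refsγ : J → List (I × I)
          refsγ j = zip (proj₂ j) E₂

          Xβ : J → J → V → ℕ
          Xβ i k = tally (pairβ Te (ι i) (ι k)) refsβ

          Xγ : J → J → V → ℕ
          Xγ j k = tally (pairγ Te (ι j) (ι k)) (refsγ j)

          tally≤ : ∀ {A : Set} (f : A → V → Bool) as {k} → length as ≡ k → ∀ v → tally f as v ≤ k
          tally≤ f as refl v = count≤length as (λ a → f a v)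

          boundsβ : ∀ {r r′ i k l l′} → r ∷ r′ ∷ i ∷ k ∷ l ∷ l′ ∷ [] ⊆ R₀ ++ flat Ws ++ E₁ ++ E₂ →
            let c = corr (pairβ Te i k (r , l)) (pairβ Te i k (r′ , l′)) in Cβ * L ≤ K * c × K * c ≤ suc Cβ * L
          boundsβ sub = floor-bounds K _ L ⦃ >-nonZero 1≤L ⦄ (constβ _ sub refl)

          boundsγ : ∀ {j m m′ k l l′} → j ∷ m ∷ m′ ∷ k ∷ l ∷ l′ ∷ [] ⊆ R₀ ++ flat Ws ++ E₁ ++ E₂ →
            let c = corr (pairγ Te j k (m , l)) (pairγ Te j k (m′ , l′)) in Cγ * L ≤ K * c × K * c ≤ suc Cγ * L
          boundsγ sub = floor-bounds K _ L ⦃ >-nonZero 1≤L ⦄ (constγ _ sub refl)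

          -- References enclose the other indices: r lies before t and l after s. The 6-tuple r, t,
          -- i, k, s, l therefore controls the pairs (r , s), (t , l), whereas (r , l), (t , s) are
          -- wanted. The product of the two conjunctions is the same for both.
          swapβ : ∀ {i k r r′ l l′} → corr (pairβ Te i k (r , l′)) (pairβ Te i k (r′ , l)) ≡ corr (pairβ Te i k (r , l)) (pairβ Te i k (r′ , l′))
          swapβ {i} {k} {r} {r′} {l} {l′} = ∑-cong μ (λ v → ∧-swap (midR Te r i k v) (midL Te i k l′ v) (midR Te r′ i k v) (midL Te i k l v))

          swapγ : ∀ {i k r r′ l l′} → corr (pairγ Te i k (r , l′)) (pairγ Te i k (r′ , l)) ≡ corr (pairγ Te i k (r , l)) (pairγ Te i k (r′ , l′))
          swapγ {i} {k} {r} {r′} {l} {l′} = ∑-cong μ (λ v → ∧-swap (rightM Te i r k v) (rightL Te i k l′ v) (rightM Te i r′ k v) (rightL Te i k l v))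

          sortedJ : ∀ {Q} → Q ⊆ Ws → ∀ {i j} → i ∷ j ∷ [] ⊆ Q → lt (ι i) (ι j) ≡ true × lt (ι j) (ι i) ≡ false
          sortedJ Q⊆ sub = sorted (⊆-trans (inside {as = []} {cs = []} {ds = []} (⊆-trans sub Q⊆) (minimum R₀) (head _ (_ ∷ []) (head _ [] [])) (minimum E₁) (minimum E₂)) whole)

          KK = K * L * (K * L)

          -- Vertices y completing an edge, weighted by the number of reference pairs that accept
          -- them; `h` adds z in the same way. With all of r, l, m, l′ averaged out, `testα` is a
          -- test of x with k as its only extra index.
          h′ : J → J → J → V → V → ℕ
          h′ i j k x z = ⟨ (λ y → ind (F Te (ι i) (ι j) (ι k) x y z) * Xβ i k y) ⟩

          h : J → J → J → V → ℕ
          h i j k x = ⟨ (λ z → Xγ j k z * h′ i j k x z) ⟩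

          h′≤ : ∀ i j k x z → h′ i j k x z ≤ K * L
          h′≤ i j k x z = ≤-trans (∑-mono μ (λ y → ≤-trans (*-mono-≤ (ind≤1 (F Te (ι i) (ι j) (ι k) x y z))
            (tally≤ (pairβ Te (ι i) (ι k)) refsβ (length-zip R₀ E₁ lR₀ lE₁) y)) (≤-reflexive (*-identityˡ K))))
            (≤-reflexive (trans (∑-const μ K) (cong (K *_) (sumFin-1 L))))

          Xγ-total : ∀ {j} k → j ∈ Ws → ⟨ Xγ j k ⟩ ≤ K * L
          Xγ-total {j} k j∈ = ≤-trans (∑-mono μ (tally≤ (pairγ Te (ι j) (ι k)) (refsγ j) (length-zip (proj₂ j) E₂ (lB j∈) lE₂)))
            (≤-reflexive (trans (∑-const μ K) (cong (K *_) (sumFin-1 L))))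

          h≤ : ∀ i {j} k x → j ∈ Ws → h i j k x ≤ KK
          h≤ i {j} k x j∈ = begin
            ⟨ (λ z → Xγ j k z * h′ i j k x z) ⟩  ≤⟨ ∑-mono μ (λ z → *-monoʳ-≤ (Xγ j k z) (h′≤ i j k x z)) ⟩
            ⟨ (λ z → Xγ j k z * (K * L)) ⟩       ≡⟨ ∑-*ʳ μ (Xγ j k) (K * L) ⟩
            ⟨ Xγ j k ⟩ * (K * L)                 ≤⟨ *-monoˡ-≤ (K * L) (Xγ-total k j∈) ⟩
            KK                                   ∎
            where open ≤-Reasoning

          testα : J → J → J → V → Bool
          testα i j k x = KK ≤ᵇ 2 * b * h i j k x

          -- Add up `dense` over all reference pairs for y and z, then apply `markov` in x.
          hypα : ∀ {t₀ p t₁ q k} → t₀ ∷ p ∷ t₁ ∷ q ∷ k ∷ [] ⊆ Ws →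
            L ≤ 2 * b * ⟨ (λ x → ind (leftR Te (ι t₀) (ι p) (ι q) x ∧ (leftM Te (ι p) (ι t₁) (ι q) x ∧ testα p q k x))) ⟩
          hypα {t₀} {p} {t₁} {q} {k} sub = ≤-trans (markov μ w (h p q k) L KK b 1≤KK w≤L total (λ x → h≤ p k x q∈))
            (≤-reflexive (cong (2 * b *_) (∑-cong μ (λ x → trans (sym (ind-∧ (leftR Te (ι t₀) (ι p) (ι q) x ∧ leftM Te (ι p) (ι t₁) (ι q) x) _))
              (cong ind (Bool.∧-assoc (leftR Te (ι t₀) (ι p) (ι q) x) _ _))))))
            where
            open ≤-Reasoning
            q∈ : q ∈ Ws
            q∈ = lookup sub (there (there (there (here refl))))
            w : V → ℕ
            w x = ind (leftR Te (ι t₀) (ι p) (ι q) x ∧ leftM Te (ι p) (ι t₁) (ι q) x)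
            1≤KK : 1 ≤ KK
            1≤KK = *-mono-≤ (*-mono-≤ 1≤K 1≤L) (*-mono-≤ 1≤K 1≤L)
            w≤L : ⟨ w ⟩ ≤ L
            w≤L = ≤-trans (∑-mono μ (λ x → ind≤1 (leftR Te (ι t₀) (ι p) (ι q) x ∧ leftM Te (ι p) (ι t₁) (ι q) x))) (≤-reflexive (sumFin-1 L))
            f : V → V → V → ℕ
            f x y z = ind (F Te (ι p) (ι q) (ι k) x y z)
            u : I × I → V → ℕ
            u a y = ind (pairβ Te (ι p) (ι k) a y)
            v : I × I → V → ℕ
            v c z = ind (pairγ Te (ι q) (ι k) c z)
            Sₘ : I × I → I × I → ℕ
            Sₘ a c = ⟨ (λ x → ⟨ (λ y → ⟨ (λ z → w x * (f x y z * (u a y * v c z))) ⟩) ⟩) ⟩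
            each : ∀ {a c} → a ∈ refsβ → c ∈ refsγ q → L * (L * L) ≤ b * Sₘ a c
            each a∈ c∈ with ∈-zip a∈ | ∈-zip c∈
            ... | r∈ , l∈ | m∈ , l′∈ = dense (⊆-trans (inside sub (single r∈)
                  (head t₀ (p ∷ t₁ ∷ q ∷ k ∷ []) (head p (t₁ ∷ q ∷ k ∷ []) (head t₁ (q ∷ k ∷ []) (head+ q (k ∷ []) (single m∈) (head k [] []))))) (single l∈) (single l′∈)) whole)
            lβ = length-zip R₀ E₁ lR₀ lE₁
            lγ = length-zip (proj₂ q) E₂ (lB q∈) lE₂
            collapse : ∀ x → sumList refsβ (λ a → sumList (refsγ q) (λ c → ⟨ (λ y → ⟨ (λ z → w x * (f x y z * (u a y * v c z))) ⟩) ⟩))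
              ≡ w x * h p q k x
            collapse x = begin-equality
              sumList refsβ (λ a → sumList (refsγ q) (λ c → ⟨ (λ y → ⟨ (λ z → w x * (f x y z * (u a y * v c z))) ⟩) ⟩))
                ≡⟨ sumList-cong refsβ (λ a _ → sym (trans (∑-cong μ (λ y → ∑-sumList μ (refsγ q) _)) (∑-sumList μ (refsγ q) _))) ⟩
              sumList refsβ (λ a → ⟨ (λ y → ⟨ (λ z → sumList (refsγ q) (λ c → w x * (f x y z * (u a y * v c z)))) ⟩) ⟩)
                ≡⟨ sym (trans (∑-cong μ (λ y → ∑-sumList μ refsβ _)) (∑-sumList μ refsβ _)) ⟩
              ⟨ (λ y → ⟨ (λ z → sumList refsβ (λ a → sumList (refsγ q) (λ c → w x * (f x y z * (u a y * v c z))))) ⟩) ⟩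
                ≡⟨ ∑-cong μ (λ y → ∑-cong μ (λ z → trans (sumList-cong refsβ (λ a _ → trans (sumList-cong (refsγ q) (λ c _ →
                     e₁ (w x) (f x y z) (u a y) (v c z))) (sumList-* (refsγ q) (w x * (f x y z * u a y)) _)))
                     (trans (sumList-*ʳ refsβ _ (Xγ q k z)) (cong (_* Xγ q k z) (trans (sumList-* refsβ (w x) _) (cong (w x *_) (sumList-* refsβ (f x y z) _))))))) ⟩
              ⟨ (λ y → ⟨ (λ z → w x * (f x y z * Xβ p k y) * Xγ q k z) ⟩) ⟩
                ≡⟨ ∑-swap L L _ ⟩
              ⟨ (λ z → ⟨ (λ y → w x * (f x y z * Xβ p k y) * Xγ q k z) ⟩) ⟩
                ≡⟨ ∑-cong μ (λ z → trans (∑-cong μ (λ y → e₂ (w x) (f x y z * Xβ p k y) (Xγ q k z)))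
                     (trans (∑-* μ (w x) _) (cong (w x *_) (∑-* μ (Xγ q k z) _)))) ⟩
              ⟨ (λ z → w x * (Xγ q k z * h′ p q k x z)) ⟩
                ≡⟨ ∑-* μ (w x) _ ⟩
              w x * h p q k x ∎
              where
              e₁ : ∀ w f u v → w * (f * (u * v)) ≡ w * (f * u) * v
              e₁ = solve-∀
              e₂ : ∀ w f v → w * f * v ≡ w * (v * f)
              e₂ = solve-∀
            total : L * KK ≤ b * ⟨ (λ x → w x * h p q k x) ⟩
            total = begin
              L * KK                                                 ≡⟨ e K L ⟩
              K * (K * (L * (L * L)))                                ≡⟨ cong₂ (λ s t → s * (t * (L * (L * L)))) lβ lγ ⟨
              length refsβ * (length (refsγ q) * (L * (L * L)))      ≡⟨ sumList-const refsβ _ ⟨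
              sumList refsβ (λ _ → length (refsγ q) * (L * (L * L))) ≡⟨ sumList-cong refsβ (λ _ _ → sym (sumList-const (refsγ q) _)) ⟩
              sumList refsβ (λ _ → sumList (refsγ q) (λ _ → L * (L * L)))
                ≤⟨ sumList-mono refsβ (λ a a∈ → sumList-mono (refsγ q) (λ c c∈ → each a∈ c∈)) ⟩
              sumList refsβ (λ a → sumList (refsγ q) (λ c → b * Sₘ a c))
                ≡⟨ trans (sumList-cong refsβ (λ a _ → sumList-* (refsγ q) b (Sₘ a))) (sumList-* refsβ b _) ⟩
              b * sumList refsβ (λ a → sumList (refsγ q) (Sₘ a))
                ≡⟨ cong (b *_) (trans (∑-cong μ (λ x → sumList-cong refsβ (λ _ _ → refl))) (trans (∑-sumList μ refsβ _) (sumList-cong refsβ (λ a _ → ∑-sumList μ (refsγ q) _)))) ⟨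
              b * ⟨ (λ x → sumList refsβ (λ a → sumList (refsγ q) (λ c → ⟨ (λ y → ⟨ (λ z → w x * (f x y z * (u a y * v c z))) ⟩) ⟩))) ⟩
                ≡⟨ cong (b *_) (∑-cong μ collapse) ⟩
              b * ⟨ (λ x → w x * h p q k x) ⟩ ∎
              where
              e : ∀ K L → L * (K * L * (K * L)) ≡ K * (K * (L * (L * L)))
              e = solve-∀

          gγ : (J → J → V) → J → J → J → V → Bool
          gγ X i j k z = (K * L) ≤ᵇ (2 * (2 * b) * h′ i j k (X i j) z)

          predγ : (J → J → V) → List J → Bool
          predγ X (i ∷ j ∷ t₁ ∷ k ∷ t₂ ∷ []) = L ≤ᵇ 8 * b * ⟨ (λ z → ind (gγ X i j k z ∧
            (rightM Te (ι j) (ι t₁) (ι k) z ∧ rightL Te (ι j) (ι k) (ι t₂) z))) ⟩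
          predγ X _ = false

          fourfold : 2 * (2 * b) ≡ 4 * b
          fourfold = sym (*-assoc 2 2 b)

          inner : ∀ {Q as} → Q ⊆ Ws → as ⊆ flat Q → as ⊆ R₀ ++ flat Ws ++ E₁ ++ E₂
          inner Q⊆ p = skip R₀ (subst (_⊆ _) (++-identityʳ _) (++⁺ (⊆-trans p (flat-⊆ Q⊆)) (minimum (E₁ ++ E₂))))

          -- By `testα` and `markov`, the reference tests of j correlate with the set of suitable z.
          -- Homogeneity in the negative colour would make this correlation small for all pairs from
          -- `T₂` and `T₃`, against `promote`.
          refuteγ : ∀ X {S} → S ⊆ Ws → spare ≤ length S → (∀ {i j k} → i ∷ j ∷ k ∷ [] ⊆ S → testα i j k (X i j) ≡ true) →
            Mono 5 S (predγ X) false → ⊥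
          refuteγ X {S} S⊆ lS tested bad with carve (0 ∷ 0 ∷ K ∷ K ∷ []) S (≤-trans (≤-reflexive (cong (λ z → K + z + 3) (+-identityʳ K))) lS)
          ... | ([] ∷ [] ∷ T₂ ∷ T₃ ∷ []) , (i ∷ j ∷ k ∷ []) , lengths , sub =
            promote (pairγ Te (ι j) (ι k)) K Cγ (refsγ j) bs (length-zip (proj₂ j) E₂ (lB j∈) lE₂) (length-zip (map ι T₂) (map ι T₃) l₂ l₃)
              (zip-AllPairs (proj₂ j) E₂ (λ mm ll → proj₂ (boundsγ
                 (inside jk (minimum R₀) (head+ j (k ∷ []) mm (head k [] [])) (minimum E₁) ll))))
              (zip-AllPairs (map ι T₂) (map ι T₃) (λ tt ss → proj₂ (boundsγ (inner jTk (⊆-trans (refl ∷ ++⁺ tt (refl ∷ ss)) all-heads)))))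
              low g 1≤L b₀ eK big small
            where
            jTk : j ∷ T₂ ++ k ∷ T₃ ⊆ Ws
            jTk = ⊆-trans (⊆-trans (_ ∷ʳ ⊆-refl) sub) S⊆
            j∈ : j ∈ Ws
            j∈ = lookup jTk (here refl)
            ijk : i ∷ j ∷ k ∷ [] ⊆ S
            ijk = ⊆-trans (refl ∷ refl ∷ skip T₂ (refl ∷ minimum T₃)) sub
            jk : j ∷ k ∷ [] ⊆ Ws
            jk = ⊆-trans (_ ∷ʳ ⊆-refl) (⊆-trans ijk S⊆)
            l₂ : length (map ι T₂) ≡ K
            l₂ = trans (length-map ι T₂) (cong (λ v → Vec.lookup v (suc (suc zero))) lengths)
            l₃ : length (map ι T₃) ≡ K
            l₃ = trans (length-map ι T₃) (cong (λ v → Vec.lookup v (suc (suc (suc zero)))) lengths)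
            bs = zip (map ι T₂) (map ι T₃)
            g = gγ X i j k
            tail-heads : map ι T₂ ++ ι k ∷ map ι T₃ ⊆ flat (T₂ ++ k ∷ T₃)
            tail-heads = ⊆-trans (⊆-reflexive (sym (map-++ ι T₂ (k ∷ T₃)))) (heads (T₂ ++ k ∷ T₃))
            all-heads : ι j ∷ map ι T₂ ++ ι k ∷ map ι T₃ ⊆ flat (j ∷ T₂ ++ k ∷ T₃)
            all-heads = head j (T₂ ++ k ∷ T₃) tail-heads
            low : ∀ {a c} → a ∈ refsγ j → c ∈ bs → Cγ * L ≤ K * corr (pairγ Te (ι j) (ι k) a) (pairγ Te (ι j) (ι k) c)
            low a∈ c∈ with ∈-zip a∈ | ∈-zip c∈
            ... | m∈ , l∈ | t∈ , s∈ = subst (λ z → Cγ * L ≤ K * z) swapγ (proj₁ (boundsγ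
                  (inside jTk (minimum R₀) (head+ j (T₂ ++ k ∷ T₃) (single m∈) (⊆-trans (++⁺ (single t∈) (refl ∷ single s∈)) tail-heads))
                    (minimum E₁) (single l∈))))
            big : K * L ≤ 4 * b * ⟨ (λ z → ind (g z) * tally (pairγ Te (ι j) (ι k)) (refsγ j) z) ⟩
            big = subst (λ c → K * L ≤ c * ⟨ (λ z → ind (g z) * tally (pairγ Te (ι j) (ι k)) (refsγ j) z) ⟩) fourfold
              (≤-trans (markov μ (Xγ j k) (h′ i j k (X i j)) (K * L) (K * L) (2 * b) (*-mono-≤ 1≤K 1≤L) (Xγ-total k j∈)
                 (≤ᵇ-true (tested ijk)) (h′≤ i j k (X i j)))
               (≤-reflexive (cong (2 * (2 * b) *_) (∑-cong μ (λ z → *-comm (Xγ j k z) _)))))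
            small : ∀ {c} → c ∈ bs → 8 * b * ⟨ (λ z → ind (g z) * ind (pairγ Te (ι j) (ι k) c z)) ⟩ ≤ L
            small c∈ with ∈-zip c∈
            ... | t∈ , s∈ with ∈-map⁻ ι t∈ | ∈-map⁻ ι s∈
            ...   | t , t∈T , refl | s , s∈T , refl = ≤-trans
                    (≤-reflexive (cong (8 * b *_) (∑-cong μ (λ z → sym (ind-∧ (g z) _)))))
                    (<⇒≤ (≤ᵇ-false (bad (i ∷ j ∷ t ∷ k ∷ s ∷ [])
                      (⊆-trans (refl ∷ refl ∷ ++⁺ (single t∈T) (refl ∷ single s∈T)) sub) refl)))

          gβ : (X Z : J → J → V) → J → J → J → V → Bool
          gβ X Z i j k y = F Te (ι i) (ι j) (ι k) (X i j) y (Z j k)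

          predβ : (X Z : J → J → V) → List J → Bool
          predβ X Z (t₀ ∷ i ∷ j ∷ k ∷ t₂ ∷ []) = L ≤ᵇ 8 * b * ⟨ (λ y → ind (midR Te (ι t₀) (ι i) (ι k) y ∧
            (gβ X Z i j k y ∧ midL Te (ι i) (ι k) (ι t₂) y))) ⟩
          predβ X Z _ = false

          -- As for z, with test indices before i and after k. Once x and z are fixed, `tested` is
          -- itself the correlation of the reference tests with the set of completing y, without a
          -- further use of `markov`.
          refuteβ : ∀ X Z {S} → S ⊆ Ws → spare ≤ length S → (∀ {i j k} → i ∷ j ∷ k ∷ [] ⊆ S → gγ X i j k (Z j k) ≡ true) →
            Mono 5 S (predβ X Z) false → ⊥
          refuteβ X Z {S} S⊆ lS tested bad with carve (K ∷ 0 ∷ 0 ∷ K ∷ []) S (≤-trans (≤-reflexive (cong (λ z → K + z + 3) (+-identityʳ K))) lS)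
          ... | (T₀ ∷ [] ∷ [] ∷ T₃ ∷ []) , (i ∷ j ∷ k ∷ []) , lengths , sub =
            promote (pairβ Te (ι i) (ι k)) K Cβ refsβ bs (length-zip R₀ E₁ lR₀ lE₁) (length-zip (map ι T₀) (map ι T₃) l₀ l₃)
              (zip-AllPairs R₀ E₁ (λ rr ll → proj₂ (boundsβ
                 (inside ik rr (head i (k ∷ []) (head k [] [])) ll (minimum E₂)))))
              (zip-AllPairs (map ι T₀) (map ι T₃) (λ tt ss → proj₂ (boundsβ (inner TikT (⊆-trans (++⁺ tt (refl ∷ refl ∷ ss)) all-heads)))))
              low g 1≤L b₀ eK big small
            where
            TikT : T₀ ++ i ∷ k ∷ T₃ ⊆ Ws
            TikT = ⊆-trans (⊆-trans (++⁺ ⊆-refl (refl ∷ _ ∷ʳ ⊆-refl)) sub) S⊆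
            ijk : i ∷ j ∷ k ∷ [] ⊆ S
            ijk = ⊆-trans (skip T₀ (refl ∷ refl ∷ refl ∷ minimum T₃)) sub
            ik : i ∷ k ∷ [] ⊆ Ws
            ik = ⊆-trans (refl ∷ _ ∷ʳ ⊆-refl) (⊆-trans ijk S⊆)
            l₀ : length (map ι T₀) ≡ K
            l₀ = trans (length-map ι T₀) (cong (λ v → Vec.lookup v zero) lengths)
            l₃ : length (map ι T₃) ≡ K
            l₃ = trans (length-map ι T₃) (cong (λ v → Vec.lookup v (suc (suc (suc zero)))) lengths)
            bs = zip (map ι T₀) (map ι T₃)
            g = gβ X Z i j k
            all-heads : map ι T₀ ++ ι i ∷ ι k ∷ map ι T₃ ⊆ flat (T₀ ++ i ∷ k ∷ T₃)
            all-heads = ⊆-trans (⊆-reflexive (sym (map-++ ι T₀ (i ∷ k ∷ T₃)))) (heads (T₀ ++ i ∷ k ∷ T₃))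
            low : ∀ {a c} → a ∈ refsβ → c ∈ bs → Cβ * L ≤ K * corr (pairβ Te (ι i) (ι k) a) (pairβ Te (ι i) (ι k) c)
            low a∈ c∈ with ∈-zip a∈ | ∈-zip c∈
            ... | r∈ , l∈ | t∈ , s∈ = subst (λ z → Cβ * L ≤ K * z) swapβ (proj₁ (boundsβ
                  (inside TikT (single r∈) (⊆-trans (++⁺ (single t∈) (refl ∷ refl ∷ single s∈)) all-heads) (single l∈) (minimum E₂))))
            big : K * L ≤ 4 * b * ⟨ (λ y → ind (g y) * tally (pairβ Te (ι i) (ι k)) refsβ y) ⟩
            big = subst (λ c → K * L ≤ c * ⟨ (λ y → ind (g y) * tally (pairβ Te (ι i) (ι k)) refsβ y) ⟩) fourfold
              (≤ᵇ-true (tested ijk))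
            rearrange : ∀ a b c → ind b * ind (a ∧ c) ≡ ind (a ∧ (b ∧ c))
            rearrange true  b c = sym (ind-∧ b c)
            rearrange false b c = *-zeroʳ (ind b)
            small : ∀ {c} → c ∈ bs → 8 * b * ⟨ (λ y → ind (g y) * ind (pairβ Te (ι i) (ι k) c y)) ⟩ ≤ L
            small c∈ with ∈-zip c∈
            ... | t∈ , s∈ with ∈-map⁻ ι t∈ | ∈-map⁻ ι s∈
            ...   | t , t∈T , refl | s , s∈T , refl = ≤-trans
                    (≤-reflexive (cong (8 * b *_) (∑-cong μ (λ y → rearrange (midR Te (ι t) (ι i) (ι k) y) (g y) _))))
                    (<⇒≤ (≤ᵇ-false (bad (t ∷ i ∷ j ∷ k ∷ s ∷ [])
                      (⊆-trans (++⁺ (single t∈T) (refl ∷ refl ∷ refl ∷ single s∈T)) sub) refl)))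

          module _ {S₁ S₂ S₃ : List J} (S₁⊆ : S₁ ⊆ Ws) (S₂⊆ : S₂ ⊆ S₁) (S₃⊆ : S₃ ⊆ S₂) (X Y Z : J → J → V)
            (XR : ∀ {t p q} → t ∷ p ∷ q ∷ [] ⊆ S₁ → leftR Te (ι t) (ι p) (ι q) (X p q) ≡ true)
            (XM : ∀ {p t q} → p ∷ t ∷ q ∷ [] ⊆ S₁ → leftM Te (ι p) (ι t) (ι q) (X p q) ≡ true)
            (ZM : ∀ {p t q} → p ∷ t ∷ q ∷ [] ⊆ S₂ → rightM Te (ι p) (ι t) (ι q) (Z p q) ≡ true)
            (ZL : ∀ {p q t} → p ∷ q ∷ t ∷ [] ⊆ S₂ → rightL Te (ι p) (ι q) (ι t) (Z p q) ≡ true)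
            (YR : ∀ {t p q} → t ∷ p ∷ q ∷ [] ⊆ S₃ → midR Te (ι t) (ι p) (ι q) (Y p q) ≡ true)
            (YF : ∀ {p t q} → p ∷ t ∷ q ∷ [] ⊆ S₃ → gβ X Z p t q (Y p q) ≡ true)
            (YL : ∀ {p q t} → p ∷ q ∷ t ∷ [] ⊆ S₃ → midL Te (ι p) (ι q) (ι t) (Y p q) ≡ true) where

            private
              S₃⊆Ws : S₃ ⊆ Ws
              S₃⊆Ws = ⊆-trans S₃⊆ (⊆-trans S₂⊆ S₁⊆)
              f : I → J
              f = find S₃
              lift : ∀ (P : J → J → J → Set) (P′ : I → I → I → Set) → (∀ {a b c} → a ∷ b ∷ c ∷ [] ⊆ S₃ → P a b c) →
                (∀ a b c → f (ι a) ≡ a → f (ι b) ≡ b → f (ι c) ≡ c → P a b c → P′ (ι a) (ι b) (ι c)) →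
                ∀ {i j k} → i ∷ j ∷ k ∷ [] ⊆ map ι S₃ → P′ i j k
              lift P P′ all conv s with map-ι-⊆ s
              ... | (a ∷ b ∷ c ∷ []) , sub , refl = conv a b c (found (here refl)) (found (there (here refl)))
                      (found (there (there (here refl)))) (all sub)
                where
                found : ∀ {q} → q ∈ a ∷ b ∷ c ∷ [] → f (ι q) ≡ q
                found q∈ = find-∈ (λ u → proj₁ (sortedJ S₃⊆Ws u)) (lookup sub q∈)

            assemble : System Te (map ι S₃)
            assemble = record
              { X = λ i j → X (f i) (f j) ; Y = λ i j → Y (f i) (f j) ; Z = λ i j → Z (f i) (f j)
              ; edge   = lift (λ i j k → gβ X Z i j k (Y i k) ≡ true)
                           (λ i j k → F Te i j k (X (f i) (f j)) (Y (f i) (f k)) (Z (f j) (f k)) ≡ true) YF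
                           (λ i j k a b c e → trans (cong₂ (λ x (y , z) → F Te (ι i) (ι j) (ι k) x y z) (cong₂ X a b)
                              (cong₂ _,_ (cong₂ Y a c) (cong₂ Z b c))) e)
              ; testLR = lift (λ t p q → leftR Te (ι t) (ι p) (ι q) (X p q) ≡ true)
                           (λ t p q → leftR Te t p q (X (f p) (f q)) ≡ true) (λ u → XR (⊆-trans u (⊆-trans S₃⊆ S₂⊆)))
                           (λ t p q a b c e → trans (cong (leftR Te (ι t) (ι p) (ι q)) (cong₂ X b c)) e)
              ; testLM = lift (λ p t q → leftM Te (ι p) (ι t) (ι q) (X p q) ≡ true)
                           (λ p t q → leftM Te p t q (X (f p) (f q)) ≡ true) (λ u → XM (⊆-trans u (⊆-trans S₃⊆ S₂⊆)))
                           (λ p t q a b c e → trans (cong (leftM Te (ι p) (ι t) (ι q)) (cong₂ X a c)) e)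
              ; testMR = lift (λ t p q → midR Te (ι t) (ι p) (ι q) (Y p q) ≡ true)
                           (λ t p q → midR Te t p q (Y (f p) (f q)) ≡ true) YR
                           (λ t p q a b c e → trans (cong (midR Te (ι t) (ι p) (ι q)) (cong₂ Y b c)) e)
              ; testML = lift (λ p q t → midL Te (ι p) (ι q) (ι t) (Y p q) ≡ true)
                           (λ p q t → midL Te p q t (Y (f p) (f q)) ≡ true) YL
                           (λ p q t a b c e → trans (cong (midL Te (ι p) (ι q) (ι t)) (cong₂ Y a b)) e)
              ; testRM = lift (λ p t q → rightM Te (ι p) (ι t) (ι q) (Z p q) ≡ true)
                           (λ p t q → rightM Te p t q (Z (f p) (f q)) ≡ true) (λ u → ZM (⊆-trans u S₃⊆))
                           (λ p t q a b c e → trans (cong (rightM Te (ι p) (ι t) (ι q)) (cong₂ Z a c)) e)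
              ; testRL = lift (λ p q t → rightL Te (ι p) (ι q) (ι t) (Z p q) ≡ true)
                           (λ p q t → rightL Te p q t (Z (f p) (f q)) ≡ true) (λ u → ZL (⊆-trans u S₃⊆))
                           (λ p q t a b c e → trans (cong (rightL Te (ι p) (ι q) (ι t)) (cong₂ Z a b)) e)
              }

          Goal : Set
          Goal = ∃[ S ] (S ⊆ W × length S ≡ n × System Te S)

          record MonoSet (S : List J) (k : ℕ) (f : List J → Bool) : Set where
            field
              S′   : List J
              S′⊆  : S′ ⊆ S
              k≤   : k ≤ length S′
              mono : Mono 5 S′ f true

          open MonoSet

          monoγ : ∀ X {S} → S ⊆ Ws → (∀ {i j k} → i ∷ j ∷ k ∷ [] ⊆ S → testα i j k (X i j) ≡ true) → length S ≡ proj₁ ρ₂ →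
            MonoSet S (proj₁ σ₂) (predγ X)
          monoγ X {S} S⊆ tested lS with proj₂ ρ₂ S (≤-reflexive (sym lS)) (predγ X)
          ... | V , V⊆ , l , true  , m = record
                  { S′ = V ; S′⊆ = V⊆ ; k≤ = ≤-trans (m≤m+n (proj₁ σ₂) spare) (≤-reflexive (sym l)) ; mono = m }
          ... | V , V⊆ , l , false , m = ⊥-elim (refuteγ X (⊆-trans V⊆ S⊆)
                  (≤-trans (m≤n+m spare (proj₁ σ₂)) (≤-reflexive (sym l))) (λ s → tested (⊆-trans s V⊆)) m)

          monoβ : ∀ X Z {S} → S ⊆ Ws → (∀ {i j k} → i ∷ j ∷ k ∷ [] ⊆ S → gγ X i j k (Z j k) ≡ true) → length S ≡ proj₁ ρ₃ →
            MonoSet S (proj₁ σ₃) (predβ X Z)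
          monoβ X Z {S} S⊆ tested lS with proj₂ ρ₃ S (≤-reflexive (sym lS)) (predβ X Z)
          ... | V , V⊆ , l , true  , m = record
                  { S′ = V ; S′⊆ = V⊆ ; k≤ = ≤-trans (m≤m+n (proj₁ σ₃) spare) (≤-reflexive (sym l)) ; mono = m }
          ... | V , V⊆ , l , false , m = ⊥-elim (refuteβ X Z (⊆-trans V⊆ S⊆)
                  (≤-trans (m≤n+m spare (proj₁ σ₃)) (≤-reflexive (sym l))) (λ s → tested (⊆-trans s V⊆)) m)

          tLR tLM tMR tML tRM tRL : J → J → J → V → Bool
          tLR t p q = leftR Te (ι t) (ι p) (ι q)
          tLM p t q = leftM Te (ι p) (ι t) (ι q)
          tMR t p q = midR Te (ι t) (ι p) (ι q)
          tML p q t = midL Te (ι p) (ι q) (ι t)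
          tRM p t q = rightM Te (ι p) (ι t) (ι q)
          tRL p q t = rightL Te (ι p) (ι q) (ι t)

          stage₅ : (c₁ : Choice tLR tLM testα Ws (proj₁ ρ₂)) (m₁ : MonoSet (S c₁) (proj₁ σ₂) (predγ (pick c₁)))
            (c₂ : Choice (gγ (pick c₁)) tRM tRL (S′ m₁) (proj₁ ρ₃)) (m₂ : MonoSet (S c₂) (proj₁ σ₃) (predβ (pick c₁) (pick c₂))) →
            Choice tMR (gβ (pick c₁) (pick c₂)) tML (S′ m₂) n → Goal
          stage₅ c₁ m₁ c₂ m₂ c₃ = map ι (S c₃) , ⊆-trans (inner S₃⊆Ws (heads (S c₃))) whole , trans (length-map ι (S c₃)) (size c₃) ,
            assemble (S⊆ c₁) (⊆-trans (S⊆ c₂) (S′⊆ m₁)) (⊆-trans (S⊆ c₃) (S′⊆ m₂)) (pick c₁) (pick c₃) (pick c₂)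
              (chosen₀ c₁) (chosen₁ c₁) (chosen₁ c₂) (chosen₂ c₂) (chosen₀ c₃) (chosen₁ c₃) (chosen₂ c₃)
            where
            S₃⊆Ws : S c₃ ⊆ Ws
            S₃⊆Ws = ⊆-trans (S⊆ c₃) (⊆-trans (S′⊆ m₂) (⊆-trans (S⊆ c₂) (⊆-trans (S′⊆ m₁) (S⊆ c₁))))

          stage₄ : (c₁ : Choice tLR tLM testα Ws (proj₁ ρ₂)) (m₁ : MonoSet (S c₁) (proj₁ σ₂) (predγ (pick c₁)))
            (c₂ : Choice (gγ (pick c₁)) tRM tRL (S′ m₁) (proj₁ ρ₃)) → MonoSet (S c₂) (proj₁ σ₃) (predβ (pick c₁) (pick c₂)) → Goal
          stage₄ c₁ m₁ c₂ m₂ = stage₅ c₁ m₁ c₂ m₂ (proj₂ σ₃ L 1≤L tMR (gβ (pick c₁) (pick c₂)) tML (S′ m₂)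
            (sortedJ (⊆-trans (S′⊆ m₂) (⊆-trans (S⊆ c₂) (⊆-trans (S′⊆ m₁) (S⊆ c₁))))) (k≤ m₂) (λ s → ≤ᵇ-true (mono m₂ _ s refl)))

          stage₃ : (c₁ : Choice tLR tLM testα Ws (proj₁ ρ₂)) (m₁ : MonoSet (S c₁) (proj₁ σ₂) (predγ (pick c₁))) →
            Choice (gγ (pick c₁)) tRM tRL (S′ m₁) (proj₁ ρ₃) → Goal
          stage₃ c₁ m₁ c₂ = stage₄ c₁ m₁ c₂ (monoβ (pick c₁) (pick c₂) (⊆-trans (S⊆ c₂) (⊆-trans (S′⊆ m₁) (S⊆ c₁))) (chosen₀ c₂) (size c₂))

          stage₂ : (c₁ : Choice tLR tLM testα Ws (proj₁ ρ₂)) → MonoSet (S c₁) (proj₁ σ₂) (predγ (pick c₁)) → Goal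
          stage₂ c₁ m₁ = stage₃ c₁ m₁ (proj₂ σ₂ L 1≤L (gγ (pick c₁)) tRM tRL (S′ m₁) (sortedJ (⊆-trans (S′⊆ m₁) (S⊆ c₁))) (k≤ m₁)
            (λ s → ≤ᵇ-true (mono m₁ _ s refl)))

          stage₁ : Choice tLR tLM testα Ws (proj₁ ρ₂) → Goal
          stage₁ c₁ = stage₂ c₁ (monoγ (pick c₁) (S⊆ c₁) (chosen₂ c₁) (size c₁))

          result : Goal
          result = stage₁ (proj₂ σ₁ L 1≤L tLR tLM testα Ws (sortedJ ⊆-refl) (≤-reflexive (sym lWs)) hypα)

        run : ∀ L (1≤L : 1 ≤ L) (let open Size L 1≤L) (Te : Tests) W → SortedI W → N₀ ≤ length W → Dense Te (suc b₀) W →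
          ∃[ S ] (S ⊆ W × length S ≡ n × System Te S)
        run L 1≤L Te W sorted hW dense with proj₂ τβ W hW (Size.twinβ L 1≤L Te K) (λ Q _ → Size.twinβ-∈ L 1≤L Te K Q)
        ... | W₁ , W₁⊆ , lW₁ , Cβ , _ , constβ with proj₂ τγ W₁ (≤-reflexive (sym lW₁)) (Size.twinγ L 1≤L Te K) (λ Q _ → Size.twinγ-∈ L 1≤L Te K Q)
        ...   | W₂ , W₂⊆ , lW₂ , Cγ , _ , constγ with cut K _ W₂ lW₂
        ...     | R₀ , U , refl , lR₀ , lU with cut (proj₁ σ₁ * suc K) _ U lU
        ...       | M , U′ , refl , lM , lU′ with cut K K U′ lU′
        ...         | E₁ , E₂ , refl , lE₁ , lE₂ with chunk K (proj₁ σ₁) M lM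
        ...           | Ws , refl , lWs , lB = Run.result L 1≤L Te W sorted dense Cβ Cγ R₀ Ws E₁ E₂ (⊆-trans W₂⊆ W₁⊆)
                          (λ Q s → constβ Q (⊆-trans s W₂⊆)) constγ lR₀ lWs lE₁ lE₂ lB

      abstract
        extract : ∀ n b₀ → ∃[ N ] ∀ L (1≤L : 1 ≤ L) (let open Size L 1≤L) (Te : Tests) W → SortedI W → N ≤ length W →
          Dense Te (suc b₀) W → ∃[ S ] (S ⊆ W × length S ≡ n × System Te S)
        extract n b₀ = sized (512 * (suc b₀ * suc b₀)) refl
          where
          sized : ∀ K → K ≡ 512 * (suc b₀ * suc b₀) → ∃[ N ] ∀ L (1≤L : 1 ≤ L) (let open Size L 1≤L) (Te : Tests) W → SortedI W →
            N ≤ length W → Dense Te (suc b₀) W → ∃[ S ] (S ⊆ W × length S ≡ n × System Te S)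
          sized K eK = Sized.N₀ n b₀ K eK , Sized.run n b₀ K eK

  open Extracting

  -- Palettes of coloured triples and the 5-cycles in them.

  module Palette where
    -- A pair ij, ik, jk of a triad i < j < k plays the role left, mid, right respectively.

    data Role : Set where
      left mid right : Role

    data Side : Set where
      first second : Side

    at : ∀ {I V : Set} → Role → (I → I → V) → I → I → I → V
    at left  g i j k = g i j
    at mid   g i j k = g i k
    at right g i j k = g j k

    insert : ∀ {A : Set} → Role → A → A → A → A × A × A
    insert left  v x y = v , x , y
    insert mid   v x y = x , v , y
    insert right v x y = x , y , v

    -- bit e s σ holds for a vertex lying in the link of the base colour e placed in role s, the side σ
    -- telling which of the two remaining roles the vertex plays.  The name XeY of a bit records the role X of
    -- the vertex, the base colour e (a, b, c for left, mid, right) and the role Y of the latter.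
    record Bit : Set where
      constructor bit
      field
        colour : Role
        role   : Role
        side   : Side

    MaL RaL LaM RaM LaR MaR MbL RbL LbM RbM LbR MbR McL RcL LcM RcM LcR McR : Bit
    MaL = bit left left first
    RaL = bit left left second
    LaM = bit left mid first
    RaM = bit left mid second
    LaR = bit left right first
    MaR = bit left right second
    MbL = bit mid left first
    RbL = bit mid left second
    LbM = bit mid mid first
    RbM = bit mid mid second
    LbR = bit mid right first
    MbR = bit mid right second
    McL = bit right left first
    RcL = bit right left second
    LcM = bit right mid first
    RcM = bit right mid second
    LcR = bit right right first
    McR = bit right right second

    Colour : Set
    Colour = ℕ

    Triple : Set
    Triple = Colour × Colour × Colour

    base : Role → Colour
    base left  = 0
    base mid   = 1
    base right = 2

    -- The triple witnessing a bit of the colour x, with third colour z.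
    pendant : Bit → Colour → Colour → Triple
    pendant (bit e s first)  x z = insert s (base e) x z
    pendant (bit e s second) x z = insert s (base e) z x

    baseTriple : Triple
    baseTriple = base left , base mid , base right

    -- A colouring of the pairs of the ordered 5-cycle: ranks of the vertices v₀,…,v₄, colours of
    -- the pairs vᵢvᵢ₊₁ and colours of the pairs vᵢvᵢ₊₂.
    record Witness : Set where
      constructor witness
      field
        ranks cyclic diagonal : Vec ℕ 5

    -- Sides vᵢvᵢ₊₁ and diagonals vᵢvᵢ₊₂ are numbered by i modulo 5. The entries for equal arguments
    -- are default values: vertices in a common edge have distinct images.
    pairIndex : Fin 5 → Fin 5 → Side × Fin 5
    pairIndex a b = Vec.lookup (Vec.lookup table a) b
      where
      c d : Fin 5 → Side × Fin 5
      c = first ,_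
      d = second ,_
      table : Vec (Vec (Side × Fin 5) 5) 5
      table = (c (# 0) ∷ c (# 0) ∷ d (# 0) ∷ d (# 3) ∷ c (# 4) ∷ [])
            ∷ (c (# 0) ∷ c (# 0) ∷ c (# 1) ∷ d (# 1) ∷ d (# 4) ∷ [])
            ∷ (d (# 0) ∷ c (# 1) ∷ c (# 0) ∷ c (# 2) ∷ d (# 2) ∷ [])
            ∷ (d (# 3) ∷ d (# 1) ∷ c (# 2) ∷ c (# 0) ∷ c (# 3) ∷ [])
            ∷ (c (# 4) ∷ d (# 4) ∷ d (# 2) ∷ c (# 3) ∷ c (# 0) ∷ [])
            ∷ []

    windows : List (Fin 5 × Fin 5 × Fin 5)
    windows = (# 0 , # 1 , # 2) ∷ (# 1 , # 2 , # 0) ∷ (# 2 , # 0 , # 1) ∷ (# 1 , # 2 , # 3)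
            ∷ (# 2 , # 3 , # 4) ∷ (# 3 , # 4 , # 0) ∷ (# 4 , # 0 , # 1) ∷ []

    module _ (w : Witness) where
      open Witness w

      pairColour : Side × Fin 5 → Colour
      pairColour (first  , i) = Vec.lookup cyclic i
      pairColour (second , i) = Vec.lookup diagonal i

      colourOf : Fin 5 → Fin 5 → Colour
      colourOf a b = pairColour (pairIndex a b)

      rankOf : Fin 5 → ℕ
      rankOf = Vec.lookup ranks

      _=ᵗ_ : Triple → Triple → Bool
      (a , b , c) =ᵗ (a′ , b′ , c′) = (a ≡ᵇ a′) ∧ ((b ≡ᵇ b′) ∧ (c ≡ᵇ c′))

      fits : List Triple → Fin 5 → Fin 5 → Fin 5 → Bool
      fits Ts a b c = (rankOf a <ᵇ rankOf b) ∧ ((rankOf b <ᵇ rankOf c) ∧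
        any ((colourOf a b , colourOf a c , colourOf b c) =ᵗ_) Ts)

      fitsUnordered : List Triple → Fin 5 → Fin 5 → Fin 5 → Bool
      fitsUnordered Ts a b c = fits Ts a b c ∨ (fits Ts a c b ∨ (fits Ts b a c ∨ (fits Ts b c a ∨ (fits Ts c a b ∨ fits Ts c b a))))

      fitsWindow : List Triple → Fin 5 × Fin 5 × Fin 5 → Bool
      fitsWindow Ts (a , b , c) = fitsUnordered Ts a b c

      -- The strict rank comparisons separate any two vertices sharing a window, that is, all five.
      -- The bound 5 on the ranks limits the number of index blocks needed to realise the pattern.
      valid : List Triple → Bool
      valid Ts = all (fitsWindow Ts) windows ∧ all (λ a → rankOf a <ᵇ 5) (List.allFin 5)

    -- Colour 3 is the one with both bits, colours 4 and 5 complete its two pendant edges. In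
    -- `restrictionPalette` colours 3 and 4 are the ends of the link edge, each completed by a
    -- further colour.
    conflictPalette : Bit → Bit → List Triple
    conflictPalette p q = baseTriple ∷ pendant p 3 4 ∷ pendant q 3 5 ∷ []

    restrictionPalette : Bit → Bit → Bit → List Triple
    restrictionPalette p q s = baseTriple ∷ pendant p 3 4 ∷ pendant q 3 5 ∷ pendant s 4 6 ∷ []

    -- Pairs of bits that no colour can have simultaneously: with them the palette would contain a 5-cycle.
    conflicts : List (Bit × Bit × Witness)
    conflicts =
      (MaL , RaM , witness (0 ∷ 2 ∷ 3 ∷ 1 ∷ 4 ∷ []) (5 ∷ 3 ∷ 0 ∷ 3 ∷ 0 ∷ []) (0 ∷ 5 ∷ 4 ∷ 5 ∷ 3 ∷ [])) ∷
      (MaL , MaR , witness (0 ∷ 2 ∷ 4 ∷ 1 ∷ 3 ∷ []) (0 ∷ 2 ∷ 1 ∷ 0 ∷ 3 ∷ []) (1 ∷ 0 ∷ 2 ∷ 5 ∷ 4 ∷ [])) ∷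
      (MaL , RbL , witness (0 ∷ 3 ∷ 2 ∷ 1 ∷ 4 ∷ []) (1 ∷ 2 ∷ 0 ∷ 3 ∷ 5 ∷ []) (0 ∷ 1 ∷ 4 ∷ 1 ∷ 3 ∷ [])) ∷
      (MaL , LbR , witness (0 ∷ 3 ∷ 2 ∷ 1 ∷ 4 ∷ []) (3 ∷ 4 ∷ 0 ∷ 1 ∷ 5 ∷ []) (0 ∷ 3 ∷ 2 ∷ 3 ∷ 1 ∷ [])) ∷
      (MaL , McL , witness (0 ∷ 2 ∷ 4 ∷ 1 ∷ 3 ∷ []) (0 ∷ 4 ∷ 3 ∷ 2 ∷ 1 ∷ []) (3 ∷ 0 ∷ 5 ∷ 0 ∷ 2 ∷ [])) ∷
      (MaL , LcM , witness (0 ∷ 2 ∷ 3 ∷ 1 ∷ 4 ∷ []) (0 ∷ 4 ∷ 3 ∷ 2 ∷ 1 ∷ []) (3 ∷ 0 ∷ 5 ∷ 0 ∷ 2 ∷ [])) ∷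
      (RaL , LaR , witness (0 ∷ 1 ∷ 2 ∷ 3 ∷ 4 ∷ []) (0 ∷ 3 ∷ 0 ∷ 2 ∷ 1 ∷ []) (4 ∷ 5 ∷ 1 ∷ 0 ∷ 2 ∷ [])) ∷
      (RaL , MbL , witness (0 ∷ 2 ∷ 3 ∷ 1 ∷ 4 ∷ []) (0 ∷ 2 ∷ 1 ∷ 3 ∷ 4 ∷ []) (1 ∷ 0 ∷ 5 ∷ 0 ∷ 3 ∷ [])) ∷
      (RaL , LbM , witness (0 ∷ 2 ∷ 4 ∷ 1 ∷ 3 ∷ []) (0 ∷ 2 ∷ 1 ∷ 3 ∷ 4 ∷ []) (1 ∷ 0 ∷ 5 ∷ 0 ∷ 3 ∷ [])) ∷
      (RaL , RcL , witness (0 ∷ 2 ∷ 4 ∷ 1 ∷ 3 ∷ []) (0 ∷ 3 ∷ 5 ∷ 2 ∷ 1 ∷ []) (4 ∷ 2 ∷ 3 ∷ 0 ∷ 2 ∷ [])) ∷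
      (RaL , LcR , witness (0 ∷ 2 ∷ 4 ∷ 1 ∷ 3 ∷ []) (0 ∷ 2 ∷ 5 ∷ 3 ∷ 4 ∷ []) (1 ∷ 3 ∷ 2 ∷ 0 ∷ 3 ∷ [])) ∷
      (LaM , RaM , witness (0 ∷ 2 ∷ 1 ∷ 3 ∷ 4 ∷ []) (0 ∷ 3 ∷ 0 ∷ 2 ∷ 1 ∷ []) (5 ∷ 4 ∷ 1 ∷ 0 ∷ 2 ∷ [])) ∷
      (LaM , MaR , witness (0 ∷ 2 ∷ 1 ∷ 4 ∷ 3 ∷ []) (3 ∷ 0 ∷ 1 ∷ 2 ∷ 0 ∷ []) (5 ∷ 2 ∷ 0 ∷ 1 ∷ 4 ∷ [])) ∷
      (LaM , LbR , witness (0 ∷ 2 ∷ 3 ∷ 1 ∷ 4 ∷ []) (3 ∷ 4 ∷ 0 ∷ 1 ∷ 5 ∷ []) (0 ∷ 3 ∷ 2 ∷ 3 ∷ 1 ∷ [])) ∷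
      (LaM , LcM , witness (0 ∷ 3 ∷ 2 ∷ 1 ∷ 4 ∷ []) (0 ∷ 4 ∷ 3 ∷ 2 ∷ 1 ∷ []) (3 ∷ 0 ∷ 5 ∷ 0 ∷ 2 ∷ [])) ∷
      (RaM , LbR , witness (0 ∷ 1 ∷ 2 ∷ 4 ∷ 3 ∷ []) (4 ∷ 3 ∷ 1 ∷ 2 ∷ 0 ∷ []) (0 ∷ 5 ∷ 0 ∷ 1 ∷ 3 ∷ [])) ∷
      (RaM , McL , witness (0 ∷ 1 ∷ 4 ∷ 3 ∷ 2 ∷ []) (4 ∷ 3 ∷ 5 ∷ 2 ∷ 0 ∷ []) (0 ∷ 2 ∷ 3 ∷ 1 ∷ 3 ∷ [])) ∷
      (RaM , LcM , witness (0 ∷ 1 ∷ 3 ∷ 4 ∷ 2 ∷ []) (4 ∷ 3 ∷ 5 ∷ 2 ∷ 0 ∷ []) (0 ∷ 2 ∷ 3 ∷ 1 ∷ 3 ∷ [])) ∷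
      (RaM , RcM , witness (0 ∷ 3 ∷ 2 ∷ 1 ∷ 4 ∷ []) (0 ∷ 3 ∷ 5 ∷ 2 ∷ 1 ∷ []) (4 ∷ 2 ∷ 3 ∷ 0 ∷ 2 ∷ [])) ∷
      (RaM , McR , witness (0 ∷ 3 ∷ 1 ∷ 2 ∷ 4 ∷ []) (0 ∷ 3 ∷ 5 ∷ 2 ∷ 1 ∷ []) (4 ∷ 2 ∷ 3 ∷ 0 ∷ 2 ∷ [])) ∷
      (LaR , LbM , witness (0 ∷ 2 ∷ 4 ∷ 1 ∷ 3 ∷ []) (3 ∷ 5 ∷ 1 ∷ 0 ∷ 4 ∷ []) (1 ∷ 3 ∷ 2 ∷ 3 ∷ 0 ∷ [])) ∷
      (LaR , RbM , witness (0 ∷ 1 ∷ 2 ∷ 3 ∷ 4 ∷ []) (5 ∷ 3 ∷ 0 ∷ 2 ∷ 1 ∷ []) (1 ∷ 4 ∷ 1 ∷ 0 ∷ 3 ∷ [])) ∷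
      (LaR , MbR , witness (0 ∷ 1 ∷ 4 ∷ 3 ∷ 2 ∷ []) (5 ∷ 1 ∷ 2 ∷ 0 ∷ 3 ∷ []) (3 ∷ 0 ∷ 1 ∷ 4 ∷ 1 ∷ [])) ∷
      (LaR , LcR , witness (0 ∷ 2 ∷ 4 ∷ 1 ∷ 3 ∷ []) (3 ∷ 2 ∷ 1 ∷ 0 ∷ 4 ∷ []) (5 ∷ 0 ∷ 2 ∷ 3 ∷ 0 ∷ [])) ∷
      (MaR , LbR , witness (0 ∷ 1 ∷ 3 ∷ 4 ∷ 2 ∷ []) (4 ∷ 0 ∷ 2 ∷ 1 ∷ 3 ∷ []) (3 ∷ 1 ∷ 0 ∷ 5 ∷ 0 ∷ [])) ∷
      (MaR , McL , witness (0 ∷ 1 ∷ 2 ∷ 3 ∷ 4 ∷ []) (4 ∷ 0 ∷ 2 ∷ 5 ∷ 3 ∷ []) (3 ∷ 1 ∷ 3 ∷ 2 ∷ 0 ∷ [])) ∷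
      (MaR , LcM , witness (0 ∷ 1 ∷ 2 ∷ 4 ∷ 3 ∷ []) (4 ∷ 0 ∷ 2 ∷ 5 ∷ 3 ∷ []) (3 ∷ 1 ∷ 3 ∷ 2 ∷ 0 ∷ [])) ∷
      (MaR , McR , witness (0 ∷ 2 ∷ 4 ∷ 1 ∷ 3 ∷ []) (5 ∷ 2 ∷ 1 ∷ 0 ∷ 3 ∷ []) (3 ∷ 0 ∷ 2 ∷ 4 ∷ 2 ∷ [])) ∷
      (MbL , RbM , witness (0 ∷ 2 ∷ 3 ∷ 1 ∷ 4 ∷ []) (0 ∷ 2 ∷ 1 ∷ 3 ∷ 1 ∷ []) (1 ∷ 0 ∷ 4 ∷ 5 ∷ 2 ∷ [])) ∷
      (MbL , MbR , witness (0 ∷ 2 ∷ 4 ∷ 1 ∷ 3 ∷ []) (1 ∷ 4 ∷ 3 ∷ 1 ∷ 3 ∷ []) (3 ∷ 1 ∷ 4 ∷ 5 ∷ 4 ∷ [])) ∷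
      (MbL , RcL , witness (0 ∷ 1 ∷ 2 ∷ 4 ∷ 3 ∷ []) (0 ∷ 2 ∷ 3 ∷ 4 ∷ 1 ∷ []) (1 ∷ 5 ∷ 1 ∷ 3 ∷ 2 ∷ [])) ∷
      (RbL , LbR , witness (0 ∷ 1 ∷ 2 ∷ 3 ∷ 4 ∷ []) (1 ∷ 3 ∷ 1 ∷ 3 ∷ 4 ∷ []) (4 ∷ 5 ∷ 4 ∷ 1 ∷ 3 ∷ [])) ∷
      (RbL , McL , witness (0 ∷ 1 ∷ 3 ∷ 4 ∷ 2 ∷ []) (0 ∷ 2 ∷ 5 ∷ 3 ∷ 1 ∷ []) (1 ∷ 3 ∷ 2 ∷ 4 ∷ 2 ∷ [])) ∷
      (RbL , LcM , witness (0 ∷ 1 ∷ 4 ∷ 3 ∷ 2 ∷ []) (0 ∷ 2 ∷ 5 ∷ 3 ∷ 1 ∷ []) (1 ∷ 3 ∷ 2 ∷ 4 ∷ 2 ∷ [])) ∷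
      (RbL , RcM , witness (0 ∷ 3 ∷ 1 ∷ 2 ∷ 4 ∷ []) (1 ∷ 2 ∷ 5 ∷ 3 ∷ 4 ∷ []) (0 ∷ 3 ∷ 2 ∷ 1 ∷ 3 ∷ [])) ∷
      (RbL , McR , witness (0 ∷ 3 ∷ 2 ∷ 1 ∷ 4 ∷ []) (1 ∷ 2 ∷ 5 ∷ 3 ∷ 4 ∷ []) (0 ∷ 3 ∷ 2 ∷ 1 ∷ 3 ∷ [])) ∷
      (LbM , RbM , witness (0 ∷ 2 ∷ 4 ∷ 1 ∷ 3 ∷ []) (0 ∷ 2 ∷ 1 ∷ 3 ∷ 1 ∷ []) (1 ∷ 0 ∷ 4 ∷ 5 ∷ 2 ∷ [])) ∷
      (LbM , MbR , witness (0 ∷ 2 ∷ 3 ∷ 1 ∷ 4 ∷ []) (5 ∷ 1 ∷ 3 ∷ 1 ∷ 3 ∷ []) (3 ∷ 5 ∷ 4 ∷ 5 ∷ 1 ∷ [])) ∷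
      (LbM , RcL , witness (0 ∷ 1 ∷ 2 ∷ 3 ∷ 4 ∷ []) (0 ∷ 2 ∷ 3 ∷ 4 ∷ 1 ∷ []) (1 ∷ 5 ∷ 1 ∷ 3 ∷ 2 ∷ [])) ∷
      (RbM , RcL , witness (0 ∷ 2 ∷ 4 ∷ 1 ∷ 3 ∷ []) (4 ∷ 3 ∷ 5 ∷ 2 ∷ 1 ∷ []) (1 ∷ 2 ∷ 3 ∷ 0 ∷ 3 ∷ [])) ∷
      (RbM , LcR , witness (0 ∷ 2 ∷ 4 ∷ 1 ∷ 3 ∷ []) (0 ∷ 2 ∷ 5 ∷ 3 ∷ 1 ∷ []) (1 ∷ 3 ∷ 2 ∷ 4 ∷ 2 ∷ [])) ∷
      (LbR , McR , witness (0 ∷ 3 ∷ 2 ∷ 1 ∷ 4 ∷ []) (3 ∷ 2 ∷ 0 ∷ 1 ∷ 4 ∷ []) (5 ∷ 1 ∷ 2 ∷ 3 ∷ 1 ∷ [])) ∷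
      (MbR , LcR , witness (0 ∷ 3 ∷ 1 ∷ 2 ∷ 4 ∷ []) (3 ∷ 1 ∷ 0 ∷ 2 ∷ 5 ∷ []) (4 ∷ 2 ∷ 1 ∷ 3 ∷ 2 ∷ [])) ∷
      (McL , RcM , witness (0 ∷ 1 ∷ 4 ∷ 2 ∷ 3 ∷ []) (0 ∷ 2 ∷ 3 ∷ 2 ∷ 1 ∷ []) (1 ∷ 5 ∷ 4 ∷ 0 ∷ 2 ∷ [])) ∷
      (McL , McR , witness (0 ∷ 2 ∷ 4 ∷ 1 ∷ 3 ∷ []) (0 ∷ 2 ∷ 3 ∷ 2 ∷ 1 ∷ []) (1 ∷ 5 ∷ 4 ∷ 0 ∷ 2 ∷ [])) ∷
      (RcL , LcR , witness (0 ∷ 1 ∷ 2 ∷ 3 ∷ 4 ∷ []) (0 ∷ 2 ∷ 3 ∷ 2 ∷ 1 ∷ []) (1 ∷ 4 ∷ 5 ∷ 0 ∷ 2 ∷ [])) ∷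
      (LcM , RcM , witness (0 ∷ 1 ∷ 3 ∷ 2 ∷ 4 ∷ []) (0 ∷ 2 ∷ 3 ∷ 2 ∷ 1 ∷ []) (1 ∷ 5 ∷ 4 ∷ 0 ∷ 2 ∷ [])) ∷
      (LcM , McR , witness (0 ∷ 2 ∷ 3 ∷ 1 ∷ 4 ∷ []) (0 ∷ 2 ∷ 3 ∷ 2 ∷ 1 ∷ []) (1 ∷ 5 ∷ 4 ∷ 0 ∷ 2 ∷ [])) ∷ []

    -- The palette contains a 5-cycle as well if there are link edges of the first bit whose end playing that bit also has the second bit, while the other end has the third.
    restrictions : List (Bit × Bit × Bit × Witness)
    restrictions =
      (LaR , MbL , RbL , witness (0 ∷ 2 ∷ 3 ∷ 1 ∷ 4 ∷ []) (1 ∷ 5 ∷ 3 ∷ 4 ∷ 6 ∷ []) (3 ∷ 1 ∷ 0 ∷ 1 ∷ 4 ∷ [])) ∷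
      (RcL , MbR , LbR , witness (0 ∷ 3 ∷ 1 ∷ 2 ∷ 4 ∷ []) (4 ∷ 3 ∷ 5 ∷ 1 ∷ 6 ∷ []) (2 ∷ 1 ∷ 3 ∷ 4 ∷ 1 ∷ [])) ∷
      (McL , LaM , LaR , witness (0 ∷ 1 ∷ 2 ∷ 4 ∷ 3 ∷ []) (2 ∷ 4 ∷ 0 ∷ 5 ∷ 3 ∷ []) (3 ∷ 6 ∷ 3 ∷ 0 ∷ 4 ∷ [])) ∷
      (MaR , RcM , RcL , witness (0 ∷ 1 ∷ 4 ∷ 3 ∷ 2 ∷ []) (5 ∷ 3 ∷ 0 ∷ 4 ∷ 2 ∷ []) (2 ∷ 4 ∷ 3 ∷ 6 ∷ 3 ∷ [])) ∷ []

    conflictValid : Bit × Bit × Witness → Bool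
    conflictValid (p , q , w) = valid w (conflictPalette p q)

    restrictionValid : Bit × Bit × Bit × Witness → Bool
    restrictionValid (p , q , s , w) = valid w (restrictionPalette p q s)

    -- Evaluation: each listed witness exhibits a 5-cycle in its palette.
    conflicts-valid : all conflictValid conflicts ≡ true
    conflicts-valid = refl

    restrictions-valid : all restrictionValid restrictions ≡ true
    restrictions-valid = refl

  open Palette

  -- The cycle of length 3m + 2 in a realised palette.

  module CycleInPalette where
    <ᵇ-true : ∀ {m n} → (m <ᵇ n) ≡ true → m < n
    <ᵇ-true {m} {n} h = <ᵇ⇒< m n (subst T (sym h) _)

    <⇒<ᵇ-true : ∀ {m n} → m < n → (m <ᵇ n) ≡ true
    <⇒<ᵇ-true {m} {n} h with m <ᵇ n | <⇒<ᵇ h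
    ... | true | _ = refl

    ≥⇒<ᵇ-false : ∀ {m n} → n ≤ m → (m <ᵇ n) ≡ false
    ≥⇒<ᵇ-false {m} {n} h with m <ᵇ n in eq
    ... | false = refl
    ... | true  = ⊥-elim (<⇒≱ (<ᵇ-true eq) h)

    ≡ᵇ-true : ∀ {m n} → (m ≡ᵇ n) ≡ true → m ≡ n
    ≡ᵇ-true {m} {n} h = ≡ᵇ⇒≡ m n (subst T (sym h) _)

    ∨-true : ∀ {a b} → a ∨ b ≡ true → a ≡ true ⊎ b ≡ true
    ∨-true {true}  h = inj₁ refl
    ∨-true {false} h = inj₂ h

    any-true : ∀ {A : Set} (p : A → Bool) xs → any p xs ≡ true → ∃[ x ] (x ∈ xs × p x ≡ true)
    any-true p (x ∷ xs) h with ∨-true {p x} h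
    ... | inj₁ e = x , here refl , e
    ... | inj₂ e = let (y , y∈ , q) = any-true p xs e in y , there y∈ , q

    nth : List ℕ → ℕ → ℕ
    nth []      n       = 0
    nth (x ∷ S) zero    = x
    nth (x ∷ S) (suc n) = nth S n

    nth-∈ : ∀ S {p} → p < length S → nth S p ∈ S
    nth-∈ (x ∷ S) {zero}  h       = here refl
    nth-∈ (x ∷ S) {suc p} (s≤s h) = there (nth-∈ S h)

    nth-⊆₂ : ∀ S {p q} → p < q → q < length S → nth S p ∷ nth S q ∷ [] ⊆ S
    nth-⊆₂ (x ∷ S) {zero}  {suc q} h       (s≤s l) = refl ∷ go S l
      where
      go : ∀ S {q} → q < length S → nth S q ∷ [] ⊆ S
      go (y ∷ S) {zero}  l       = refl ∷ minimum S
      go (y ∷ S) {suc q} (s≤s l) = _ ∷ʳ go S l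
    nth-⊆₂ (x ∷ S) {suc p} {suc q} (s≤s h) (s≤s l) = _ ∷ʳ nth-⊆₂ S h l

    nth-⊆₃ : ∀ S {p q r} → p < q → q < r → r < length S → nth S p ∷ nth S q ∷ nth S r ∷ [] ⊆ S
    nth-⊆₃ (x ∷ S) {zero}  {suc q} {suc r} h       (s≤s h′) (s≤s l) = refl ∷ nth-⊆₂ S h′ l
    nth-⊆₃ (x ∷ S) {suc p} {suc q} {suc r} (s≤s h) (s≤s h′) (s≤s l) = _ ∷ʳ nth-⊆₃ S h h′ l

    -- The closed walk (v₀v₁v₂)…(v₀v₁v₂)v₃v₄ of length 3m+2 in the 5-cycle.
    walk : ℕ → ℕ → Fin 5
    walk zero    zero                = # 3
    walk zero    (suc n)             = # 4
    walk (suc m) zero                = # 0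
    walk (suc m) (suc zero)          = # 1
    walk (suc m) (suc (suc zero))    = # 2
    walk (suc m) (suc (suc (suc n))) = walk m n

    Window : Fin 5 → Fin 5 → Fin 5 → Set
    Window a b c = (a , b , c) ∈ windows

    walk-window : ∀ m n → 1 ≤ m → 2 + n < 2 + 3 * m → Window (walk m n) (walk m (1 + n)) (walk m (2 + n))
    walk-window (suc m)       zero          _ _ = here refl
    walk-window (suc zero)    (suc zero)    _ _ = there (there (there (here refl)))
    walk-window (suc (suc m)) (suc zero)    _ _ = there (here refl)
    walk-window (suc zero)    (suc (suc zero)) _ _ = there (there (there (there (here refl))))
    walk-window (suc (suc m)) (suc (suc zero)) _ _ = there (there (here refl))
    walk-window (suc m)       (suc (suc (suc n))) _ h with m | walk-window m n
    ... | zero  | _  = ⊥-elim (n≮0 (≤-pred (≤-pred (≤-pred (≤-pred (≤-pred h))))))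
    ... | suc m′ | ih = ih (s≤s z≤n) (≤-pred (≤-pred (≤-pred (≤-trans h (≤-reflexive (e m′))))))
      where
      e : ∀ m → 2 + 3 * suc (suc m) ≡ 3 + (2 + 3 * suc m)
      e = solve-∀

    walk-end : ∀ m → walk m (3 * m) ≡ # 3 × walk m (1 + 3 * m) ≡ # 4
    walk-end zero    = refl , refl
    walk-end (suc m) = subst (λ n → walk (suc m) n ≡ # 3 × walk (suc m) (1 + n) ≡ # 4) (sym (e m)) (walk-end m)
      where
      e : ∀ m → 3 * suc m ≡ 3 + 3 * m
      e = solve-∀

    module Cycle {V : Set} (E : ℕ → ℕ → ℕ → V → V → V → Bool) where

      Realized : (Colour → ℕ → ℕ → V) → List Triple → List ℕ → Set
      Realized X Ts S = ∀ {a b c i j k} → (a , b , c) ∈ Ts → i ∷ j ∷ k ∷ [] ⊆ S → E i j k (X a i j) (X b i k) (X c j k) ≡ true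

      record TightCycle (ℓ : ℕ) .⦃ _ : NonZero ℓ ⦄ (S : List ℕ) : Set where
        field
          a     : Fin ℓ → ℕ
          a∈    : ∀ t → a t ∈ S
          a-inj : ∀ {t u} → a t ≡ a u → t ≡ u
          c     : Fin ℓ → Fin ℓ → V
          c-sym : ∀ t u → c t u ≡ c u t

        Edge : Fin ℓ → Fin ℓ → Fin ℓ → Set
        Edge x y z = a x < a y × a y < a z × E (a x) (a y) (a z) (c x y) (c x z) (c y z) ≡ true

        field
          edges : ∀ t → let u = (toℕ t + 1) mod ℓ ; v = (toℕ t + 2) mod ℓ in
            Edge t u v ⊎ Edge t v u ⊎ Edge u t v ⊎ Edge u v t ⊎ Edge v t u ⊎ Edge v u t

      TightCycle-⊆ : ∀ {ℓ} .⦃ _ : NonZero ℓ ⦄ {S S′} → S ⊆ S′ → TightCycle ℓ S → TightCycle ℓ S′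
      TightCycle-⊆ p t = record
        { a = a ; a∈ = λ u → lookup p (a∈ u) ; a-inj = a-inj ; c = c ; c-sym = c-sym ; edges = edges }
        where open TightCycle t

      module _ (m : ℕ) (m≥1 : m ≥ 1) (w : Witness) (Ts : List Triple) (ok : valid w Ts ≡ true) (S : List ℕ)
        (sorted : ∀ {i j} → i ∷ j ∷ [] ⊆ S → i < j) (long : 5 * (2 + 3 * m) ≤ length S)
        (X : Colour → ℕ → ℕ → V) (real : Realized X Ts S) where

        private
          ℓ = 2 + 3 * m

          φ : Fin ℓ → Fin 5
          φ t = walk m (toℕ t)

          rank : Fin ℓ → ℕ
          rank t = rankOf w (φ t)

          -- All cycle vertices over one vertex of the 5-cycle share a block of ℓ positions, and the
          -- blocks follow the ranks. The summand t keeps positions inside a block distinct.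
          pos : Fin ℓ → ℕ
          pos t = rank t * ℓ + toℕ t

          rank<5 : ∀ t → rank t < 5
          rank<5 t = <ᵇ-true (all-∈ (λ a → rankOf w a <ᵇ 5) (proj₂ (∧-true {all (fitsWindow w Ts) windows} ok)) (∈-allFin (φ t)))

          pos< : ∀ t → pos t < length S
          pos< t = ≤-trans (+-monoʳ-< (rank t * ℓ) (Fin.toℕ<n t)) (≤-trans (≤-reflexive (+-comm (rank t * ℓ) ℓ))
            (≤-trans (*-monoˡ-≤ ℓ (rank<5 t)) long))

          rank-pos : ∀ {t u} → rank t < rank u → pos t < pos u
          rank-pos {t} {u} h = ≤-trans (+-monoʳ-< (rank t * ℓ) (Fin.toℕ<n t)) (≤-trans (≤-reflexive (+-comm (rank t * ℓ) ℓ))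
            (≤-trans (*-monoˡ-≤ ℓ h) (m≤m+n _ (toℕ u))))

          pos-inj : ∀ {t u} → pos t ≡ pos u → t ≡ u
          pos-inj {t} {u} e with <-cmp (rank t) (rank u)
          ... | tri< h _ _ = ⊥-elim (<⇒≢ (rank-pos {t} {u} h) e)
          ... | tri> _ _ h = ⊥-elim (<⇒≢ (rank-pos {u} {t} h) (sym e))
          ... | tri≈ _ h _ = Fin.toℕ-injective (+-cancelˡ-≡ (rank t * ℓ) _ _ (trans e (cong (λ r → r * ℓ + toℕ u) (sym h))))

          index : Fin ℓ → ℕ
          index t = nth S (pos t)

          pos-index : ∀ {t u} → pos t < pos u → index t < index u
          pos-index {t} {u} h = sorted (nth-⊆₂ S h (pos< u))

          index-inj : ∀ {t u} → index t ≡ index u → t ≡ u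
          index-inj {t} {u} e with <-cmp (pos t) (pos u)
          ... | tri< h _ _ = ⊥-elim (<⇒≢ (pos-index {t} {u} h) e)
          ... | tri> _ _ h = ⊥-elim (<⇒≢ (pos-index {u} {t} h) (sym e))
          ... | tri≈ _ h _ = pos-inj h

          vertex : Fin ℓ → Fin ℓ → V
          vertex t u = if pos t <ᵇ pos u then X (colourOf w (φ t) (φ u)) (index t) (index u)
                       else X (colourOf w (φ u) (φ t)) (index u) (index t)

          vertex-< : ∀ {t u} → pos t < pos u → vertex t u ≡ X (colourOf w (φ t) (φ u)) (index t) (index u)
          vertex-< h rewrite <⇒<ᵇ-true h = refl

          vertex-sym : ∀ t u → vertex t u ≡ vertex u t
          vertex-sym t u with <-cmp (pos t) (pos u)
          ... | tri< h _ _ rewrite <⇒<ᵇ-true h | ≥⇒<ᵇ-false {pos u} {pos t} (<⇒≤ h) = refl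
          ... | tri> _ _ h rewrite <⇒<ᵇ-true h | ≥⇒<ᵇ-false {pos t} {pos u} (<⇒≤ h) = refl
          ... | tri≈ _ h _ = cong₂ vertex (pos-inj h) (sym (pos-inj h))

          SortedEdge : Fin ℓ → Fin ℓ → Fin ℓ → Set
          SortedEdge x y z = index x < index y × index y < index z ×
            E (index x) (index y) (index z) (vertex x y) (vertex x z) (vertex y z) ≡ true

          =ᵗ-true : ∀ {s t} → (_=ᵗ_ w s t) ≡ true → s ≡ t
          =ᵗ-true {a , b , c} {a′ , b′ , c′} h with ∧-true h
          ... | p , h′ with ∧-true h′
          ...   | q , r = cong₂ _,_ (≡ᵇ-true p) (cong₂ _,_ (≡ᵇ-true q) (≡ᵇ-true r))

          fits-edge : ∀ x y z → fits w Ts (φ x) (φ y) (φ z) ≡ true → SortedEdge x y z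
          fits-edge x y z h with ∧-true h
          ... | xy , h′ with ∧-true h′
          ...   | yz , h″ with any-true (_=ᵗ_ w (colourOf w (φ x) (φ y) , colourOf w (φ x) (φ z) , colourOf w (φ y) (φ z))) Ts h″
          ...     | t , t∈ , e with =ᵗ-true {colourOf w (φ x) (φ y) , colourOf w (φ x) (φ z) , colourOf w (φ y) (φ z)} {t} e
          ...       | refl = pos-index {x} {y} x<y , pos-index {y} {z} y<z ,
                      trans (cong₂ (λ p (q , r) → E (index x) (index y) (index z) p q r) (vertex-< {x} {y} x<y)
                        (cong₂ _,_ (vertex-< {x} {z} (<-trans x<y y<z)) (vertex-< {y} {z} y<z)))
                        (real t∈ (nth-⊆₃ S x<y y<z (pos< z)))
            where
            x<y : pos x < pos y
            x<y = rank-pos {x} {y} (<ᵇ-true xy)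
            y<z : pos y < pos z
            y<z = rank-pos {y} {z} (<ᵇ-true yz)

          window-edge : ∀ x y z → Window (φ x) (φ y) (φ z) →
            SortedEdge x y z ⊎ SortedEdge x z y ⊎ SortedEdge y x z ⊎ SortedEdge y z x ⊎ SortedEdge z x y ⊎ SortedEdge z y x
          window-edge x y z win with ∨-true (all-∈ (fitsWindow w Ts) (proj₁ (∧-true {all (fitsWindow w Ts) windows} ok)) win)
          ... | inj₁ h = inj₁ (fits-edge x y z h)
          ... | inj₂ h with ∨-true h
          ...   | inj₁ h = inj₂ (inj₁ (fits-edge x z y h))
          ...   | inj₂ h with ∨-true h
          ...     | inj₁ h = inj₂ (inj₂ (inj₁ (fits-edge y x z h)))
          ...     | inj₂ h with ∨-true h
          ...       | inj₁ h = inj₂ (inj₂ (inj₂ (inj₁ (fits-edge y z x h))))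
          ...       | inj₂ h with ∨-true h
          ...         | inj₁ h = inj₂ (inj₂ (inj₂ (inj₂ (inj₁ (fits-edge z x y h)))))
          ...         | inj₂ h = inj₂ (inj₂ (inj₂ (inj₂ (inj₂ (fits-edge z y x h)))))

          toℕ-mod : ∀ n → toℕ (n mod ℓ) ≡ n % ℓ
          toℕ-mod n = Fin.toℕ-fromℕ< (m%n<n n ℓ)

          mod-walk : ∀ n → φ (n mod ℓ) ≡ walk m (n % ℓ)
          mod-walk n = cong (walk m) (toℕ-mod n)

          window : ∀ t → Window (φ t) (φ ((toℕ t + 1) mod ℓ)) (φ ((toℕ t + 2) mod ℓ))
          window t with <-cmp (toℕ t) (3 * m)
          ... | tri< h _ _ = subst₂ (Window (φ t))
                  (sym (trans (mod-walk (toℕ t + 1)) (cong (walk m) (trans (m<n⇒m%n≡m (h₁ h)) (+-comm (toℕ t) 1)))))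
                  (sym (trans (mod-walk (toℕ t + 2)) (cong (walk m) (trans (m<n⇒m%n≡m (h₂ h)) (+-comm (toℕ t) 2)))))
                  (walk-window m (toℕ t) m≥1 (s≤s (s≤s h)))
            where
            h₁ : toℕ t < 3 * m → toℕ t + 1 < ℓ
            h₁ h = ≤-trans (s≤s (≤-reflexive (+-comm (toℕ t) 1))) (≤-trans (s≤s (s≤s (<⇒≤ h))) ≤-refl)
            h₂ : toℕ t < 3 * m → toℕ t + 2 < ℓ
            h₂ h = ≤-trans (s≤s (≤-reflexive (+-comm (toℕ t) 2))) (s≤s (s≤s h))
          -- From here on the window passes the end of the closed walk: v₃v₄v₀, and v₄v₀v₁ in the
          -- last case.
          ... | tri≈ _ e _ = subst₃ (trans (cong (walk m) e) (proj₁ (walk-end m)))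
                  (trans (mod-walk (toℕ t + 1)) (trans (cong (walk m) (trans (cong (λ n → (n + 1) % ℓ) e)
                    (trans (m<n⇒m%n≡m (≤-reflexive (cong suc (+-comm (3 * m) 1)))) (+-comm (3 * m) 1)))) (proj₂ (walk-end m))))
                  (trans (mod-walk (toℕ t + 2)) (trans (cong (walk m) (trans (cong (λ n → (n + 2) % ℓ) e)
                    (trans (cong (_% ℓ) (+-comm (3 * m) 2)) (n%n≡0 ℓ)))) (walk-0 m m≥1)))
                  (there (there (there (there (there (here refl))))))
            where
            subst₃ : ∀ {a b c a′ b′ c′} → a ≡ a′ → b ≡ b′ → c ≡ c′ → Window a′ b′ c′ → Window a b c
            subst₃ refl refl refl x = x
            walk-0 : ∀ m → m ≥ 1 → walk m 0 ≡ # 0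
            walk-0 (suc m) _ = refl
          ... | tri> _ _ h = subst₃ (trans (cong (walk m) e) (proj₂ (walk-end m)))
                  (trans (mod-walk (toℕ t + 1)) (trans (cong (walk m) (trans (cong (λ n → (n + 1) % ℓ) e)
                    (trans (cong (_% ℓ) (+-comm (1 + 3 * m) 1)) (n%n≡0 ℓ)))) (walk-0 m m≥1)))
                  (trans (mod-walk (toℕ t + 2)) (trans (cong (walk m) (trans (cong (λ n → (n + 2) % ℓ) e)
                    (trans (cong (_% ℓ) (ee m)) (trans ([m+n]%n≡m%n 1 ℓ) (m<n⇒m%n≡m {n = ℓ} {m = 1} (s≤s (s≤s z≤n))))))) (walk-1 m m≥1)))
                  (there (there (there (there (there (there (here refl)))))))
            where
            e : toℕ t ≡ 1 + 3 * m
            e = ≤-antisym (≤-pred (Fin.toℕ<n t)) h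
            ee : ∀ m → 1 + 3 * m + 2 ≡ 1 + (2 + 3 * m)
            ee = solve-∀
            subst₃ : ∀ {a b c a′ b′ c′} → a ≡ a′ → b ≡ b′ → c ≡ c′ → Window a′ b′ c′ → Window a b c
            subst₃ refl refl refl x = x
            walk-0 : ∀ m → m ≥ 1 → walk m 0 ≡ # 0
            walk-0 (suc m) _ = refl
            walk-1 : ∀ m → m ≥ 1 → walk m 1 ≡ # 1
            walk-1 (suc m) _ = refl

        tightCycle : TightCycle (2 + 3 * m) S
        tightCycle = record
          { a = index ; a∈ = λ t → nth-∈ S (pos< t) ; a-inj = index-inj ; c = vertex ; c-sym = vertex-sym
          ; edges = λ t → window-edge t ((toℕ t + 1) mod (2 + 3 * m)) ((toℕ t + 2) mod (2 + 3 * m)) (window t) }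

  open CycleInPalette

  -- Degrees of vertices, their moments and rounded values.

  module DegreeLabels where
    open Measure

    module Indices = Extraction ℕ _<ᵇ_ (λ i → ≥⇒<ᵇ-false {i} {i} ≤-refl)
    open Indices using (extract; SortedI; module Size)

    search : ∀ {A : Set} → (A → Bool) → List A → A → A
    search p []       d = d
    search p (x ∷ xs) d = if p x then x else search p xs d

    search-true : ∀ {A : Set} (p : A → Bool) xs d {y} → y ∈ xs → p y ≡ true → search p xs d ∈ xs × p (search p xs d) ≡ true
    search-true p (x ∷ xs) d y∈ py with p x in eq
    ... | true = here refl , eq
    search-true p (x ∷ xs) d (here refl) py | false = ⊥-elim (true≢false (trans (sym py) eq))
      where
      true≢false : true ≡ false → ⊥
      true≢false ()
    search-true p (x ∷ xs) d (there y∈)  py | false = let (a , b) = search-true p xs d y∈ py in there a , b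

    term≤sumList : ∀ {A : Set} (xs : List A) (f : A → ℕ) {x} → x ∈ xs → f x ≤ sumList xs f
    term≤sumList (x ∷ xs) f (here refl) = m≤m+n _ _
    term≤sumList (x ∷ xs) f (there x∈)  = ≤-trans (term≤sumList xs f x∈) (m≤n+m _ _)

    Labels : Set
    Labels = Vec ℕ 9

    -- label v e s is the label of the base colour e in role s.
    label : Labels → Role → Role → ℕ
    label (a ∷ b ∷ c ∷ d ∷ e ∷ f ∷ g ∷ h ∷ i ∷ []) = λ
      { left  left → a ; left  mid → b ; left  right → c
      ; mid   left → d ; mid   mid → e ; mid   right → f
      ; right left → g ; right mid → h ; right right → i }

    total : Labels → ℕ
    total v = (label v left left + label v left mid + label v left right)
            + (label v mid left + label v mid mid + label v mid right)
            + (label v right left + label v right mid + label v right right)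

    abstract
      labelVectors : ℕ → List Labels
      labelVectors g = allVecs (upTo (suc g)) 9

      ∈-labelVectors : ∀ {g} (v : Labels) → (∀ i → Vec.lookup v i ≤ g) → v ∈ labelVectors g
      ∈-labelVectors v h = ∈-allVecs v (λ i → ∈-upTo⁺ (s≤s (h i)))

    module Degrees (L : ℕ) (1≤L : 1 ≤ L) (E : ℕ → ℕ → ℕ → Fin L → Fin L → Fin L → Bool) where
      open Size L 1≤L public

      L² L³ L⁵ : ℕ
      L² = L * L
      L³ = L * (L * L)
      L⁵ = L * (L² * L²)

      instance
        L²≢0 : NonZero L²
        L²≢0 = >-nonZero (*-mono-≤ 1≤L 1≤L)
        L³≢0 : NonZero L³
        L³≢0 = >-nonZero (*-mono-≤ 1≤L (*-mono-≤ 1≤L 1≤L))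
        L⁵≢0 : NonZero L⁵
        L⁵≢0 = >-nonZero (*-mono-≤ 1≤L (*-mono-≤ (*-mono-≤ 1≤L 1≤L) (*-mono-≤ 1≤L 1≤L)))

      mass-μ : mass μ ≡ L
      mass-μ = sumFin-1 L

      ⟨const⟩ : ∀ k → ⟨ (λ _ → k) ⟩ ≡ k * L
      ⟨const⟩ k = trans (∑-const μ k) (cong (k *_) mass-μ)

      ⟨≤⟩ : ∀ {f k} → (∀ v → f v ≤ k) → ⟨ f ⟩ ≤ k * L
      ⟨≤⟩ {f} {k} h = ≤-trans (∑-mono μ h) (≤-reflexive (⟨const⟩ k))

      edgeAt : Role → ℕ → ℕ → ℕ → V → V → V → Bool
      edgeAt s i j k v x y = let (a , b , c) = insert s v x y in E i j k a b c

      deg : Role → ℕ → ℕ → ℕ → V → ℕ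
      deg s i j k v = ⟨ (λ x → ⟨ (λ y → ind (edgeAt s i j k v x y)) ⟩) ⟩

      dens : ℕ → ℕ → ℕ → ℕ
      dens i j k = ⟨ (λ x → ⟨ (λ y → ⟨ (λ z → ind (E i j k x y z)) ⟩) ⟩) ⟩

      deg≤ : ∀ s i j k v → deg s i j k v ≤ L²
      deg≤ s i j k v = ⟨≤⟩ (λ x → ≤-trans (⟨≤⟩ (λ y → ind≤1 (edgeAt s i j k v x y))) (≤-reflexive (*-identityˡ L)))

      at₃ : Role → V × V × V → V
      at₃ left  (x , y , z) = x
      at₃ mid   (x , y , z) = y
      at₃ right (x , y , z) = z

      weighted : ∀ s i j k (h : V → ℕ) →
        ⟨ (λ x → ⟨ (λ y → ⟨ (λ z → ind (E i j k x y z) * h (at₃ s (x , y , z))) ⟩) ⟩) ⟩ ≡ ⟨ (λ v → deg s i j k v * h v) ⟩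
      weighted left  i j k h = ∑-cong μ (λ x → trans (∑-cong μ (λ y → ∑-*ʳ μ _ (h x))) (∑-*ʳ μ _ (h x)))
      weighted mid   i j k h = trans (∑-swap L L _) (∑-cong μ (λ y → trans (∑-cong μ (λ x → ∑-*ʳ μ _ (h y))) (∑-*ʳ μ _ (h y))))
      weighted right i j k h = trans (∑-cong μ (λ x → ∑-swap L L _)) (trans (∑-swap L L _)
        (∑-cong μ (λ z → trans (∑-cong μ (λ x → ∑-*ʳ μ _ (h z))) (∑-*ʳ μ _ (h z)))))

      dens-deg : ∀ s i j k → ⟨ deg s i j k ⟩ ≡ dens i j k
      dens-deg s i j k = trans (∑-cong μ (λ v → sym (*-identityʳ _))) (trans (sym (weighted s i j k (λ _ → 1)))
        (∑-cong μ (λ x → ∑-cong μ (λ y → ∑-cong μ (λ z → *-identityʳ _)))))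

      -- The vertex belongs to V_pq; the third indices tR < p < tM < q < tL produce the triads in
      -- which it is right, mid and left.
      degSum : (tR p tM q tL : ℕ) → V → ℕ
      degSum tR p tM q tL v = deg right tR p q v + deg mid p tM q v + deg left p q tL v

      degAt : Role → (tR p tM q tL : ℕ) → V → ℕ
      degAt left  tR p tM q tL = deg left p q tL
      degAt mid   tR p tM q tL = deg mid p tM q
      degAt right tR p tM q tL = deg right tR p q

      -- A vertex is met by the edges of a triad as often as its degree says. By `weighted`, the
      -- moment is thus the sum of `degSum` over the edges, evaluated at their vertex in role `s`.
      moment : Role → (tR p tM q tL : ℕ) → ℕ
      moment s tR p tM q tL = ⟨ (λ v → degAt s tR p tM q tL v * degSum tR p tM q tL v) ⟩

      degSum≤ : ∀ tR p tM q tL v → degSum tR p tM q tL v ≤ 3 * L²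
      degSum≤ tR p tM q tL v = ≤-trans (+-mono-≤ (+-mono-≤ (deg≤ right tR p q v) (deg≤ mid p tM q v)) (deg≤ left p q tL v))
        (≤-reflexive (e L²))
        where
        e : ∀ a → a + a + a ≡ 3 * a
        e = solve-∀

      module _ (G : ℕ) where

        densFloor : List ℕ → ℕ
        densFloor (i ∷ j ∷ k ∷ []) = (G * dens i j k) / L³
        densFloor _ = 0

        momentFloor : Role → List ℕ → ℕ
        momentFloor s (tR ∷ p ∷ tM ∷ q ∷ tL ∷ []) = (G * moment s tR p tM q tL) / L⁵
        momentFloor s _ = 0

        densFloor-∈ : ∀ Q → length Q ≡ 3 → densFloor Q ∈ upTo (suc G)
        densFloor-∈ (i ∷ j ∷ k ∷ []) refl = ∈-upTo⁺ (s≤s (≤-trans (/-monoˡ-≤ L³ (*-monoʳ-≤ G bound)) (≤-reflexive (m*n/n≡m G L³))))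
          where
          bound : dens i j k ≤ L³
          bound = ≤-trans (⟨≤⟩ (λ x → deg≤ left i j k x)) (≤-reflexive (*-comm L² L))

        momentFloor-∈ : ∀ s Q → length Q ≡ 5 → momentFloor s Q ∈ upTo (suc (3 * G))
        momentFloor-∈ s (tR ∷ p ∷ tM ∷ q ∷ tL ∷ []) refl = ∈-upTo⁺ (s≤s (≤-trans (/-monoˡ-≤ L⁵ (*-monoʳ-≤ G bound))
          (≤-trans (≤-reflexive (cong (_/ L⁵) (e₁ G L⁵))) (≤-reflexive (m*n/n≡m (3 * G) L⁵)))))
          where
          degAt≤ : ∀ s v → degAt s tR p tM q tL v ≤ L²
          degAt≤ left  v = deg≤ left p q tL v
          degAt≤ mid   v = deg≤ mid p tM q v
          degAt≤ right v = deg≤ right tR p q v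
          e₁ : ∀ G x → G * (3 * x) ≡ 3 * G * x
          e₁ = solve-∀
          e₂ : ∀ a l → a * (3 * a) * l ≡ 3 * (l * (a * a))
          e₂ = solve-∀
          bound : moment s tR p tM q tL ≤ 3 * L⁵
          bound = ≤-trans (⟨≤⟩ (λ v → *-mono-≤ (degAt≤ s v) (degSum≤ tR p tM q tL v))) (≤-reflexive (e₂ L² L))

      module _ (g : ℕ) where

        degLabel : Role → ℕ → ℕ → ℕ → V → ℕ
        degLabel s i j k v = (g * deg s i j k v) / L²

        tests : Labels → Tests
        tests v = record
          { F      = λ i j k x y z → E i j k x y z ∧ ((degLabel left i j k x ≡ᵇ label v left left) ∧
                       ((degLabel mid i j k y ≡ᵇ label v mid mid) ∧ (degLabel right i j k z ≡ᵇ label v right right)))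
          ; leftR  = λ t p q x → degLabel right t p q x ≡ᵇ label v left right
          ; leftM  = λ p t q x → degLabel mid p t q x ≡ᵇ label v left mid
          ; midR   = λ t p q y → degLabel right t p q y ≡ᵇ label v mid right
          ; midL   = λ p q t y → degLabel left p q t y ≡ᵇ label v mid left
          ; rightM = λ p t q z → degLabel mid p t q z ≡ᵇ label v right mid
          ; rightL = λ p q t z → degLabel left p q t z ≡ᵇ label v right left
          }

        -- Labels are degrees in units of L² / g, rounded down; `heavy` says that the nine of them
        -- sum to more than 4/3.
        record Base (S : List ℕ) : Set where
          field
            labels   : Labels
            heavy    : 4 * g + 1 ≤ 3 * total labels
            B        : Role → ℕ → ℕ → V
            triangle : ∀ {i j k} → i ∷ j ∷ k ∷ [] ⊆ S → E i j k (B left i j) (B mid i k) (B right j k) ≡ true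
            degree   : ∀ e s {i j k} → i ∷ j ∷ k ∷ [] ⊆ S → label labels e s * L² ≤ g * deg s i j k (at s (B e) i j k)

        Heavy : Labels → Bool
        Heavy v = (4 * g + 1) ≤ᵇ (3 * total v)

        good : ℕ → (r t₀ i t₁ j m k l l′ : ℕ) → Labels → Bool
        good b r t₀ i t₁ j m k l l′ v = Heavy v ∧
          (L³ ≤ᵇ b * ⟨ (λ x → ⟨ (λ y → ⟨ (λ z → weight (tests v) r t₀ i t₁ j m k l l′ x y z) ⟩) ⟩) ⟩)

        pickLabels : ℕ → List ℕ → Labels
        pickLabels b (r ∷ t₀ ∷ i ∷ t₁ ∷ j ∷ m ∷ k ∷ l ∷ l′ ∷ []) =
          search (good b r t₀ i t₁ j m k l l′) (labelVectors g) (Vec.replicate 9 0)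
        pickLabels b _ = Vec.replicate 9 0

        ≡ᵇ-refl : ∀ n → (n ≡ᵇ n) ≡ true
        ≡ᵇ-refl zero    = refl
        ≡ᵇ-refl (suc n) = ≡ᵇ-refl n

        toBase : ∀ {v S} → 4 * g + 1 ≤ 3 * total v → System (tests v) S → Base S
        toBase {v} {S} hv sys = record
          { labels = v ; heavy = hv ; B = B
          ; triangle = λ s → proj₁ (own s)
          ; degree = λ e r {i} {j} {k} s → subst (λ n → n * L² ≤ g * deg r i j k (at r (B e) i j k))
              (≡ᵇ-true {degLabel r i j k (at r (B e) i j k)} (exact e r s)) (m/n*n≤m (g * deg r i j k (at r (B e) i j k)) L²) }
          where
          B : Role → ℕ → ℕ → V
          B left  = System.X sys
          B mid   = System.Y sys
          B right = System.Z sys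
          own : ∀ {i j k} → i ∷ j ∷ k ∷ [] ⊆ S → E i j k (B left i j) (B mid i k) (B right j k) ≡ true ×
            (degLabel left i j k (B left i j) ≡ᵇ label v left left) ≡ true ×
            (degLabel mid i j k (B mid i k) ≡ᵇ label v mid mid) ≡ true ×
            (degLabel right i j k (B right j k) ≡ᵇ label v right right) ≡ true
          own {i} {j} {k} s =
            let (a , h)  = ∧-true {E i j k (B left i j) (B mid i k) (B right j k)} (System.edge sys s)
                (b , h′) = ∧-true {degLabel left i j k (B left i j) ≡ᵇ label v left left} h
                (c , d)  = ∧-true {degLabel mid i j k (B mid i k) ≡ᵇ label v mid mid} h′
            in a , b , c , d
          exact : ∀ e s {i j k} → i ∷ j ∷ k ∷ [] ⊆ S → (degLabel s i j k (at s (B e) i j k) ≡ᵇ label v e s) ≡ true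
          exact left  left  s = proj₁ (proj₂ (own s))
          exact left  mid   s = System.testLM sys s
          exact left  right s = System.testLR sys s
          exact mid   left  s = System.testML sys s
          exact mid   mid   s = proj₁ (proj₂ (proj₂ (own s)))
          exact mid   right s = System.testMR sys s
          exact right left  s = System.testRL sys s
          exact right mid   s = System.testRM sys s
          exact right right s = proj₂ (proj₂ (proj₂ (own s)))

  open DegreeLabels

  -- Stage one: base colours of large total degree.

  module BaseColours where
    open Measure
    open Indices using (extract; SortedI; module Size)

    -- With G = 1620q and d = D / G, the hypotheses read d ≥ 4/27 + 1/27q and 9d² ≤ A / G up to
    -- rounding. The conclusion puts A / D, the mean sum of nine degrees per edge, above 4/3, the 30
    -- leaving room for rounding nine labels.
    numeric : ∀ q D A → 60 * (4 * q + 1) ≤ D + 1 → D * D ≤ 180 * q * (A + 3) →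
      (4 * (60 * q) + 30) * (D + 1) + 1 ≤ 3 * (60 * q) * A
    numeric q D A h₁ h₂ = +-cancelʳ-≤ (540 * q) _ _ (begin
      (4 * (60 * q) + 30) * (D + 1) + 1 + 540 * q   ≡⟨ e₁ q D ⟩
      (240 * q + 30) * D + (780 * q + 31)           ≤⟨ +-monoʳ-≤ ((240 * q + 30) * D) big ⟩
      (240 * q + 30) * D + 29 * D                   ≡⟨ e₂ q D ⟩
      (240 * q + 59) * D                            ≤⟨ *-monoˡ-≤ D D≥ ⟩
      D * D                                         ≤⟨ h₂ ⟩
      180 * q * (A + 3)                             ≡⟨ e₅ q A ⟩
      3 * (60 * q) * A + 540 * q                    ∎)
      where
      open ≤-Reasoning
      e₁ : ∀ q D → (4 * (60 * q) + 30) * (D + 1) + 1 + 540 * q ≡ (240 * q + 30) * D + (780 * q + 31)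
      e₁ = solve-∀
      e₂ : ∀ q D → (240 * q + 30) * D + 29 * D ≡ (240 * q + 59) * D
      e₂ = solve-∀
      e₅ : ∀ q A → 180 * q * (A + 3) ≡ 3 * (60 * q) * A + 540 * q
      e₅ = solve-∀
      e₆ : ∀ q → 240 * q + 59 + 1 ≡ 60 * (4 * q + 1)
      e₆ = solve-∀
      D≥ : 240 * q + 59 ≤ D
      D≥ = +-cancelʳ-≤ 1 (240 * q + 59) D (≤-trans (≤-reflexive (e₆ q)) h₁)
      e₇ : ∀ q → 29 * (240 * q + 59) ≡ 780 * q + 31 + (6180 * q + 1680)
      e₇ = solve-∀
      big : 780 * q + 31 ≤ 29 * D
      big = ≤-trans (≤-trans (m≤m+n _ _) (≤-reflexive (sym (e₇ q)))) (*-monoʳ-≤ 29 D≥)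

    ind-positive : ∀ h {X c w} → 1 ≤ X → X ≤ c * (ind h * w) → h ≡ true × X ≤ c * w
    ind-positive true  {X} {c} {w} _   p = refl , ≤-trans p (≤-reflexive (cong (c *_) (+-identityʳ w)))
    ind-positive false {X} {c}     1≤X p = ⊥-elim (<-irrefl refl (≤-trans 1≤X (≤-trans p (≤-reflexive (*-zeroʳ c)))))

    ≤⇒≤ᵇ-true : ∀ {m n} → m ≤ n → (m ≤ᵇ n) ≡ true
    ≤⇒≤ᵇ-true {m} {n} h with m ≤ᵇ n | ≤⇒≤ᵇ h
    ... | true | _ = refl

    module Counting (L : ℕ) (1≤L : 1 ≤ L) (E : ℕ → ℕ → ℕ → Fin L → Fin L → Fin L → Bool)
      (q g G : ℕ) (1≤q : 1 ≤ q) (eg : g ≡ 60 * q) (eG : G ≡ 27 * q * 60) where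
      open Degrees L 1≤L E

      module _ {W : List ℕ} (D Al Am Ar : ℕ)
        (dense : ∀ {i j k} → i ∷ j ∷ k ∷ [] ⊆ W → (4 * q + 1) * L³ ≤ 27 * q * dens i j k)
        (cD : ∀ Q → Q ⊆ W → length Q ≡ 3 → densFloor G Q ≡ D)
        (cl : ∀ Q → Q ⊆ W → length Q ≡ 5 → momentFloor G left Q ≡ Al)
        (cm : ∀ Q → Q ⊆ W → length Q ≡ 5 → momentFloor G mid Q ≡ Am)
        (cr : ∀ Q → Q ⊆ W → length Q ≡ 5 → momentFloor G right Q ≡ Ar)
        {r t₀ i t₁ j m k l l′ : ℕ} (sub : r ∷ t₀ ∷ i ∷ t₁ ∷ j ∷ m ∷ k ∷ l ∷ l′ ∷ [] ⊆ W) where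

        private
          A = Al + Am + Ar
          open ≤-Reasoning

          sα : t₀ ∷ i ∷ t₁ ∷ j ∷ k ∷ [] ⊆ W
          sα = ⊆-trans (_ ∷ʳ refl ∷ refl ∷ refl ∷ refl ∷ _ ∷ʳ refl ∷ _ ∷ʳ _ ∷ʳ []) sub
          sβ : r ∷ i ∷ j ∷ k ∷ l ∷ [] ⊆ W
          sβ = ⊆-trans (refl ∷ _ ∷ʳ refl ∷ _ ∷ʳ refl ∷ _ ∷ʳ refl ∷ refl ∷ _ ∷ʳ []) sub
          sγ : i ∷ j ∷ m ∷ k ∷ l′ ∷ [] ⊆ W
          sγ = ⊆-trans (_ ∷ʳ _ ∷ʳ refl ∷ _ ∷ʳ refl ∷ refl ∷ refl ∷ _ ∷ʳ refl ∷ []) sub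
          sijk : i ∷ j ∷ k ∷ [] ⊆ W
          sijk = ⊆-trans (refl ∷ refl ∷ _ ∷ʳ refl ∷ _ ∷ʳ []) sγ

          densBounds : ∀ {i j k} → i ∷ j ∷ k ∷ [] ⊆ W → D * L³ ≤ G * dens i j k × G * dens i j k ≤ suc D * L³
          densBounds s = floor-bounds G _ L³ (cD _ s refl)

          momentBounds : ∀ {s C} → (∀ Q → Q ⊆ W → length Q ≡ 5 → momentFloor G s Q ≡ C) →
            ∀ {tR p tM q tL} → tR ∷ p ∷ tM ∷ q ∷ tL ∷ [] ⊆ W →
            C * L⁵ ≤ G * moment s tR p tM q tL × G * moment s tR p tM q tL ≤ suc C * L⁵
          momentBounds c s = floor-bounds G _ L⁵ (c _ s refl)

          27q≢0 : NonZero (27 * q)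
          27q≢0 = m*n≢0 27 q ⦃ _ ⦄ ⦃ >-nonZero 1≤q ⦄

          D-large′ : G * (4 * q + 1) ≤ 27 * q * (D + 1)
          D-large′ = *-cancelʳ-≤ _ _ L³ (begin
            G * (4 * q + 1) * L³           ≡⟨ *-assoc G (4 * q + 1) L³ ⟩
            G * ((4 * q + 1) * L³)         ≤⟨ *-monoʳ-≤ G (dense sijk) ⟩
            G * (27 * q * dens i j k)      ≡⟨ e G (27 * q) (dens i j k) ⟩
            27 * q * (G * dens i j k)      ≤⟨ *-monoʳ-≤ (27 * q) (proj₂ (densBounds sijk)) ⟩
            27 * q * (suc D * L³)          ≡⟨ e′ (27 * q) D L³ ⟩
            27 * q * (D + 1) * L³          ∎)
            where
            e : ∀ G a x → G * (a * x) ≡ a * (G * x)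
            e = solve-∀
            e′ : ∀ a D x → a * (suc D * x) ≡ a * (D + 1) * x
            e′ = solve-∀

          D-large : 60 * (4 * q + 1) ≤ D + 1
          D-large = *-cancelˡ-≤ (27 * q) ⦃ 27q≢0 ⦄ (≤-trans (≤-reflexive (trans (sym (*-assoc (27 * q) 60 (4 * q + 1)))
            (cong (_* (4 * q + 1)) (sym eG)))) D-large′)

          -- Cauchy-Schwarz for `degSum` on V_ij: its sum consists of three triad densities, its sum
          -- of squares of the moments of the three roles, here all for the same vertex.
          squares′ : 9 * (D * D) ≤ G * (A + 3)
          squares′ = *-cancelʳ-≤ _ _ (L * L⁵) ⦃ m*n≢0 L L⁵ ⦃ >-nonZero 1≤L ⦄ ⦄ (begin
            9 * (D * D) * (L * L⁵)
              ≡⟨ e₁ D L ⟩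
            (3 * (D * L³)) * (3 * (D * L³))
              ≤⟨ *-mono-≤ sumLower sumLower ⟩
            (G * ⟨ s ⟩) * (G * ⟨ s ⟩)
              ≡⟨ e₂ G ⟨ s ⟩ ⟩
            G * G * (⟨ s ⟩ * ⟨ s ⟩)
              ≤⟨ *-monoʳ-≤ (G * G) (≤-trans (cauchy-schwarz μ s) (≤-reflexive (cong (_* ⟨ (λ v → s v * s v) ⟩) mass-μ))) ⟩
            G * G * (L * ⟨ (λ v → s v * s v) ⟩)
              ≡⟨ e₃ G L ⟨ (λ v → s v * s v) ⟩ ⟩
            G * L * (G * ⟨ (λ v → s v * s v) ⟩)
              ≤⟨ *-monoʳ-≤ (G * L) squareUpper ⟩
            G * L * ((A + 3) * L⁵)
              ≡⟨ e₄ G L (A + 3) L⁵ ⟩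
            G * (A + 3) * (L * L⁵) ∎)
            where
            s : V → ℕ
            s = degSum t₀ i t₁ j k
            e₁ : ∀ D L → 9 * (D * D) * (L * (L * (L * L * (L * L)))) ≡ (3 * (D * (L * (L * L)))) * (3 * (D * (L * (L * L))))
            e₁ = solve-∀
            e₂ : ∀ G s → (G * s) * (G * s) ≡ G * G * (s * s)
            e₂ = solve-∀
            e₃ : ∀ G L x → G * G * (L * x) ≡ G * L * (G * x)
            e₃ = solve-∀
            e₄ : ∀ G L a x → G * L * (a * x) ≡ G * a * (L * x)
            e₄ = solve-∀
            e₅ : ∀ x → x + x + x ≡ 3 * x
            e₅ = solve-∀
            e₆ : ∀ G a b c → G * a + G * b + G * c ≡ G * (a + b + c)
            e₆ = solve-∀
            sumLower : 3 * (D * L³) ≤ G * ⟨ s ⟩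
            sumLower = begin
              3 * (D * L³)                             ≡⟨ e₅ (D * L³) ⟨
              D * L³ + D * L³ + D * L³
                ≤⟨ +-mono-≤ (+-mono-≤ (proj₁ (densBounds (⊆-trans (refl ∷ refl ∷ _ ∷ʳ refl ∷ _ ∷ʳ []) sα)))
                     (proj₁ (densBounds (⊆-trans (_ ∷ʳ refl ∷ refl ∷ refl ∷ _ ∷ʳ []) sα)))) (proj₁ (densBounds sijk)) ⟩
              G * dens t₀ i j + G * dens i t₁ j + G * dens i j k
                ≡⟨ e₆ G (dens t₀ i j) (dens i t₁ j) (dens i j k) ⟩
              G * (dens t₀ i j + dens i t₁ j + dens i j k)
                ≡⟨ cong (G *_) (sym (trans (∑-+ μ _ _) (cong₂ _+_ (trans (∑-+ μ _ _)
                     (cong₂ _+_ (dens-deg right t₀ i j) (dens-deg mid i t₁ j))) (dens-deg left i j k)))) ⟩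
              G * ⟨ s ⟩ ∎
            squareUpper : G * ⟨ (λ v → s v * s v) ⟩ ≤ (A + 3) * L⁵
            squareUpper = begin
              G * ⟨ (λ v → s v * s v) ⟩
                ≡⟨ cong (G *_) (trans (∑-cong μ (λ v → trans (*-distribʳ-+ (s v) (deg right t₀ i j v + deg mid i t₁ j v) (deg left i j k v))
                     (cong (_+ deg left i j k v * s v) (*-distribʳ-+ (s v) (deg right t₀ i j v) (deg mid i t₁ j v)))))
                     (trans (∑-+ μ _ _) (cong (_+ moment left t₀ i t₁ j k) (∑-+ μ _ _)))) ⟩
              G * (moment right t₀ i t₁ j k + moment mid t₀ i t₁ j k + moment left t₀ i t₁ j k)
                ≡⟨ e₆ G _ _ _ ⟨
              G * moment right t₀ i t₁ j k + G * moment mid t₀ i t₁ j k + G * moment left t₀ i t₁ j k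
                ≤⟨ +-mono-≤ (+-mono-≤ (proj₂ (momentBounds {right} cr sα)) (proj₂ (momentBounds {mid} cm sα))) (proj₂ (momentBounds {left} cl sα)) ⟩
              suc Ar * L⁵ + suc Am * L⁵ + suc Al * L⁵
                ≡⟨ e₇ Al Am Ar L⁵ ⟩
              (A + 3) * L⁵ ∎
              where
              e₇ : ∀ a b c x → suc c * x + suc b * x + suc a * x ≡ (a + b + c + 3) * x
              e₇ = solve-∀

          squares : D * D ≤ 180 * q * (A + 3)
          squares = *-cancelˡ-≤ 9 (≤-trans squares′ (≤-reflexive (trans (cong (_* (A + 3)) eG) (e q (A + 3)))))
            where
            e : ∀ q a → 27 * q * 60 * a ≡ 9 * (180 * q * a)
            e = solve-∀

          sα′ : V → ℕ
          sα′ = degSum t₀ i t₁ j k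
          sβ′ : V → ℕ
          sβ′ = degSum r i j k l
          sγ′ : V → ℕ
          sγ′ = degSum i j m k l′

          nine : V → V → V → ℕ
          nine x y z = sα′ x + sβ′ y + sγ′ z

          lv : V → V → V → Labels
          lv x y z = degLabel g left i j k x ∷ degLabel g mid i t₁ j x ∷ degLabel g right t₀ i j x
                   ∷ degLabel g left i k l y ∷ degLabel g mid i j k y ∷ degLabel g right r i k y
                   ∷ degLabel g left j k l′ z ∷ degLabel g mid j m k z ∷ degLabel g right i j k z ∷ []

          degLabel≤ : ∀ s i j k v → degLabel g s i j k v ≤ g
          degLabel≤ s i j k v = ≤-trans (/-monoˡ-≤ L² (*-monoʳ-≤ g (deg≤ s i j k v))) (≤-reflexive (m*n/n≡m g L²))

          lv-∈ : ∀ x y z → lv x y z ∈ labelVectors g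
          lv-∈ x y z = ∈-labelVectors (lv x y z) λ
            { zero → degLabel≤ left i j k x
            ; (suc zero) → degLabel≤ mid i t₁ j x
            ; (suc (suc zero)) → degLabel≤ right t₀ i j x
            ; (suc (suc (suc zero))) → degLabel≤ left i k l y
            ; (suc (suc (suc (suc zero)))) → degLabel≤ mid i j k y
            ; (suc (suc (suc (suc (suc zero))))) → degLabel≤ right r i k y
            ; (suc (suc (suc (suc (suc (suc zero)))))) → degLabel≤ left j k l′ z
            ; (suc (suc (suc (suc (suc (suc (suc zero))))))) → degLabel≤ mid j m k z
            ; (suc (suc (suc (suc (suc (suc (suc (suc zero)))))))) → degLabel≤ right i j k z }

          weight-lv : ∀ x y z → weight (tests g (lv x y z)) r t₀ i t₁ j m k l l′ x y z ≡ ind (E i j k x y z)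
          weight-lv x y z
            rewrite ≡ᵇ-refl g (degLabel g right t₀ i j x) | ≡ᵇ-refl g (degLabel g mid i t₁ j x)
                  | ≡ᵇ-refl g (degLabel g left i j k x) | ≡ᵇ-refl g (degLabel g mid i j k y) | ≡ᵇ-refl g (degLabel g right i j k z)
                  | ≡ᵇ-refl g (degLabel g right r i k y) | ≡ᵇ-refl g (degLabel g left i k l y)
                  | ≡ᵇ-refl g (degLabel g mid j m k z) | ≡ᵇ-refl g (degLabel g left j k l′ z)
                  | Bool.∧-identityʳ (E i j k x y z) = trans (+-identityʳ _) (*-identityʳ _)

          up : ∀ s i j k v → g * deg s i j k v ≤ suc (degLabel g s i j k v) * L²
          up s i j k v = proj₂ (floor-bounds g (deg s i j k v) L² refl)

          slot : ∀ tR p tM q tL v → g * degSum tR p tM q tL v ≤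
            (degLabel g left p q tL v + degLabel g mid p tM q v + degLabel g right tR p q v + 3) * L²
          slot tR p tM q tL v = ≤-trans (≤-reflexive (e₁ g (deg right tR p q v) (deg mid p tM q v) (deg left p q tL v)))
            (≤-trans (+-mono-≤ (+-mono-≤ (up right tR p q v) (up mid p tM q v)) (up left p q tL v))
            (≤-reflexive (e₂ (degLabel g right tR p q v) (degLabel g mid p tM q v) (degLabel g left p q tL v) L²)))
            where
            e₁ : ∀ g r m l → g * (r + m + l) ≡ g * r + g * m + g * l
            e₁ = solve-∀
            e₂ : ∀ r m l x → suc r * x + suc m * x + suc l * x ≡ (l + m + r + 3) * x
            e₂ = solve-∀

          g-nine : ∀ x y z → g * nine x y z ≤ (total (lv x y z) + 9) * L²
          g-nine x y z = ≤-trans (≤-reflexive (e₁ g (sα′ x) (sβ′ y) (sγ′ z))) (≤-trans (+-mono-≤ (+-mono-≤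
            (slot t₀ i t₁ j k x) (slot r i j k l y)) (slot i j m k l′ z))
            (≤-reflexive (e₂ (degLabel g left i j k x + degLabel g mid i t₁ j x + degLabel g right t₀ i j x)
              (degLabel g left i k l y + degLabel g mid i j k y + degLabel g right r i k y)
              (degLabel g left j k l′ z + degLabel g mid j m k z + degLabel g right i j k z) L²)))
            where
            e₁ : ∀ g a b c → g * (a + b + c) ≡ g * a + g * b + g * c
            e₁ = solve-∀
            e₂ : ∀ a b c x → (a + 3) * x + (b + 3) * x + (c + 3) * x ≡ (a + b + c + 9) * x
            e₂ = solve-∀

          nine≤ : ∀ x y z → nine x y z ≤ 9 * L²
          nine≤ x y z = ≤-trans (+-mono-≤ (+-mono-≤ (degSum≤ t₀ i t₁ j k x) (degSum≤ r i j k l y)) (degSum≤ i j m k l′ z)) (≤-reflexive (e L²))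
            where
            e : ∀ a → 3 * a + 3 * a + 3 * a ≡ 9 * a
            e = solve-∀

          -- Rounding down nine labels loses at most 9, three times this is 27 ≤ 30. Where the
          -- labels are heavy, the trivial bound 9 for the nine degrees is used instead.
          pointwise : ∀ x y z → 3 * g * nine x y z ≤ (4 * g + 30) * L² + 27 * g * L² * ind (Heavy g (lv x y z))
          pointwise x y z with Heavy g (lv x y z) in eq
          ... | true = begin
                  3 * g * nine x y z                     ≤⟨ *-monoʳ-≤ (3 * g) (nine≤ x y z) ⟩
                  3 * g * (9 * L²)                       ≡⟨ e g L² ⟩
                  27 * g * L² * 1                        ≤⟨ m≤n+m _ _ ⟩
                  (4 * g + 30) * L² + 27 * g * L² * 1    ∎
            where
            e : ∀ g x → 3 * g * (9 * x) ≡ 27 * g * x * 1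
            e = solve-∀
          ... | false = begin
                  3 * g * nine x y z                     ≡⟨ *-assoc 3 g (nine x y z) ⟩
                  3 * (g * nine x y z)                   ≤⟨ *-monoʳ-≤ 3 (g-nine x y z) ⟩
                  3 * ((total (lv x y z) + 9) * L²)      ≡⟨ e (total (lv x y z)) L² ⟩
                  (3 * total (lv x y z) + 27) * L²       ≤⟨ *-monoˡ-≤ L² (+-mono-≤ light (≤ᵇ⇒≤ 27 30 _)) ⟩
                  (4 * g + 30) * L²                      ≤⟨ m≤m+n _ _ ⟩
                  (4 * g + 30) * L² + 27 * g * L² * 0    ∎
            where
            e : ∀ t x → 3 * ((t + 9) * x) ≡ (3 * t + 27) * x
            e = solve-∀
            light : 3 * total (lv x y z) ≤ 4 * g
            light = ≤-pred (≤-trans (≤ᵇ-false eq) (≤-reflexive (+-comm (4 * g) 1)))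

          heavyCount : ℕ
          heavyCount = ⟨ (λ x → ⟨ (λ y → ⟨ (λ z → ind (E i j k x y z) * ind (Heavy g (lv x y z))) ⟩) ⟩) ⟩

          ⟨⟨⟨_⟩⟩⟩ : (V → V → V → ℕ) → ℕ
          ⟨⟨⟨ f ⟩⟩⟩ = ⟨ (λ x → ⟨ (λ y → ⟨ (λ z → f x y z) ⟩) ⟩) ⟩

          cong³ : ∀ {f h : V → V → V → ℕ} → (∀ x y z → f x y z ≡ h x y z) → ⟨⟨⟨ f ⟩⟩⟩ ≡ ⟨⟨⟨ h ⟩⟩⟩
          cong³ e = ∑-cong μ λ x → ∑-cong μ λ y → ∑-cong μ λ z → e x y z
          mono³ : ∀ {f h : V → V → V → ℕ} → (∀ x y z → f x y z ≤ h x y z) → ⟨⟨⟨ f ⟩⟩⟩ ≤ ⟨⟨⟨ h ⟩⟩⟩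
          mono³ e = ∑-mono μ λ x → ∑-mono μ λ y → ∑-mono μ λ z → e x y z
          plus³ : ∀ (f h : V → V → V → ℕ) → ⟨⟨⟨ (λ x y z → f x y z + h x y z) ⟩⟩⟩ ≡ ⟨⟨⟨ f ⟩⟩⟩ + ⟨⟨⟨ h ⟩⟩⟩
          plus³ f h = trans (∑-cong μ λ x → trans (∑-cong μ λ y → ∑-+ μ _ _) (∑-+ μ _ _)) (∑-+ μ _ _)
          times³ : ∀ c (f : V → V → V → ℕ) → ⟨⟨⟨ (λ x y z → c * f x y z) ⟩⟩⟩ ≡ c * ⟨⟨⟨ f ⟩⟩⟩
          times³ c f = trans (∑-cong μ λ x → trans (∑-cong μ λ y → ∑-* μ c _) (∑-* μ c _)) (∑-* μ c _)

          e³ : V → V → V → ℕ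
          e³ x y z = ind (E i j k x y z)

          nine-moments : ⟨⟨⟨ (λ x y z → e³ x y z * nine x y z) ⟩⟩⟩ ≡
            moment left t₀ i t₁ j k + moment mid r i j k l + moment right i j m k l′
          nine-moments = trans (cong³ λ x y z → e (e³ x y z) (sα′ x) (sβ′ y) (sγ′ z))
            (trans (plus³ _ _) (cong₂ _+_ (trans (plus³ _ _) (cong₂ _+_ (weighted left i j k sα′) (weighted mid i j k sβ′)))
              (weighted right i j k sγ′)))
            where
            e : ∀ w a b c → w * (a + b + c) ≡ w * a + w * b + w * c
            e = solve-∀

          summed : 3 * g * ⟨⟨⟨ (λ x y z → e³ x y z * nine x y z) ⟩⟩⟩ ≤ (4 * g + 30) * L² * dens i j k + 27 * g * L² * heavyCount
          summed = begin
            3 * g * ⟨⟨⟨ (λ x y z → e³ x y z * nine x y z) ⟩⟩⟩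
              ≡⟨ times³ (3 * g) _ ⟨
            ⟨⟨⟨ (λ x y z → 3 * g * (e³ x y z * nine x y z)) ⟩⟩⟩
              ≤⟨ mono³ (λ x y z → ≤-trans (≤-reflexive (e₁ (3 * g) (e³ x y z) (nine x y z)))
                   (≤-trans (*-monoʳ-≤ (e³ x y z) (pointwise x y z)) (≤-reflexive (e₂ (e³ x y z) ((4 * g + 30) * L²) (27 * g * L²) (ind (Heavy g (lv x y z))))))) ⟩
            ⟨⟨⟨ (λ x y z → (4 * g + 30) * L² * e³ x y z + 27 * g * L² * (e³ x y z * ind (Heavy g (lv x y z)))) ⟩⟩⟩
              ≡⟨ trans (plus³ _ _) (cong₂ _+_ (times³ ((4 * g + 30) * L²) _) (times³ (27 * g * L²) _)) ⟩
            (4 * g + 30) * L² * dens i j k + 27 * g * L² * heavyCount ∎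
            where
            e₁ : ∀ c w n → c * (w * n) ≡ w * (c * n)
            e₁ = solve-∀
            e₂ : ∀ w a b h → w * (a + b * h) ≡ a * w + b * (w * h)
            e₂ = solve-∀

          -- The mean of the nine degrees over the edges of ijk exceeds 4/3, so heavy edges form a
          -- positive proportion. Its three moments belong to three different 5-tuples of indices;
          -- homogeneity identifies them with the constants `Al`, `Am`, `Ar` of `squares`.
          many-heavy : L³ ≤ 27 * g * G * heavyCount
          many-heavy = *-cancelʳ-≤ _ _ L² (+-cancelˡ-≤ ((4 * g + 30) * (D + 1) * L⁵) _ _ (begin
            (4 * g + 30) * (D + 1) * L⁵ + L³ * L²
              ≡⟨ f₁ ((4 * g + 30) * (D + 1)) L ⟩
            ((4 * g + 30) * (D + 1) + 1) * L⁵
              ≤⟨ *-monoˡ-≤ L⁵ (subst (λ z → (4 * z + 30) * (D + 1) + 1 ≤ 3 * z * A) (sym eg) (numeric q D A D-large squares)) ⟩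
            3 * g * A * L⁵
              ≡⟨ f₂ (3 * g) Al Am Ar L⁵ ⟩
            3 * g * (Al * L⁵ + Am * L⁵ + Ar * L⁵)
              ≤⟨ *-monoʳ-≤ (3 * g) (+-mono-≤ (+-mono-≤ (proj₁ (momentBounds {left} cl sα)) (proj₁ (momentBounds {mid} cm sβ))) (proj₁ (momentBounds {right} cr sγ))) ⟩
            3 * g * (G * moment left t₀ i t₁ j k + G * moment mid r i j k l + G * moment right i j m k l′)
              ≡⟨ f₃ (3 * g) G _ _ _ ⟩
            G * (3 * g * (moment left t₀ i t₁ j k + moment mid r i j k l + moment right i j m k l′))
              ≡⟨ cong (λ z → G * (3 * g * z)) nine-moments ⟨
            G * (3 * g * ⟨⟨⟨ (λ x y z → e³ x y z * nine x y z) ⟩⟩⟩)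
              ≤⟨ *-monoʳ-≤ G summed ⟩
            G * ((4 * g + 30) * L² * dens i j k + 27 * g * L² * heavyCount)
              ≡⟨ f₄ G ((4 * g + 30) * L²) (dens i j k) g L² heavyCount ⟩
            (4 * g + 30) * L² * (G * dens i j k) + 27 * g * G * heavyCount * L²
              ≤⟨ +-monoˡ-≤ _ (*-monoʳ-≤ ((4 * g + 30) * L²) (proj₂ (densBounds sijk))) ⟩
            (4 * g + 30) * L² * (suc D * L³) + 27 * g * G * heavyCount * L²
              ≡⟨ cong (_+ 27 * g * G * heavyCount * L²) (f₅ (4 * g + 30) D L) ⟩
            (4 * g + 30) * (D + 1) * L⁵ + 27 * g * G * heavyCount * L² ∎))
            where
            f₁ : ∀ a L → a * (L * (L * L * (L * L))) + L * (L * L) * (L * L) ≡ (a + 1) * (L * (L * L * (L * L)))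
            f₁ = solve-∀
            f₂ : ∀ c a b d x → c * (a + b + d) * x ≡ c * (a * x + b * x + d * x)
            f₂ = solve-∀
            f₃ : ∀ c G a b d → c * (G * a + G * b + G * d) ≡ G * (c * (a + b + d))
            f₃ = solve-∀
            f₄ : ∀ G c d g x h → G * (c * d + 27 * g * x * h) ≡ c * (G * d) + 27 * g * G * h * x
            f₄ = solve-∀
            f₅ : ∀ c D L → c * (L * L) * (suc D * (L * (L * L))) ≡ c * (D + 1) * (L * (L * L * (L * L)))
            f₅ = solve-∀

          labelSum : ℕ
          labelSum = sumList (labelVectors g) (λ v → ind (Heavy g v) * ⟨⟨⟨ (λ x y z → weight (tests g v) r t₀ i t₁ j m k l l′ x y z) ⟩⟩⟩)

          heavy≤labels : heavyCount ≤ labelSum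
          heavy≤labels = begin
            heavyCount
              ≤⟨ mono³ (λ x y z → ≤-trans (≤-reflexive (trans (*-comm (e³ x y z) _) (cong (ind (Heavy g (lv x y z)) *_) (sym (weight-lv x y z)))))
                   (term≤sumList (labelVectors g) (λ v → ind (Heavy g v) * weight (tests g v) r t₀ i t₁ j m k l l′ x y z) (lv-∈ x y z))) ⟩
            ⟨⟨⟨ (λ x y z → sumList (labelVectors g) (λ v → ind (Heavy g v) * weight (tests g v) r t₀ i t₁ j m k l l′ x y z)) ⟩⟩⟩
              ≡⟨ trans (∑-cong μ (λ x → trans (∑-cong μ (λ y → ∑-sumList μ (labelVectors g) _)) (∑-sumList μ (labelVectors g) _))) (∑-sumList μ (labelVectors g) _) ⟩
            sumList (labelVectors g) (λ v → ⟨⟨⟨ (λ x y z → ind (Heavy g v) * weight (tests g v) r t₀ i t₁ j m k l l′ x y z) ⟩⟩⟩)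
              ≡⟨ sumList-cong (labelVectors g) (λ v _ → times³ (ind (Heavy g v)) _) ⟩
            labelSum ∎

        labels-exist : ∀ b → 27 * g * G * length (labelVectors g) ≤ b →
          ∃[ v ] (v ∈ labelVectors g × good g b r t₀ i t₁ j m k l l′ v ≡ true)
        labels-exist b b≥ = finish (pigeonhole (labelVectors g) (λ v → ind (Heavy g v) * wt v)
            {k = 27 * g * G} 1≤L³ (≤-trans many-heavy (*-monoʳ-≤ (27 * g * G) heavy≤labels)))
          where
          wt : Labels → ℕ
          wt v = ⟨⟨⟨ weight (tests g v) r t₀ i t₁ j m k l l′ ⟩⟩⟩
          1≤L³ : 1 ≤ L³
          1≤L³ = *-mono-≤ 1≤L (*-mono-≤ 1≤L 1≤L)
          finish : ∃[ v ] (v ∈ labelVectors g × L³ ≤ 27 * g * G * length (labelVectors g) * (ind (Heavy g v) * wt v)) →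
            ∃[ v ] (v ∈ labelVectors g × good g b r t₀ i t₁ j m k l l′ v ≡ true)
          finish (v , v∈ , p) =
            let (h , p′) = ind-positive (Heavy g v) {L³} {27 * g * G * length (labelVectors g)} {wt v} 1≤L³ p
            in v , v∈ , cong₂ _∧_ h (≤⇒≤ᵇ-true (≤-trans p′ (*-monoˡ-≤ (wt v) b≥)))

    module StageOne (n q g G : ℕ) (1≤q : 1 ≤ q) (eg : g ≡ 60 * q) (eG : G ≡ 27 * q * 60) where

      -- The loss in `many-heavy` times the number of label vectors, over which the heavy edges are
      -- distributed.
      b₀ = 27 * g * G * length (labelVectors g)
      εx = extract n b₀
      εv = ramseyList {ℕ} (Vec.≡-dec _≟_) (labelVectors g) 9 (proj₁ εx + 9)
      εr = ramseyList {ℕ} _≟_ (upTo (suc (3 * G))) 5 (proj₁ εv)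
      εm = ramseyList {ℕ} _≟_ (upTo (suc (3 * G))) 5 (proj₁ εr)
      εl = ramseyList {ℕ} _≟_ (upTo (suc (3 * G))) 5 (proj₁ εm)
      εd = ramseyList {ℕ} _≟_ (upTo (suc G)) 3 (proj₁ εl)

      module _ (L : ℕ) (1≤L : 1 ≤ L) (E : ℕ → ℕ → ℕ → Fin L → Fin L → Fin L → Bool) where
        open Degrees L 1≤L E
        open Counting L 1≤L E q g G 1≤q eg eG

        module _ {W : List ℕ} (sorted : SortedI W) (long : proj₁ εv ≤ length W) (D Al Am Ar : ℕ)
          (dense : ∀ {i j k} → i ∷ j ∷ k ∷ [] ⊆ W → (4 * q + 1) * L³ ≤ 27 * q * dens i j k)
          (cD : ∀ Q → Q ⊆ W → length Q ≡ 3 → densFloor G Q ≡ D)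
          (cl : ∀ Q → Q ⊆ W → length Q ≡ 5 → momentFloor G left Q ≡ Al)
          (cm : ∀ Q → Q ⊆ W → length Q ≡ 5 → momentFloor G mid Q ≡ Am)
          (cr : ∀ Q → Q ⊆ W → length Q ≡ 5 → momentFloor G right Q ≡ Ar) where

          found : ∀ Q → Q ⊆ W → length Q ≡ 9 → pickLabels g (suc b₀) Q ∈ labelVectors g
          found (r ∷ t₀ ∷ i ∷ t₁ ∷ j ∷ m ∷ k ∷ l ∷ l′ ∷ []) sub refl =
            let (v , v∈ , p) = labels-exist D Al Am Ar dense cD cl cm cr sub (suc b₀) (n≤1+n b₀)
            in proj₁ (search-true (good g (suc b₀) r t₀ i t₁ j m k l l′) (labelVectors g) (Vec.replicate 9 0) v∈ p)

          found-good : ∀ {r t₀ i t₁ j m k l l′ v} → r ∷ t₀ ∷ i ∷ t₁ ∷ j ∷ m ∷ k ∷ l ∷ l′ ∷ [] ⊆ W →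
            pickLabels g (suc b₀) (r ∷ t₀ ∷ i ∷ t₁ ∷ j ∷ m ∷ k ∷ l ∷ l′ ∷ []) ≡ v →
            good g (suc b₀) r t₀ i t₁ j m k l l′ v ≡ true
          found-good {r} {t₀} {i} {t₁} {j} {m} {k} {l} {l′} sub refl =
            let (v , v∈ , p) = labels-exist D Al Am Ar dense cD cl cm cr sub (suc b₀) (n≤1+n b₀)
            in proj₂ (search-true (good g (suc b₀) r t₀ i t₁ j m k l l′) (labelVectors g) (Vec.replicate 9 0) v∈ p)

          Homogeneous : Set
          Homogeneous = ∃[ W′ ] (W′ ⊆ W × length W′ ≡ proj₁ εx + 9 × ∃[ v ] (v ∈ labelVectors g ×
            ∀ Q → Q ⊆ W′ → length Q ≡ 9 → pickLabels g (suc b₀) Q ≡ v))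

          conclude : Homogeneous → ∃[ S ] (S ⊆ W × length S ≡ n × Base g S)
          conclude (W′ , W′⊆ , lW′ , v , v∈ , const) =
            let (S , S⊆ , lS , sys) = proj₂ εx L 1≤L (tests g v) W′ (λ s → sorted (⊆-trans s W′⊆))
                  (≤-trans (m≤m+n (proj₁ εx) 9) (≤-reflexive (sym lW′)))
                  (λ {r} {t₀} {i} {t₁} {j} {m} {k} {l} {l′} s → ≤ᵇ-true (proj₂ (∧-true {Heavy g v}
                     (found-good {r} {t₀} {i} {t₁} {j} {m} {k} {l} {l′} (⊆-trans s W′⊆) (const _ s refl)))))
            in S , ⊆-trans S⊆ W′⊆ , lS , toBase g {v} (heavy (take 9 W′) (take-⊆ 9 W′) (length-take-≡ 9 W′
                 (≤-trans (m≤n+m 9 (proj₁ εx)) (≤-reflexive (sym lW′))))) sys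
            where
            heavy : ∀ Q → Q ⊆ W′ → length Q ≡ 9 → 4 * g + 1 ≤ 3 * total v
            heavy Q@(r ∷ t₀ ∷ i ∷ t₁ ∷ j ∷ m ∷ k ∷ l ∷ l′ ∷ []) sub refl =
              ≤ᵇ-true (proj₁ (∧-true {Heavy g v} (found-good {r} {t₀} {i} {t₁} {j} {m} {k} {l} {l′} (⊆-trans sub W′⊆) (const Q sub refl))))

          finish : ∃[ S ] (S ⊆ W × length S ≡ n × Base g S)
          finish = conclude (proj₂ εv W long (pickLabels g (suc b₀)) found)

        Dense₃ : List ℕ → Set
        Dense₃ W = ∀ {i j k} → i ∷ j ∷ k ∷ [] ⊆ W → (4 * q + 1) * L³ ≤ 27 * q * dens i j k

        Goal : List ℕ → Set
        Goal W = ∃[ S ] (S ⊆ W × length S ≡ n × Base g S)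

        widen : ∀ {W W′} → W′ ⊆ W → Goal W′ → Goal W
        widen p (S , S⊆ , r) = S , ⊆-trans S⊆ p , r

        run : ∀ W → SortedI W → proj₁ εd ≤ length W → Dense₃ W → Goal W
        run W sorted hW dense with proj₂ εd W hW (densFloor G) (λ Q _ → densFloor-∈ G Q)
        ... | W₁ , p₁ , l₁ , D , _ , cD with proj₂ εl W₁ (≤-reflexive (sym l₁)) (momentFloor G left) (λ Q _ → momentFloor-∈ G left Q)
        ...   | W₂ , p₂ , l₂ , Al , _ , cl with proj₂ εm W₂ (≤-reflexive (sym l₂)) (momentFloor G mid) (λ Q _ → momentFloor-∈ G mid Q)
        ...     | W₃ , p₃ , l₃ , Am , _ , cm with proj₂ εr W₃ (≤-reflexive (sym l₃)) (momentFloor G right) (λ Q _ → momentFloor-∈ G right Q)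
        ...       | W₄ , p₄ , l₄ , Ar , _ , cr = widen W₄⊆ (finish (λ s → sorted (⊆-trans s W₄⊆)) (≤-reflexive (sym l₄)) D Al Am Ar
                      (λ s → dense (⊆-trans s W₄⊆))
                      (λ Q s → cD Q (⊆-trans s (⊆-trans p₄ (⊆-trans p₃ p₂))))
                      (λ Q s → cl Q (⊆-trans s (⊆-trans p₄ p₃)))
                      (λ Q s → cm Q (⊆-trans s p₄)) cr)
          where
          W₄⊆ : W₄ ⊆ W
          W₄⊆ = ⊆-trans p₄ (⊆-trans p₃ (⊆-trans p₂ p₁))

    abstract
      baseSystem : ∀ n q → 1 ≤ q → ∃[ N ] ∀ L (1≤L : 1 ≤ L) E (let open Degrees L 1≤L E) W → SortedI W → N ≤ length W →
        (∀ {i j k} → i ∷ j ∷ k ∷ [] ⊆ W → (4 * q + 1) * L³ ≤ 27 * q * dens i j k) →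
        ∃[ S ] (S ⊆ W × length S ≡ n × Base (60 * q) S)
      baseSystem n q 1≤q = sized (60 * q) (27 * q * 60) refl refl
        where
        sized : ∀ g G → g ≡ 60 * q → G ≡ 27 * q * 60 → ∃[ N ] ∀ L (1≤L : 1 ≤ L) E (let open Degrees L 1≤L E) W → SortedI W →
          N ≤ length W → (∀ {i j k} → i ∷ j ∷ k ∷ [] ⊆ W → (4 * q + 1) * L³ ≤ 27 * q * dens i j k) →
          ∃[ S ] (S ⊆ W × length S ≡ n × Base g S)
        sized g G eg eG = proj₁ (StageOne.εd n q g G 1≤q eg eG) , StageOne.run n q g G 1≤q eg eG

  open BaseColours

  -- Finite analysis of bit sets, potentials and the quadratic form.

  module LinkPotentials where
    BitSet : Set
    BitSet = Bit → Bool

    clash : BitSet → Bit × Bit × Witness → Bool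
    clash f (p , q , _) = f p ∧ f q

    ok : BitSet → Bool
    ok f = all (not ∘ clash f) conflicts

    -- The 18 bits are divided so that six of the nine links join a positive bit to a negative one,
    -- one joins two positive bits (`LbM`, `RbM`) and two join negative bits (`LaM`, `RaM` and
    -- `LcM`, `RcM`). An exhaustive check then runs over at most 2¹⁸ pairs of halves instead of 2³⁶
    -- pairs of bit sets.
    plusPart : Vec Bool 8 → BitSet
    plusPart (lcr ∷ lbm ∷ mbl ∷ ral ∷ rbm ∷ mbr ∷ lar ∷ rcl ∷ []) = λ
      { (bit right right first) → lcr
      ; (bit mid mid first)     → lbm
      ; (bit mid left first)    → mbl
      ; (bit left left second)  → ral
      ; (bit mid mid second)    → rbm
      ; (bit mid right second)  → mbr
      ; (bit left right first)  → lar
      ; (bit right left second) → rcl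
      ; _                       → false }

    minusPart : Vec Bool 10 → BitSet
    minusPart (mcl ∷ lcm ∷ lbr ∷ mar ∷ ram ∷ rbl ∷ mal ∷ lam ∷ mcr ∷ rcm ∷ []) = λ
      { (bit right left first)   → mcl
      ; (bit right mid first)    → lcm
      ; (bit mid right first)    → lbr
      ; (bit left right second)  → mar
      ; (bit left mid second)    → ram
      ; (bit mid left second)    → rbl
      ; (bit left left first)    → mal
      ; (bit left mid first)     → lam
      ; (bit right right second) → mcr
      ; (bit right mid second)   → rcm
      ; _                        → false }

    plus minus : BitSet → BitSet
    plus f = plusPart (Vec.map f (LcR ∷ LbM ∷ MbL ∷ RaL ∷ RbM ∷ MbR ∷ LaR ∷ RcL ∷ []))
    minus f = minusPart (Vec.map f (McL ∷ LcM ∷ LbR ∷ MaR ∷ RaM ∷ RbL ∷ MaL ∷ LaM ∷ McR ∷ RcM ∷ []))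

    -- The ends of an allowed link edge have distinct potentials, as made precise by links≤adjacent.
    λ⁺ λ⁻ : BitSet → ℕ
    λ⁺ f = if f LcR ∨ (f LbM ∨ f MbL) then 0 else if f RaL ∨ (f RbM ∨ f MbR) then 1 else
           if f LaR then (if f RcL then 2 else 0) else if f RcL then 1 else 2
    λ⁻ f = if f MaL ∨ (f LaM ∨ (f McR ∨ f RcM)) then 2 else if f MaR ∨ (f RaM ∨ f RbL) then 1 else 0

    restricted : BitSet → BitSet → Bool
    restricted f h = (f MbL ∧ h RbL) ∨ (h RcM ∧ f RcL)

    restricted′ : BitSet → BitSet → Bool
    restricted′ f h = (f MbR ∧ h LbR) ∨ (h LaM ∧ f LaR)

    -- The links joining a positive end to a negative end; the excluded combinations come from the restrictions.
    mixed : BitSet → BitSet → ℕ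
    mixed f h = ind (f RaL ∧ h MaL) + (ind (f LaR ∧ (h MaR ∧ not (restricted f h))) + (ind (f MbL ∧ h RbL) +
      (ind (f MbR ∧ h LbR) + (ind (f RcL ∧ (h McL ∧ not (restricted′ f h))) + ind (f LcR ∧ h McR)))))

    infixr 4 _⇒_
    _⇒_ : Bool → Bool → Bool
    true  ⇒ b = b
    false ⇒ b = true

    ⇒-elim : ∀ {a b} → (a ⇒ b) ≡ true → a ≡ true → b ≡ true
    ⇒-elim h refl = h

    forallVec : ∀ n → (Vec Bool n → Bool) → Bool
    forallVec zero    φ = φ []
    forallVec (suc n) φ = forallVec n (φ ∘ (true ∷_)) ∧ forallVec n (φ ∘ (false ∷_))

    forallVec-elim : ∀ n φ → forallVec n φ ≡ true → ∀ v → φ v ≡ true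
    forallVec-elim zero    φ h []          = h
    forallVec-elim (suc n) φ h (true ∷ v)  = forallVec-elim n (φ ∘ (true ∷_)) (proj₁ (∧-true h)) v
    forallVec-elim (suc n) φ h (false ∷ v) = forallVec-elim n (φ ∘ (false ∷_)) (proj₂ (∧-true {forallVec n (φ ∘ (true ∷_))} h)) v

    forallPlus forallMinus : (BitSet → Bool) → Bool
    forallPlus φ  = forallVec 8 (φ ∘ plusPart)
    forallMinus φ = forallVec 10 (φ ∘ minusPart)

    -- Evaluation over all conflict-free halves; testing the positive half before the inner
    -- enumeration keeps this feasible.
    mixed-check : forallPlus (λ f → ok f ⇒ forallMinus (λ h → ok h ⇒ (mixed f h ≤ᵇ ind (not (λ⁺ f ≡ᵇ λ⁻ h))))) ≡ true
    mixed-check = refl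

    plus-check : forallPlus (λ f → ok f ⇒ (f RbM ⇒ (λ⁺ f ≡ᵇ 1))) ≡ true
    plus-check = refl

    minus-check : forallMinus (λ f → ok f ⇒ ((f RaM ⇒ (λ⁻ f ≡ᵇ 1)) ∧ (f LcM ⇒ (λ⁻ f ≡ᵇ 0)))) ≡ true
    minus-check = refl

    -- Dropping bits creates no clash, so both halves of a conflict-free bit set are covered by the
    -- checks.
    ok-mono : ∀ {f f′ : BitSet} → (∀ β → f′ β ≡ true → f β ≡ true) → ok f ≡ true → ok f′ ≡ true
    ok-mono {f} {f′} sub h = all-intro (not ∘ clash f′) conflicts λ c c∈ → step c (all-∈ (not ∘ clash f) h c∈)
      where
      step : ∀ c → not (clash f c) ≡ true → not (clash f′ c) ≡ true
      step (p , q , _) n with f′ p in e₁ | f′ q in e₂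
      ... | false | _     = refl
      ... | true  | false = refl
      ... | true  | true rewrite sub p e₁ | sub q e₂ = n

    plus-sub : ∀ f β → plus f β ≡ true → f β ≡ true
    plus-sub f (bit left  left  second) h = h
    plus-sub f (bit left  right first)  h = h
    plus-sub f (bit mid   left  first)  h = h
    plus-sub f (bit mid   mid   first)  h = h
    plus-sub f (bit mid   mid   second) h = h
    plus-sub f (bit mid   right second) h = h
    plus-sub f (bit right left  second) h = h
    plus-sub f (bit right right first)  h = h

    minus-sub : ∀ f β → minus f β ≡ true → f β ≡ true
    minus-sub f (bit left  left  first)  h = h
    minus-sub f (bit left  mid   first)  h = h
    minus-sub f (bit left  mid   second) h = h
    minus-sub f (bit left  right second) h = h
    minus-sub f (bit mid   left  second) h = h
    minus-sub f (bit mid   right first)  h = h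
    minus-sub f (bit right left  first)  h = h
    minus-sub f (bit right mid   first)  h = h
    minus-sub f (bit right mid   second) h = h
    minus-sub f (bit right right second) h = h

    module _ (f : BitSet) (okf : ok f ≡ true) where

      ok-plus : ok (plus f) ≡ true
      ok-plus = ok-mono {f} {plus f} (plus-sub f) okf

      ok-minus : ok (minus f) ≡ true
      ok-minus = ok-mono {f} {minus f} (minus-sub f) okf

      RbM-λ⁺ : f RbM ≡ true → λ⁺ f ≡ 1
      RbM-λ⁺ h = ≡ᵇ-true {λ⁺ f} (⇒-elim (⇒-elim {ok (plus f)} (forallVec-elim 8 (λ v → ok (plusPart v) ⇒ (plusPart v RbM ⇒ (λ⁺ (plusPart v) ≡ᵇ 1)))
        plus-check (Vec.map f (LcR ∷ LbM ∷ MbL ∷ RaL ∷ RbM ∷ MbR ∷ LaR ∷ RcL ∷ []))) ok-plus) h)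

      private
        minus-facts : ((f RaM ⇒ (λ⁻ f ≡ᵇ 1)) ∧ (f LcM ⇒ (λ⁻ f ≡ᵇ 0))) ≡ true
        minus-facts = ⇒-elim {ok (minus f)} (forallVec-elim 10 (λ v → ok (minusPart v) ⇒ ((minusPart v RaM ⇒ (λ⁻ (minusPart v) ≡ᵇ 1)) ∧
          (minusPart v LcM ⇒ (λ⁻ (minusPart v) ≡ᵇ 0)))) minus-check (Vec.map f (McL ∷ LcM ∷ LbR ∷ MaR ∷ RaM ∷ RbL ∷ MaL ∷ LaM ∷ McR ∷ RcM ∷ []))) ok-minus

      RaM-λ⁻ : f RaM ≡ true → λ⁻ f ≡ 1
      RaM-λ⁻ h = ≡ᵇ-true {λ⁻ f} (⇒-elim (proj₁ (∧-true {f RaM ⇒ (λ⁻ f ≡ᵇ 1)} minus-facts)) h)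

      LcM-λ⁻ : f LcM ≡ true → λ⁻ f ≡ 0
      LcM-λ⁻ h = ≡ᵇ-true {λ⁻ f} (⇒-elim (proj₂ (∧-true {f RaM ⇒ (λ⁻ f ≡ᵇ 1)} minus-facts)) h)

    -- `mixed` and `λ⁺` read only positive bits of `f`, `mixed` and `λ⁻` only negative bits of `h`;
    -- passing to the halves thus changes nothing, and the check applies by computation.
    mixed-bound : ∀ f h → ok f ≡ true → ok h ≡ true → mixed f h ≤ ind (not (λ⁺ f ≡ᵇ λ⁻ h))
    mixed-bound f h okf okh = ≤ᵇ-true (⇒-elim {ok (minus h)} (forallVec-elim 10
      (λ u → ok (minusPart u) ⇒ (mixed (plus f) (minusPart u) ≤ᵇ ind (not (λ⁺ (plus f) ≡ᵇ λ⁻ (minusPart u)))))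
      (⇒-elim {ok (plus f)} (forallVec-elim 8 (λ v → ok (plusPart v) ⇒ forallMinus (λ h → ok h ⇒ (mixed (plusPart v) h ≤ᵇ ind (not (λ⁺ (plusPart v) ≡ᵇ λ⁻ h)))))
        mixed-check (Vec.map f (LcR ∷ LbM ∷ MbL ∷ RaL ∷ RbM ∷ MbR ∷ LaR ∷ RcL ∷ []))) (ok-plus f okf))
      (Vec.map h (McL ∷ LcM ∷ LbR ∷ MaR ∷ RaM ∷ RbL ∷ MaL ∷ LaM ∷ McR ∷ RcM ∷ []))) (ok-minus h okh))

    LbM-λ⁺ : ∀ f → f LbM ≡ true → λ⁺ f ≡ 0
    LbM-λ⁺ f h rewrite h | Bool.∨-zeroʳ (f LcR) = refl

    LaM-λ⁻ : ∀ f → f LaM ≡ true → λ⁻ f ≡ 2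
    LaM-λ⁻ f h rewrite h | Bool.∨-zeroʳ (f MaL) = refl

    RcM-λ⁻ : ∀ f → f RcM ≡ true → λ⁻ f ≡ 2
    RcM-λ⁻ f h rewrite h | Bool.∨-zeroʳ (f McR) | Bool.∨-zeroʳ (f LaM) | Bool.∨-zeroʳ (f MaL) = refl

    -- Whether link edges of the base colour e in role s may join vertices with bit sets f and h.
    excluded : Role → Role → BitSet → BitSet → Bool
    excluded left  right f h = restricted f h
    excluded right left  f h = restricted′ h f
    excluded _     _     f h = false

    compatible : Bool → Bool → Role → Role → BitSet → BitSet → Bool
    compatible u v e s f h = f (bit e s first) ∧ (h (bit e s second) ∧ (u ∧ (v ∧ not (excluded e s f h))))

    allowed : Role → Role → BitSet → BitSet → Bool
    allowed e s f h = compatible (ok f) (ok h) e s f h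

    -- The nine links, oriented so that a positive end, or else an end with λ⁻ = 2, comes first.
    oriented : (Role → Role → BitSet → BitSet → Bool) → (Role → Role → BitSet → BitSet → Bool) → BitSet → BitSet → ℕ
    oriented a a′ f h = (ind (a′ left left h f) + (ind (a left right f h) + (ind (a mid left f h) +
        (ind (a′ mid right h f) + (ind (a′ right left h f) + ind (a right right f h))))))
      + ind (a mid mid f h) + (ind (a left mid f h) + ind (a′ right mid h f))

    links : BitSet → BitSet → ℕ
    links = oriented allowed allowed

    -- A kernel depending on potentials alone. Its first term bounds the six mixed links together;
    -- the others bound the links of the base colours mid, left and right in role mid, in this
    -- order.
    adjacent : BitSet → BitSet → ℕ
    adjacent f h = ind (not (λ⁺ f ≡ᵇ λ⁻ h)) + ind ((λ⁺ f ≡ᵇ 0) ∧ (λ⁺ h ≡ᵇ 1)) + (ind ((λ⁻ f ≡ᵇ 2) ∧ (λ⁻ h ≡ᵇ 1)) + ind ((λ⁻ f ≡ᵇ 2) ∧ (λ⁻ h ≡ᵇ 0)))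

    links≤adjacent : ∀ f h → links f h ≤ adjacent f h
    links≤adjacent f h = go (ok f) (ok h) refl refl
      where
      swap : ∀ a b → ind (a ∧ (b ∧ true)) ≤ ind (b ∧ a)
      swap true  true  = ≤-refl
      swap true  false = z≤n
      swap false b     = z≤n
      keep : ∀ a b → ind (a ∧ (b ∧ true)) ≤ ind (a ∧ b)
      keep true  true  = ≤-refl
      keep true  false = z≤n
      keep false b     = z≤n
      swap₃ : ∀ a b c → ind (a ∧ (b ∧ c)) ≤ ind (b ∧ (a ∧ c))
      swap₃ true  true  c = ≤-refl
      swap₃ true  false c = z≤n
      swap₃ false b     c = z≤n
      both : ∀ a b {c d} → (a ≡ true → c ≡ true) → (b ≡ true → d ≡ true) → ind (a ∧ (b ∧ true)) ≤ ind (c ∧ d)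
      both true  true  p q rewrite p refl | q refl = ≤-refl
      both true  false p q = z≤n
      both false b     p q = z≤n
      none : ∀ a b u v n → u ∧ v ≡ false → ind (a ∧ (b ∧ (u ∧ (v ∧ n)))) ≤ 0
      none true  true  true  false n _ = z≤n
      none true  true  false v     n _ = z≤n
      none true  false u     v     n _ = z≤n
      none false b     u     v     n _ = z≤n
      vanish : ∀ u v → u ∧ v ≡ false → oriented (compatible u v) (compatible v u) f h ≤ 0
      vanish u v e = +-mono-≤ (+-mono-≤ (+-mono-≤ (n′ left left) (+-mono-≤ (n left right) (+-mono-≤ (n mid left)
        (+-mono-≤ (n′ mid right) (+-mono-≤ (n′ right left) (n right right)))))) (n mid mid)) (+-mono-≤ (n left mid) (n′ right mid))
        where
        n : ∀ e s → ind (compatible u v e s f h) ≤ 0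
        n r s = none (f (bit r s first)) (h (bit r s second)) u v (not (excluded r s f h)) e
        n′ : ∀ e s → ind (compatible v u e s h f) ≤ 0
        n′ r s = none (h (bit r s first)) (f (bit r s second)) v u (not (excluded r s h f)) (trans (Bool.∧-comm v u) e)
      go : ∀ u v → ok f ≡ u → ok h ≡ v → oriented (compatible u v) (compatible v u) f h ≤ adjacent f h
      go false v     okf okh = ≤-trans (vanish false v refl) z≤n
      go true  false okf okh = ≤-trans (vanish true false refl) z≤n
      go true  true  okf okh = +-mono-≤ (+-mono-≤ mix pp) (+-mono-≤ m₁ m₀)
        where
        mix : ind (h MaL ∧ (f RaL ∧ true)) + (ind (f LaR ∧ (h MaR ∧ not (restricted f h))) + (ind (f MbL ∧ (h RbL ∧ true)) +
          (ind (h LbR ∧ (f MbR ∧ true)) + (ind (h McL ∧ (f RcL ∧ not (restricted′ f h))) + ind (f LcR ∧ (h McR ∧ true)))))) ≤ ind (not (λ⁺ f ≡ᵇ λ⁻ h))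
        mix = ≤-trans (+-mono-≤ (swap (h MaL) (f RaL)) (+-mono-≤ (≤-refl {ind (f LaR ∧ (h MaR ∧ not (restricted f h)))})
          (+-mono-≤ (keep (f MbL) (h RbL)) (+-mono-≤ (swap (h LbR) (f MbR))
          (+-mono-≤ (swap₃ (h McL) (f RcL) (not (restricted′ f h))) (keep (f LcR) (h McR))))))) (mixed-bound f h okf okh)
        pp : ind (f LbM ∧ (h RbM ∧ true)) ≤ ind ((λ⁺ f ≡ᵇ 0) ∧ (λ⁺ h ≡ᵇ 1))
        pp = both (f LbM) (h RbM) (λ e → cong (_≡ᵇ 0) (LbM-λ⁺ f e)) (λ e → cong (_≡ᵇ 1) (RbM-λ⁺ h okh e))
        m₁ : ind (f LaM ∧ (h RaM ∧ true)) ≤ ind ((λ⁻ f ≡ᵇ 2) ∧ (λ⁻ h ≡ᵇ 1))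
        m₁ = both (f LaM) (h RaM) (λ e → cong (_≡ᵇ 2) (LaM-λ⁻ f e)) (λ e → cong (_≡ᵇ 1) (RaM-λ⁻ h okh e))
        m₀ : ind (h LcM ∧ (f RcM ∧ true)) ≤ ind ((λ⁻ f ≡ᵇ 2) ∧ (λ⁻ h ≡ᵇ 0))
        m₀ = ≤-trans (both (h LcM) (f RcM) {λ⁻ h ≡ᵇ 0} {λ⁻ f ≡ᵇ 2} (λ e → cong (_≡ᵇ 0) (LcM-λ⁻ h okh e)) (λ e → cong (_≡ᵇ 2) (RcM-λ⁻ f e)))
          (≤-reflexive (cong ind (Bool.∧-comm (λ⁻ h ≡ᵇ 0) (λ⁻ f ≡ᵇ 2))))

    λ⁺<3 : ∀ f → λ⁺ f ≡ 0 ⊎ λ⁺ f ≡ 1 ⊎ λ⁺ f ≡ 2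
    λ⁺<3 f with f LcR ∨ (f LbM ∨ f MbL) | f RaL ∨ (f RbM ∨ f MbR) | f LaR | f RcL
    ... | true  | _     | _     | _     = inj₁ refl
    ... | false | true  | _     | _     = inj₂ (inj₁ refl)
    ... | false | false | true  | true  = inj₂ (inj₂ refl)
    ... | false | false | true  | false = inj₁ refl
    ... | false | false | false | true  = inj₂ (inj₁ refl)
    ... | false | false | false | false = inj₂ (inj₂ refl)

    λ⁻<3 : ∀ f → λ⁻ f ≡ 0 ⊎ λ⁻ f ≡ 1 ⊎ λ⁻ f ≡ 2
    λ⁻<3 f with f MaL ∨ (f LaM ∨ (f McR ∨ f RcM)) | f MaR ∨ (f RaM ∨ f RbL)
    ... | true  | _     = inj₂ (inj₂ refl)
    ... | false | true  = inj₂ (inj₁ refl)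
    ... | false | false = inj₁ refl

    -- The quadratic form of the potentials is maximal, with value 4/3, at p = (2/3 , 1/3 , 0), n = (0 , 1/3 , 2/3).
    quadratic : ∀ p₀ p₁ p₂ n₀ n₁ n₂ → p₀ + p₁ + p₂ ≡ n₀ + n₁ + n₂ →
      3 * (p₀ * p₁) + 3 * (n₂ * (n₀ + n₁)) ≤ (p₀ + p₁ + p₂) * (p₀ + p₁ + p₂) + 3 * (p₀ * n₀ + p₁ * n₁ + p₂ * n₂)
    quadratic p₀ p₁ p₂ n₀ n₁ n₂ eq = [ (λ p₁≤p₀ → half p₀ p₁ p₂ n₀ n₁ n₂ eq p₁≤p₀) , (λ p₀≤p₁ →
      subst₂ _≤_ (s₁ p₀ p₁ n₀ n₁ n₂) (s₂ p₀ p₁ p₂ n₀ n₁ n₂)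
        (half p₁ p₀ p₂ n₁ n₀ n₂ (trans (cong (_+ p₂) (+-comm p₁ p₀)) (trans eq (cong (_+ n₂) (+-comm n₀ n₁)))) p₀≤p₁)) ]′ (≤-total p₁ p₀)
      where
      s₁ : ∀ p₀ p₁ n₀ n₁ n₂ → 3 * (p₁ * p₀) + 3 * (n₂ * (n₁ + n₀)) ≡ 3 * (p₀ * p₁) + 3 * (n₂ * (n₀ + n₁))
      s₁ = solve-∀
      s₂ : ∀ p₀ p₁ p₂ n₀ n₁ n₂ → (p₁ + p₀ + p₂) * (p₁ + p₀ + p₂) + 3 * (p₁ * n₁ + p₀ * n₀ + p₂ * n₂) ≡
        (p₀ + p₁ + p₂) * (p₀ + p₁ + p₂) + 3 * (p₀ * n₀ + p₁ * n₁ + p₂ * n₂)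
      s₂ = solve-∀
      -- The inequality is symmetric under exchanging the indices 0 and 1, hence p₁ ≤ p₀ may be
      -- assumed. Then p₀n₀ + p₁n₁ ≥ p₁s with s = n₀ + n₁, and p₀p₁ ≤ p₁(t - p₁) leaves a quadratic
      -- form in p₁, s and t.
      half : ∀ p₀ p₁ p₂ n₀ n₁ n₂ → p₀ + p₁ + p₂ ≡ n₀ + n₁ + n₂ → p₁ ≤ p₀ →
        3 * (p₀ * p₁) + 3 * (n₂ * (n₀ + n₁)) ≤ (p₀ + p₁ + p₂) * (p₀ + p₁ + p₂) + 3 * (p₀ * n₀ + p₁ * n₁ + p₂ * n₂)
      half p₀ p₁ p₂ n₀ n₁ n₂ eq p₁≤p₀ = begin
        3 * (p₀ * p₁) + 3 * (n₂ * s)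
          ≤⟨ m≤m+n _ (3 * (p₁ * p₂)) ⟩
        3 * (p₀ * p₁) + 3 * (n₂ * s) + 3 * (p₁ * p₂)
          ≤⟨ core ⟩
        t * t + 3 * (p₁ * s)
          ≤⟨ +-monoʳ-≤ (t * t) (*-monoʳ-≤ 3 (begin
               p₁ * (n₀ + n₁)                       ≡⟨ *-distribˡ-+ p₁ n₀ n₁ ⟩
               p₁ * n₀ + p₁ * n₁                    ≤⟨ +-monoˡ-≤ (p₁ * n₁) (*-monoˡ-≤ n₀ p₁≤p₀) ⟩
               p₀ * n₀ + p₁ * n₁                    ≤⟨ m≤m+n _ (p₂ * n₂) ⟩
               p₀ * n₀ + p₁ * n₁ + p₂ * n₂          ∎)) ⟩
        t * t + 3 * (p₀ * n₀ + p₁ * n₁ + p₂ * n₂) ∎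
        where
        open ≤-Reasoning
        s = n₀ + n₁
        t = p₀ + p₁ + p₂
        -- 3 (p₁ - s)² + (3 (p₁ + s) - 2 t)² ≥ 0
        key : 3 * (t * (p₁ + s)) ≤ 3 * (p₁ * p₁) + 3 * (s * s) + 3 * (p₁ * s) + t * t
        key = *-cancelˡ-≤ 4 (+-cancelʳ-≤ (6 * (p₁ * s)) _ _ (begin
          4 * (3 * (t * (p₁ + s))) + 6 * (p₁ * s)
            ≡⟨ k₁ t p₁ s ⟩
          3 * (2 * (p₁ * s)) + 2 * ((3 * (p₁ + s)) * (2 * t))
            ≤⟨ +-mono-≤ (*-monoʳ-≤ 3 (amgm p₁ s)) (amgm (3 * (p₁ + s)) (2 * t)) ⟩
          3 * (p₁ * p₁ + s * s) + ((3 * (p₁ + s)) * (3 * (p₁ + s)) + (2 * t) * (2 * t))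
            ≡⟨ k₂ t p₁ s ⟩
          4 * (3 * (p₁ * p₁) + 3 * (s * s) + 3 * (p₁ * s) + t * t) + 6 * (p₁ * s) ∎))
          where
          k₁ : ∀ t p s → 4 * (3 * (t * (p + s))) + 6 * (p * s) ≡ 3 * (2 * (p * s)) + 2 * ((3 * (p + s)) * (2 * t))
          k₁ = solve-∀
          k₂ : ∀ t p s → 3 * (p * p + s * s) + ((3 * (p + s)) * (3 * (p + s)) + (2 * t) * (2 * t)) ≡
            4 * (3 * (p * p) + 3 * (s * s) + 3 * (p * s) + t * t) + 6 * (p * s)
          k₂ = solve-∀
        core : 3 * (p₀ * p₁) + 3 * (n₂ * s) + 3 * (p₁ * p₂) ≤ t * t + 3 * (p₁ * s)
        core = +-cancelʳ-≤ (3 * (p₁ * p₁) + 3 * (s * s)) _ _ (begin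
          3 * (p₀ * p₁) + 3 * (n₂ * s) + 3 * (p₁ * p₂) + (3 * (p₁ * p₁) + 3 * (s * s))
            ≡⟨ c₁ p₀ p₁ p₂ n₂ s ⟩
          3 * (t * p₁) + 3 * ((s + n₂) * s)
            ≡⟨ cong (λ z → 3 * (t * p₁) + 3 * (z * s)) (sym eq) ⟩
          3 * (t * p₁) + 3 * (t * s)
            ≡⟨ c₂ t p₁ s ⟩
          3 * (t * (p₁ + s))
            ≤⟨ key ⟩
          3 * (p₁ * p₁) + 3 * (s * s) + 3 * (p₁ * s) + t * t
            ≡⟨ c₃ p₁ s (t * t) ⟩
          t * t + 3 * (p₁ * s) + (3 * (p₁ * p₁) + 3 * (s * s)) ∎)
          where
          c₁ : ∀ a b c n s → 3 * (a * b) + 3 * (n * s) + 3 * (b * c) + (3 * (b * b) + 3 * (s * s)) ≡ 3 * ((a + b + c) * b) + 3 * ((s + n) * s)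
          c₁ = solve-∀
          c₂ : ∀ t p s → 3 * (t * p) + 3 * (t * s) ≡ 3 * (t * (p + s))
          c₂ = solve-∀
          c₃ : ∀ p s u → 3 * (p * p) + 3 * (s * s) + 3 * (p * s) + u ≡ u + 3 * (p * s) + (3 * (p * p) + 3 * (s * s))
          c₃ = solve-∀

    module _ {Ω : Set} (μ : Measure Ω) (bitsOf : Ω → BitSet) (w : Ω → ℕ) where
      open Measure μ

      class : (BitSet → ℕ) → ℕ → ℕ
      class l i = ∑ (λ a → w a * ind (l (bitsOf a) ≡ᵇ i))

      private
        p n : ℕ → ℕ
        p = class λ⁺
        n = class λ⁻
        W = ∑ w

        classes : ∀ l → (∀ f → l f ≡ 0 ⊎ l f ≡ 1 ⊎ l f ≡ 2) → class l 0 + class l 1 + class l 2 ≡ W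
        classes l l<3 = trans (cong (_+ class l 2) (sym (∑-+ _ _))) (trans (sym (∑-+ _ _)) (∑-cong λ a → each (w a) (l (bitsOf a)) (l<3 (bitsOf a))))
          where
          each : ∀ w x → x ≡ 0 ⊎ x ≡ 1 ⊎ x ≡ 2 → w * ind (x ≡ᵇ 0) + w * ind (x ≡ᵇ 1) + w * ind (x ≡ᵇ 2) ≡ w
          each w _ (inj₁ refl)        = e w
            where
            e : ∀ w → w * 1 + w * 0 + w * 0 ≡ w
            e = solve-∀
          each w _ (inj₂ (inj₁ refl)) = e w
            where
            e : ∀ w → w * 0 + w * 1 + w * 0 ≡ w
            e = solve-∀
          each w _ (inj₂ (inj₂ refl)) = e w
            where
            e : ∀ w → w * 0 + w * 0 + w * 1 ≡ w
            e = solve-∀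

        product : ∀ (l l′ : BitSet → ℕ) i j → ∑ (λ a → ∑ (λ b → w a * w b * ind ((l (bitsOf a) ≡ᵇ i) ∧ (l′ (bitsOf b) ≡ᵇ j)))) ≡ class l i * class l′ j
        product l l′ i j = trans (∑-cong λ a → trans (∑-cong λ b → each (w a) (w b) (l (bitsOf a) ≡ᵇ i) (l′ (bitsOf b) ≡ᵇ j))
          (∑-* (w a * ind (l (bitsOf a) ≡ᵇ i)) (λ b → w b * ind (l′ (bitsOf b) ≡ᵇ j)))) (∑-*ʳ (λ a → w a * ind (l (bitsOf a) ≡ᵇ i)) (class l′ j))
          where
          each : ∀ x y a b → x * y * ind (a ∧ b) ≡ x * ind a * (y * ind b)
          each x y a b = trans (cong (x * y *_) (ind-∧ a b)) (e x y (ind a) (ind b))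
            where
            e : ∀ x y a b → x * y * (a * b) ≡ x * a * (y * b)
            e = solve-∀

        ⟪_⟫ : (BitSet → BitSet → ℕ) → ℕ
        ⟪ k ⟫ = ∑ (λ a → ∑ (λ b → w a * w b * k (bitsOf a) (bitsOf b)))

        ⟪⟫-+ : ∀ k k′ → ⟪ (λ f h → k f h + k′ f h) ⟫ ≡ ⟪ k ⟫ + ⟪ k′ ⟫
        ⟪⟫-+ k k′ = trans (∑-cong λ a → trans (∑-cong λ b → *-distribˡ-+ (w a * w b) _ _) (∑-+ _ _)) (∑-+ _ _)

        total-mass : ⟪ (λ _ _ → 1) ⟫ ≡ W * W
        total-mass = trans (∑-cong λ a → trans (∑-cong λ b → *-identityʳ _) (∑-* (w a) w)) (∑-*ʳ w W)

        pair : (BitSet → ℕ) → (BitSet → ℕ) → ℕ → ℕ → BitSet → BitSet → ℕ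
        pair l l′ i j f h = ind ((l f ≡ᵇ i) ∧ (l′ h ≡ᵇ j))

        unequal : BitSet → BitSet → ℕ
        unequal f h = ind (not (λ⁺ f ≡ᵇ λ⁻ h))

        equal : BitSet → BitSet → ℕ
        equal f h = pair λ⁺ λ⁻ 0 0 f h + pair λ⁺ λ⁻ 1 1 f h + pair λ⁺ λ⁻ 2 2 f h

        unequal-equal : ∀ f h → ind (not (λ⁺ f ≡ᵇ λ⁻ h)) + equal f h ≡ 1
        unequal-equal f h = each (λ⁺ f) (λ⁻ h) (λ⁺<3 f) (λ⁻<3 h)
          where
          each : ∀ x y → x ≡ 0 ⊎ x ≡ 1 ⊎ x ≡ 2 → y ≡ 0 ⊎ y ≡ 1 ⊎ y ≡ 2 →
            ind (not (x ≡ᵇ y)) + (ind ((x ≡ᵇ 0) ∧ (y ≡ᵇ 0)) + ind ((x ≡ᵇ 1) ∧ (y ≡ᵇ 1)) + ind ((x ≡ᵇ 2) ∧ (y ≡ᵇ 2))) ≡ 1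
          each _ _ (inj₁ refl)        (inj₁ refl)        = refl
          each _ _ (inj₁ refl)        (inj₂ (inj₁ refl)) = refl
          each _ _ (inj₁ refl)        (inj₂ (inj₂ refl)) = refl
          each _ _ (inj₂ (inj₁ refl)) (inj₁ refl)        = refl
          each _ _ (inj₂ (inj₁ refl)) (inj₂ (inj₁ refl)) = refl
          each _ _ (inj₂ (inj₁ refl)) (inj₂ (inj₂ refl)) = refl
          each _ _ (inj₂ (inj₂ refl)) (inj₁ refl)        = refl
          each _ _ (inj₂ (inj₂ refl)) (inj₂ (inj₁ refl)) = refl
          each _ _ (inj₂ (inj₂ refl)) (inj₂ (inj₂ refl)) = refl

        U = ⟪ unequal ⟫

        U-eq : U + (p 0 * n 0 + p 1 * n 1 + p 2 * n 2) ≡ W * W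
        U-eq = trans (cong (U +_) (sym (trans (⟪⟫-+ (λ f h → pair λ⁺ λ⁻ 0 0 f h + pair λ⁺ λ⁻ 1 1 f h) (pair λ⁺ λ⁻ 2 2)) (cong₂ _+_ (trans (⟪⟫-+ (pair λ⁺ λ⁻ 0 0) (pair λ⁺ λ⁻ 1 1)) (cong₂ _+_ (product λ⁺ λ⁻ 0 0) (product λ⁺ λ⁻ 1 1))) (product λ⁺ λ⁻ 2 2)))))
          (trans (sym (⟪⟫-+ unequal equal)) (trans (∑-cong λ a → ∑-cong λ b → cong (w a * w b *_) (unequal-equal (bitsOf a) (bitsOf b))) total-mass))

      -- The first term of `adjacent` sums to W² - ∑ pᵢnᵢ by `U-eq`, the other three to p₀p₁ + n₂n₁
      -- + n₂n₀. By `quadratic` the excess over W² is at most a third of it.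
      links-bound : 3 * ∑ (λ a → ∑ (λ b → w a * w b * links (bitsOf a) (bitsOf b))) ≤ 4 * (W * W)
      links-bound = begin
        3 * ⟪ links ⟫
          ≤⟨ *-monoʳ-≤ 3 (∑-mono λ a → ∑-mono λ b → *-monoʳ-≤ (w a * w b) (links≤adjacent (bitsOf a) (bitsOf b))) ⟩
        3 * ⟪ adjacent ⟫
          ≡⟨ cong (3 *_) (trans (⟪⟫-+ (λ f h → unequal f h + pair λ⁺ λ⁺ 0 1 f h) (λ f h → pair λ⁻ λ⁻ 2 1 f h + pair λ⁻ λ⁻ 2 0 f h))
               (cong₂ _+_ (trans (⟪⟫-+ unequal (pair λ⁺ λ⁺ 0 1)) (cong (U +_) (product λ⁺ λ⁺ 0 1)))
               (trans (⟪⟫-+ (pair λ⁻ λ⁻ 2 1) (pair λ⁻ λ⁻ 2 0)) (cong₂ _+_ (product λ⁻ λ⁻ 2 1) (product λ⁻ λ⁻ 2 0))))) ⟩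
        3 * (U + p 0 * p 1 + (n 2 * n 1 + n 2 * n 0))
          ≡⟨ e₁ U (p 0) (p 1) (n 0) (n 1) (n 2) ⟩
        3 * U + (3 * (p 0 * p 1) + 3 * (n 2 * (n 0 + n 1)))
          ≤⟨ +-monoʳ-≤ (3 * U) (quadratic (p 0) (p 1) (p 2) (n 0) (n 1) (n 2) (trans p-total (sym n-total))) ⟩
        3 * U + ((p 0 + p 1 + p 2) * (p 0 + p 1 + p 2) + 3 * (p 0 * n 0 + p 1 * n 1 + p 2 * n 2))
          ≡⟨ cong (λ t → 3 * U + (t * t + 3 * (p 0 * n 0 + p 1 * n 1 + p 2 * n 2))) p-total ⟩
        3 * U + (W * W + 3 * (p 0 * n 0 + p 1 * n 1 + p 2 * n 2))
          ≡⟨ e₂ U (W * W) (p 0 * n 0 + p 1 * n 1 + p 2 * n 2) ⟩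
        3 * (U + (p 0 * n 0 + p 1 * n 1 + p 2 * n 2)) + W * W
          ≡⟨ cong (λ z → 3 * z + W * W) U-eq ⟩
        3 * (W * W) + W * W
          ≡⟨ e₃ (W * W) ⟩
        4 * (W * W) ∎
        where
        open ≤-Reasoning
        p-total : p 0 + p 1 + p 2 ≡ W
        p-total = classes λ⁺ λ⁺<3
        n-total : n 0 + n 1 + n 2 ≡ W
        n-total = classes λ⁻ λ⁻<3
        e₁ : ∀ U p q a b c → 3 * (U + p * q + (c * b + c * a)) ≡ 3 * U + (3 * (p * q) + 3 * (c * (a + b)))
        e₁ = solve-∀
        e₂ : ∀ U t x → 3 * U + (t + 3 * x) ≡ 3 * (U + x) + t
        e₂ = solve-∀
        e₃ : ∀ t → 3 * t + t ≡ 4 * t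
        e₃ = solve-∀

  open LinkPotentials

  -- Types of vertices, and colours completing pendant edges.

  module Pendants where
    open Measure
    open Indices using (extract; SortedI; module Size)

    infix 4 _=ᵛ_
    _=ᵛ_ : ∀ {n} → Vec Bool n → Vec Bool n → Bool
    []          =ᵛ []          = true
    (true ∷ u)  =ᵛ (true ∷ v)  = u =ᵛ v
    (true ∷ u)  =ᵛ (false ∷ v) = false
    (false ∷ u) =ᵛ (true ∷ v)  = false
    (false ∷ u) =ᵛ (false ∷ v) = u =ᵛ v

    =ᵛ-true : ∀ {n} (u v : Vec Bool n) → (u =ᵛ v) ≡ true → u ≡ v
    =ᵛ-true []          []          h = refl
    =ᵛ-true (true ∷ u)  (true ∷ v)  h = cong (true ∷_) (=ᵛ-true u v h)
    =ᵛ-true (false ∷ u) (false ∷ v) h = cong (false ∷_) (=ᵛ-true u v h)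

    cube : ∀ n → Measure (Vec Bool n)
    cube zero = record
      { ∑ = λ f → f [] ; ∑-mono = λ h → h [] ; ∑-+ = λ f g → refl ; ∑-* = λ k f → refl ; ∑-witness = λ f h → [] , h }
    cube (suc n) = record
      { ∑         = λ f → ∑ (cube n) (f ∘ (true ∷_)) + ∑ (cube n) (f ∘ (false ∷_))
      ; ∑-mono    = λ h → +-mono-≤ (∑-mono (cube n) (h ∘ (true ∷_))) (∑-mono (cube n) (h ∘ (false ∷_)))
      ; ∑-+       = λ f g → trans (cong₂ _+_ (∑-+ (cube n) (f ∘ (true ∷_)) (g ∘ (true ∷_))) (∑-+ (cube n) (f ∘ (false ∷_)) (g ∘ (false ∷_))))
                        (e (∑ (cube n) (f ∘ (true ∷_))) _ _ _)
      ; ∑-*       = λ k f → trans (cong₂ _+_ (∑-* (cube n) k (f ∘ (true ∷_))) (∑-* (cube n) k (f ∘ (false ∷_)))) (sym (*-distribˡ-+ k _ _))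
      ; ∑-witness = λ f h → branch f (∑ (cube n) (f ∘ (true ∷_))) refl h }
      where
      e : ∀ a b c d → a + b + (c + d) ≡ a + c + (b + d)
      e = solve-∀
      branch : ∀ f a → ∑ (cube n) (f ∘ (true ∷_)) ≡ a → 1 ≤ a + ∑ (cube n) (f ∘ (false ∷_)) → ∃[ v ] 1 ≤ f v
      branch f zero    eq h = let (v , p) = ∑-witness (cube n) _ h in false ∷ v , p
      branch f (suc a) eq h = let (v , p) = ∑-witness (cube n) _ (≤-trans (s≤s z≤n) (≤-reflexive (sym eq))) in true ∷ v , p

    cube-point : ∀ n (v : Vec Bool n) → ∑ (cube n) (λ u → ind (u =ᵛ v)) ≡ 1
    cube-point zero    []          = refl
    cube-point (suc n) (true ∷ v)  = cong₂ _+_ (cube-point n v) (∑-0 (cube n))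
    cube-point (suc n) (false ∷ v) = cong₂ _+_ (∑-0 (cube n)) (cube-point n v)

    ⊗-point : ∀ {A B} (μ : Measure A) (ν : Measure B) f g → ∑ μ (ind ∘ f) ≡ 1 → ∑ ν (ind ∘ g) ≡ 1 →
      ∑ (μ ⊗ ν) (λ ω → ind (f (proj₁ ω) ∧ g (proj₂ ω))) ≡ 1
    ⊗-point μ ν f g hf hg = trans (∑-cong μ λ a → trans (∑-cong ν λ b → ind-∧ (f a) (g b))
      (trans (∑-* ν (ind (f a)) (ind ∘ g)) (trans (cong (ind (f a) *_) hg) (*-identityʳ _)))) hf

    Groups : ℕ → Set
    Groups n = Vec Bool n × Vec Bool n × Vec Bool n

    component : ∀ {n} → Role → Groups n → Vec Bool n
    component left  (u , v , w) = u
    component mid   (u , v , w) = v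
    component right (u , v , w) = w

    cubes : ∀ n → Measure (Groups n)
    cubes n = cube n ⊗ (cube n ⊗ cube n)

    -- Every vertex has exactly one type, so counting by types loses and repeats nothing.
    cubes-point : ∀ n u v w → ∑ (cubes n) (λ τ → ind ((component left τ =ᵛ u) ∧ ((component mid τ =ᵛ v) ∧ (component right τ =ᵛ w)))) ≡ 1
    cubes-point n u v w = ⊗-point (cube n) (cube n ⊗ cube n) (_=ᵛ u) (λ τ → (proj₁ τ =ᵛ v) ∧ (proj₂ τ =ᵛ w)) (cube-point n u)
      (⊗-point (cube n) (cube n) (_=ᵛ v) (_=ᵛ w) (cube-point n v) (cube-point n w))

    groupList : ∀ n → List (Groups n)
    groupList n = cartesianProduct (vectors n) (cartesianProduct (vectors n) (vectors n))
      where
      vectors : ∀ n → List (Vec Bool n)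
      vectors = allVecs (true ∷ false ∷ [])

    ∈-groupList : ∀ n τ → τ ∈ groupList n
    ∈-groupList n (u , v , w) = ∈-cartesianProduct⁺ (∈-vectors u) (∈-cartesianProduct⁺ (∈-vectors v) (∈-vectors w))
      where
      ∈-bool : ∀ b → b ∈ true ∷ false ∷ []
      ∈-bool true  = here refl
      ∈-bool false = there (here refl)
      ∈-vectors : ∀ (u : Vec Bool n) → u ∈ allVecs (true ∷ false ∷ []) n
      ∈-vectors u = ∈-allVecs u (λ i → ∈-bool _)

    -- The type of a vertex: the bits it has, grouped by the role that the vertex plays.
    Type : Set
    Type = Groups 6

    fstSlot sndSlot : Role → Role
    fstSlot left  = mid
    fstSlot mid   = left
    fstSlot right = left
    sndSlot left  = right
    sndSlot mid   = right
    sndSlot right = mid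

    -- The role of the vertex and of the third vertex in the edges counted by a bit.
    place third : Bit → Role
    place (bit e s first)  = fstSlot s
    place (bit e s second) = sndSlot s
    third (bit e s first)  = sndSlot s
    third (bit e s second) = fstSlot s

    bitsAt : Role → Vec Bit 6
    bitsAt left  = LaM ∷ LaR ∷ LbM ∷ LbR ∷ LcM ∷ LcR ∷ []
    bitsAt mid   = MaL ∷ MaR ∷ MbL ∷ MbR ∷ McL ∷ McR ∷ []
    bitsAt right = RaL ∷ RaM ∷ RbL ∷ RbM ∷ RcL ∷ RcM ∷ []

    slotIndex : Bit → Fin 6
    slotIndex (bit left  left  _)      = # 0
    slotIndex (bit left  mid   first)  = # 0
    slotIndex (bit left  mid   second) = # 1
    slotIndex (bit left  right _)      = # 1
    slotIndex (bit mid   left  _)      = # 2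
    slotIndex (bit mid   mid   first)  = # 2
    slotIndex (bit mid   mid   second) = # 3
    slotIndex (bit mid   right _)      = # 3
    slotIndex (bit right left  _)      = # 4
    slotIndex (bit right mid   first)  = # 4
    slotIndex (bit right mid   second) = # 5
    slotIndex (bit right right _)      = # 5

    bitsAt-slotIndex : ∀ β → Vec.lookup (bitsAt (place β)) (slotIndex β) ≡ β
    bitsAt-slotIndex (bit left  left  first)  = refl
    bitsAt-slotIndex (bit left  left  second) = refl
    bitsAt-slotIndex (bit left  mid   first)  = refl
    bitsAt-slotIndex (bit left  mid   second) = refl
    bitsAt-slotIndex (bit left  right first)  = refl
    bitsAt-slotIndex (bit left  right second) = refl
    bitsAt-slotIndex (bit mid   left  first)  = refl
    bitsAt-slotIndex (bit mid   left  second) = refl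
    bitsAt-slotIndex (bit mid   mid   first)  = refl
    bitsAt-slotIndex (bit mid   mid   second) = refl
    bitsAt-slotIndex (bit mid   right first)  = refl
    bitsAt-slotIndex (bit mid   right second) = refl
    bitsAt-slotIndex (bit right left  first)  = refl
    bitsAt-slotIndex (bit right left  second) = refl
    bitsAt-slotIndex (bit right mid   first)  = refl
    bitsAt-slotIndex (bit right mid   second) = refl
    bitsAt-slotIndex (bit right right first)  = refl
    bitsAt-slotIndex (bit right right second) = refl

    has : Type → BitSet
    has τ β = Vec.lookup (component (place β) τ) (slotIndex β)

    roles : List Role
    roles = left ∷ mid ∷ right ∷ []

    ∈-roles : ∀ e → e ∈ roles
    ∈-roles left  = here refl
    ∈-roles mid   = there (here refl)
    ∈-roles right = there (there (here refl))

    Code : Set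
    Code = Role × Role × Type × Type

    codesOf : List Type → List Code
    codesOf ts = cartesianProduct roles (cartesianProduct roles (cartesianProduct ts ts))

    ∈-codesOf : ∀ ts → (∀ τ → τ ∈ ts) → ∀ c → c ∈ codesOf ts
    ∈-codesOf ts h (e , s , τ , τ′) = ∈-cartesianProduct⁺ (∈-roles e) (∈-cartesianProduct⁺ (∈-roles s) (∈-cartesianProduct⁺ (h τ) (h τ′)))

    abstract
      -- Opaque together with its lists: there are 2¹⁸ types, far too many to be unfolded.
      types : Measure Type
      types = cubes 6

      types-point : ∀ u v w → ∑ types (λ τ → ind ((component left τ =ᵛ u) ∧ ((component mid τ =ᵛ v) ∧ (component right τ =ᵛ w)))) ≡ 1
      types-point = cubes-point 6

      typeList : List Type
      typeList = groupList 6

      ∈-typeList : ∀ τ → τ ∈ typeList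
      ∈-typeList = ∈-groupList 6

      codes : List Code
      codes = codesOf typeList

      ∈-codes : ∀ c → c ∈ codes
      ∈-codes = ∈-codesOf typeList ∈-typeList

    1≤types : 1 ≤ mass types
    1≤types = ≤-trans (≤-reflexive (sym (types-point z z z))) (∑-mono types (λ τ → ind≤1 ((component left τ =ᵛ z) ∧ ((component mid τ =ᵛ z) ∧ (component right τ =ᵛ z)))))
      where z = Vec.replicate 6 true

    -- One application of Ramsey per colouring; homogeneity already achieved survives in smaller
    -- sets.
    ramseyFamily : ∀ {I A C : Set} → DecidableEquality A → (xs : List A) (cs : List C) → ∀ s n → ∃[ N ] ∀ (W : List I) → N ≤ length W →
      (f : C → List I → A) → (∀ c Q → length Q ≡ s → f c Q ∈ xs) →
      ∃[ W′ ] (W′ ⊆ W × length W′ ≡ n × ∀ c → c ∈ cs → ∃[ a ] ∀ Q → Q ⊆ W′ → length Q ≡ s → f c Q ≡ a)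
    ramseyFamily _≟_ xs []       s n = n , λ W h f f∈ → take n W , take-⊆ n W , length-take-≡ n W h , λ _ ()
    ramseyFamily {I} {A} {C} _≟_ xs (c ∷ cs) s n with ramseyFamily {I} {A} {C} _≟_ xs cs s n
    ... | N₁ , r₁ with ramseyList {I} _≟_ xs s N₁
    ...   | N , r = N , λ W h f f∈ → step f f∈ (r W h (f c) (λ Q _ → f∈ c Q))
      where
      step : ∀ {W} (f : C → List I → A) → (∀ c Q → length Q ≡ s → f c Q ∈ xs) →
        ∃[ V ] (V ⊆ W × length V ≡ N₁ × ∃[ a ] (a ∈ xs × ∀ Q → Q ⊆ V → length Q ≡ s → f c Q ≡ a)) →
        ∃[ W′ ] (W′ ⊆ W × length W′ ≡ n × ∀ c′ → c′ ∈ c ∷ cs → ∃[ a ] ∀ Q → Q ⊆ W′ → length Q ≡ s → f c′ Q ≡ a)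
      step f f∈ (V , V⊆ , lV , a , _ , const) with r₁ V (≤-reflexive (sym lV)) f f∈
      ... | U , U⊆ , lU , g = U , ⊆-trans U⊆ V⊆ , lU , λ
        { c′ (here refl) → a , λ Q Q⊆ → const Q (⊆-trans Q⊆ U⊆)
        ; c′ (there c∈)  → g c′ c∈ }

    module Links (L : ℕ) (1≤L : 1 ≤ L) (E : ℕ → ℕ → ℕ → Fin L → Fin L → Fin L → Bool) (B : Role → ℕ → ℕ → Fin L) (b : ℕ) where
      open Degrees L 1≤L E

      pendantEdge : Bit → ℕ → ℕ → ℕ → V → V → Bool
      pendantEdge (bit e s first)  i j k v z = edgeAt s i j k (at s (B e) i j k) v z
      pendantEdge (bit e s second) i j k v z = edgeAt s i j k (at s (B e) i j k) z v

      linkDeg : Bit → ℕ → ℕ → ℕ → V → ℕ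
      linkDeg β i j k v = ⟨ (λ z → ind (pendantEdge β i j k v z)) ⟩

      -- The colour x has the bit β throughout S.
      Rich : Bit → List ℕ → (ℕ → ℕ → V) → Set
      Rich β S x = ∀ {i j k} → i ∷ j ∷ k ∷ [] ⊆ S → L ≤ suc b * linkDeg β i j k (at (place β) x i j k)

      Attached : Bit → List ℕ → (x z : ℕ → ℕ → V) → Set
      Attached β S x z = ∀ {i j k} → i ∷ j ∷ k ∷ [] ⊆ S → pendantEdge β i j k (at (place β) x i j k) (at (third β) z i j k) ≡ true

      ⟨⟨⟨_⟩⟩⟩ : (V → V → V → ℕ) → ℕ
      ⟨⟨⟨ f ⟩⟩⟩ = ⟨ (λ x → ⟨ (λ y → ⟨ (λ z → f x y z) ⟩) ⟩) ⟩

      ⟨⟨⟨slot⟩⟩⟩ : ∀ ρ (f : V → ℕ) → ⟨⟨⟨ (λ x y z → f (at₃ ρ (x , y , z))) ⟩⟩⟩ ≡ L * L * ⟨ f ⟩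
      ⟨⟨⟨slot⟩⟩⟩ left f = trans (∑-cong μ λ x → trans (∑-cong μ λ y → ⟨const⟩ (f x)) (⟨const⟩ _)) (trans (∑-cong μ λ x → *-assoc (f x) L L)
        (trans (∑-*ʳ μ f (L * L)) (*-comm _ (L * L))))
      ⟨⟨⟨slot⟩⟩⟩ mid f = trans (∑-cong μ λ x → trans (∑-cong μ λ y → ⟨const⟩ (f y)) (∑-*ʳ μ f L)) (trans (⟨const⟩ _) (e ⟨ f ⟩ L))
        where
        e : ∀ a L → a * L * L ≡ L * L * a
        e = solve-∀
      ⟨⟨⟨slot⟩⟩⟩ right f = trans (∑-cong μ λ x → ⟨const⟩ _) (trans (⟨const⟩ _) (e ⟨ f ⟩ L))
        where
        e : ∀ a L → a * L * L ≡ L * L * a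
        e = solve-∀

      slotOf : ∀ {Te S} → System Te S → Role → ℕ → ℕ → V
      slotOf sys left  = System.X sys
      slotOf sys mid   = System.Y sys
      slotOf sys right = System.Z sys

      module _ (β : Bit) (x : ℕ → ℕ → V) where

        pendantTests : Tests
        pendantTests = record
          { F      = λ i j k u v w → pendantEdge β i j k (at (place β) x i j k) (at₃ (third β) (u , v , w))
          ; leftR  = λ _ _ _ _ → true ; leftM  = λ _ _ _ _ → true
          ; midR   = λ _ _ _ _ → true ; midL   = λ _ _ _ _ → true
          ; rightM = λ _ _ _ _ → true ; rightL = λ _ _ _ _ → true }

        -- Only the slot of the third vertex is constrained. The two other slots are free and supply
        -- the factor L².
        pendant-dense : ∀ {S} → Rich β S x → Dense pendantTests (suc b) S
        pendant-dense {S} rich {r} {t₀} {i} {t₁} {j} {m} {k} {l} {l′} s = begin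
          L * (L * L)                    ≡⟨ *-comm L (L * L) ⟩
          L * L * L                      ≤⟨ *-monoʳ-≤ (L * L) (rich sijk) ⟩
          L * L * (suc b * ⟨ f ⟩)        ≡⟨ e (L * L) (suc b) ⟨ f ⟩ ⟩
          suc b * (L * L * ⟨ f ⟩)        ≡⟨ cong (suc b *_) (⟨⟨⟨slot⟩⟩⟩ (third β) f) ⟨
          suc b * ⟨⟨⟨ (λ u v w → f (at₃ (third β) (u , v , w))) ⟩⟩⟩
            ≡⟨ cong (suc b *_) (∑-cong μ λ u → ∑-cong μ λ v → ∑-cong μ λ w → e′ (f (at₃ (third β) (u , v , w)))) ⟩
          suc b * ⟨⟨⟨ weight pendantTests r t₀ i t₁ j m k l l′ ⟩⟩⟩ ∎
          where
          open ≤-Reasoning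
          f : V → ℕ
          f z = ind (pendantEdge β i j k (at (place β) x i j k) z)
          sijk : i ∷ j ∷ k ∷ [] ⊆ S
          sijk = ⊆-trans (_ ∷ʳ _ ∷ʳ refl ∷ _ ∷ʳ refl ∷ _ ∷ʳ refl ∷ _ ∷ʳ _ ∷ʳ []) s
          e : ∀ a c x → a * (c * x) ≡ c * (a * x)
          e = solve-∀
          e′ : ∀ a → a ≡ 1 * (a * (1 * 1))
          e′ = solve-∀

        attached : ∀ {S} (sys : System pendantTests S) → Attached β S x (slotOf sys (third β))
        attached sys {i} {j} {k} s = go (third β) (System.edge sys s)
          where
          go : ∀ ρ → pendantEdge β i j k (at (place β) x i j k) (at₃ ρ (System.X sys i j , System.Y sys i k , System.Z sys j k)) ≡ true →
            pendantEdge β i j k (at (place β) x i j k) (at ρ (slotOf sys ρ) i j k) ≡ true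
          go left  h = h
          go mid   h = h
          go right h = h

      Attached-⊆ : ∀ {β S S′ x z} → S′ ⊆ S → Attached β S x z → Attached β S′ x z
      Attached-⊆ p h s = h (⊆-trans s p)

    module TwoPendants (n b : ℕ) where
      ε₂ = extract n b
      ε₁ = extract (proj₁ ε₂) b

      module _ (L : ℕ) (1≤L : 1 ≤ L) (E : ℕ → ℕ → ℕ → Fin L → Fin L → Fin L → Bool) (B : Role → ℕ → ℕ → Fin L) where
        open Degrees L 1≤L E
        open Links L 1≤L E B b

        run : ∀ β β′ u v S → SortedI S → proj₁ ε₁ ≤ length S → Rich β S u → Rich β′ S v →
          ∃[ S′ ] (S′ ⊆ S × length S′ ≡ n × ∃[ z ] ∃[ z′ ] (Attached β S′ u z × Attached β′ S′ v z′))
        run β β′ u v S sorted long ru rv = step₁ (proj₂ ε₁ L 1≤L (pendantTests β u) S sorted long (pendant-dense β u ru))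
          where
          Goal = ∃[ S′ ] (S′ ⊆ S × length S′ ≡ n × ∃[ z ] ∃[ z′ ] (Attached β S′ u z × Attached β′ S′ v z′))
          step₂ : ∀ {S₁} → S₁ ⊆ S → System (pendantTests β u) S₁ → ∃[ S′ ] (S′ ⊆ S₁ × length S′ ≡ n × System (pendantTests β′ v) S′) → Goal
          step₂ p₁ sys₁ (S₂ , p₂ , l₂ , sys₂) = S₂ , ⊆-trans p₂ p₁ , l₂ , slotOf sys₁ (third β) , slotOf sys₂ (third β′) ,
            Attached-⊆ {β} {x = u} p₂ (attached β u sys₁) , attached β′ v sys₂
          step₁ : ∃[ S₁ ] (S₁ ⊆ S × length S₁ ≡ proj₁ ε₂ × System (pendantTests β u) S₁) → Goal
          step₁ (S₁ , p₁ , l₁ , sys₁) = step₂ p₁ sys₁ (proj₂ ε₂ L 1≤L (pendantTests β′ v) S₁ (λ s → sorted (⊆-trans s p₁))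
            (≤-reflexive (sym l₁)) (pendant-dense β′ v (λ s → rv (⊆-trans s p₁))))

    abstract
      twoPendants : ∀ n b → ∃[ N ] ∀ L (1≤L : 1 ≤ L) E B (let open Degrees L 1≤L E) (let open Links L 1≤L E B b) β β′ u v S →
        SortedI S → N ≤ length S → Rich β S u → Rich β′ S v →
        ∃[ S′ ] (S′ ⊆ S × length S′ ≡ n × Σ (ℕ → ℕ → V) λ z → Σ (ℕ → ℕ → V) λ z′ → (Attached β S′ u z × Attached β′ S′ v z′))
      twoPendants n b = proj₁ (TwoPendants.ε₁ n b) , TwoPendants.run n b

  open Pendants

  -- Cycles from forbidden combinations of types.

  module ForbiddenTypes where
    open Measure
    open Indices using (extract; SortedI; module Size)

    module Palettes (L : ℕ) (1≤L : 1 ≤ L) (E : ℕ → ℕ → ℕ → Fin L → Fin L → Fin L → Bool) (B : Role → ℕ → ℕ → Fin L) (b : ℕ) where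
      open Degrees L 1≤L E
      open Links L 1≤L E B b
      open Cycle E

      Triangles : List ℕ → Set
      Triangles S = ∀ {i j k} → i ∷ j ∷ k ∷ [] ⊆ S → E i j k (B left i j) (B mid i k) (B right j k) ≡ true

      colours : (x y z w : ℕ → ℕ → V) → Colour → ℕ → ℕ → V
      colours x y z w 0 = B left
      colours x y z w 1 = B mid
      colours x y z w 2 = B right
      colours x y z w 3 = x
      colours x y z w 4 = y
      colours x y z w 5 = z
      colours x y z w _ = w

      EdgeOf : (Colour → ℕ → ℕ → V) → List ℕ → Triple → Set
      EdgeOf X S t = ∀ {i j k} → i ∷ j ∷ k ∷ [] ⊆ S → E i j k (X (proj₁ t) i j) (X (proj₁ (proj₂ t)) i k) (X (proj₂ (proj₂ t)) j k) ≡ true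

      pendant-edge : ∀ X → (∀ e → X (base e) ≡ B e) → ∀ β {S} u w → Attached β S (X u) (X w) → EdgeOf X S (pendant β u w)
      pendant-edge X hX (bit e left  first)  u w h s rewrite hX e = h s
      pendant-edge X hX (bit e mid   first)  u w h s rewrite hX e = h s
      pendant-edge X hX (bit e right first)  u w h s rewrite hX e = h s
      pendant-edge X hX (bit e left  second) u w h s rewrite hX e = h s
      pendant-edge X hX (bit e mid   second) u w h s rewrite hX e = h s
      pendant-edge X hX (bit e right second) u w h s rewrite hX e = h s

      module _ (x y z w : ℕ → ℕ → V) where
        private
          X = colours x y z w

        colours-base : ∀ e → X (base e) ≡ B e
        colours-base left  = refl
        colours-base mid   = refl
        colours-base right = refl

        realize-conflict : ∀ p q {S} → Triangles S → Attached p S x y → Attached q S x z → Realized X (conflictPalette p q) S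
        realize-conflict p q {S} tr hp hq (here eq) = subst (EdgeOf X S) (sym eq) tr
        realize-conflict p q {S} tr hp hq (there (here eq)) = subst (EdgeOf X S) (sym eq) (pendant-edge X colours-base p 3 4 hp)
        realize-conflict p q {S} tr hp hq (there (there (here eq))) = subst (EdgeOf X S) (sym eq) (pendant-edge X colours-base q 3 5 hq)

        realize-restriction : ∀ p q s {S} → Triangles S → Attached p S x y → Attached q S x z → Attached s S y w →
          Realized X (restrictionPalette p q s) S
        realize-restriction p q s {S} tr hp hq hs (here eq) = subst (EdgeOf X S) (sym eq) tr
        realize-restriction p q s {S} tr hp hq hs (there (here eq)) = subst (EdgeOf X S) (sym eq) (pendant-edge X colours-base p 3 4 hp)
        realize-restriction p q s {S} tr hp hq hs (there (there (here eq))) = subst (EdgeOf X S) (sym eq) (pendant-edge X colours-base q 3 5 hq)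
        realize-restriction p q s {S} tr hp hq hs (there (there (there (here eq)))) = subst (EdgeOf X S) (sym eq) (pendant-edge X colours-base s 4 6 hs)

    all-false : ∀ {A : Set} (p : A → Bool) xs → all p xs ≡ false → ∃[ x ] (x ∈ xs × p x ≡ false)
    all-false p (x ∷ xs) h with p x in eq
    ... | false = x , here refl , eq
    ... | true  = let (y , y∈ , h′) = all-false p xs h in y , there y∈ , h′

    clashing : ∀ f → ok f ≡ false → ∃[ p ] ∃[ q ] ∃[ w ] ((p , q , w) ∈ conflicts × f p ≡ true × f q ≡ true)
    clashing f h =
      let ((p , q , w) , c∈ , n) = all-false (not ∘ clash f) conflicts h
          (fp , fq) = ∧-true {f p} (Bool.not-injective n)
      in p , q , w , c∈ , fp , fq

    -- The two bits of the link are present, yet the combination is not allowed, because of a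
    -- conflict or a restriction. Combinations lacking one of the bits are sparse by the meaning of
    -- a bit and are kept apart.
    bad : Code → Bool
    bad (e , s , τ , τ′) = has τ (bit e s first) ∧ (has τ′ (bit e s second) ∧ not (allowed e s (has τ) (has τ′)))

    not-allowed : ∀ e s f h → f (bit e s first) ≡ true → h (bit e s second) ≡ true → allowed e s f h ≡ false →
      ok f ≡ false ⊎ ok h ≡ false ⊎ excluded e s f h ≡ true
    not-allowed e s f h p q n = cases (f (bit e s first)) (h (bit e s second)) (ok f) (ok h) (excluded e s f h) p q n
      where
      cases : ∀ a b u v x → a ≡ true → b ≡ true → a ∧ (b ∧ (u ∧ (v ∧ not x))) ≡ false → u ≡ false ⊎ v ≡ false ⊎ x ≡ true
      cases true true false v     x    _ _ _ = inj₁ refl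
      cases true true true  false x    _ _ _ = inj₂ (inj₁ refl)
      cases true true true  true  true _ _ _ = inj₂ (inj₂ refl)

    module Closing (m : ℕ) (m≥1 : m ≥ 1) (b : ℕ) where
      εp = twoPendants (5 * (2 + 3 * m)) b

      module _ (L : ℕ) (1≤L : 1 ≤ L) (E : ℕ → ℕ → ℕ → Fin L → Fin L → Fin L → Bool) (B : Role → ℕ → ℕ → Fin L) where
        open Degrees L 1≤L E
        open Links L 1≤L E B b
        open Palettes L 1≤L E B b
        open Cycle E

        module _ {S : List ℕ} (sorted : SortedI S) (long : proj₁ εp ≤ length S) (tr : Triangles S) where

          close : ∀ w Ts → valid w Ts ≡ true → ∀ {S′} → S′ ⊆ S → length S′ ≡ 5 * (2 + 3 * m) → ∀ X → Realized X Ts S′ → TightCycle (2 + 3 * m) S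
          close w Ts v {S′} S′⊆ l X real = TightCycle-⊆ S′⊆ (tightCycle m m≥1 w Ts v S′ (λ s → <ᵇ-true (proj₁ (sorted (⊆-trans s S′⊆))))
            (≤-reflexive (sym l)) X real)

          fromConflict : ∀ {p q w} x → (p , q , w) ∈ conflicts → Rich p S x → Rich q S x → TightCycle (2 + 3 * m) S
          fromConflict {p} {q} {w} x c∈ rp rq = finish (proj₂ εp L 1≤L E B p q x x S sorted long rp rq)
            where
            finish : ∃[ S′ ] (S′ ⊆ S × length S′ ≡ 5 * (2 + 3 * m) × Σ (ℕ → ℕ → V) λ z → Σ (ℕ → ℕ → V) λ z′ →
              (Attached p S′ x z × Attached q S′ x z′)) → TightCycle (2 + 3 * m) S
            finish (S′ , S′⊆ , l , z , z′ , hp , hq) = close w (conflictPalette p q) (all-∈ conflictValid conflicts-valid c∈) S′⊆ l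
              (colours x z z′ z′) (realize-conflict x z z′ z′ p q (λ s → tr (⊆-trans s S′⊆)) hp hq)

          fromRestriction : ∀ {p q s w} x y → (p , q , s , w) ∈ restrictions → Attached p S x y → Rich q S x → Rich s S y → TightCycle (2 + 3 * m) S
          fromRestriction {p} {q} {s} {w} x y r∈ hp rq rs = finish (proj₂ εp L 1≤L E B q s x y S sorted long rq rs)
            where
            finish : ∃[ S′ ] (S′ ⊆ S × length S′ ≡ 5 * (2 + 3 * m) × Σ (ℕ → ℕ → V) λ z → Σ (ℕ → ℕ → V) λ z′ →
              (Attached q S′ x z × Attached s S′ y z′)) → TightCycle (2 + 3 * m) S
            finish (S′ , S′⊆ , l , z , z′ , hq , hs) = close w (restrictionPalette p q s) (all-∈ restrictionValid restrictions-valid r∈) S′⊆ l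
              (colours x y z z′) (realize-restriction x y z z′ p q s (λ t → tr (⊆-trans t S′⊆)) (λ t → hp (⊆-trans t S′⊆)) hq hs)

          fromBad : ∀ e s (f h : BitSet) x y → f (bit e s first) ≡ true → h (bit e s second) ≡ true → allowed e s f h ≡ false →
            Attached (bit e s first) S x y → (∀ β → f β ≡ true → Rich β S x) → (∀ β → h β ≡ true → Rich β S y) → TightCycle (2 + 3 * m) S
          fromBad e s f h x y p q n link rx ry = cases (not-allowed e s f h p q n)
            where
            conflict : ∀ g z → (∀ β → g β ≡ true → Rich β S z) → ok g ≡ false → TightCycle (2 + 3 * m) S
            conflict g z rz h = let (p , q , w , c∈ , gp , gq) = clashing g h in fromConflict z c∈ (rz p gp) (rz q gq)
            -- A restriction that names the bit of the opposite side is applied with x and y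
            -- exchanged. Being attached is then literally the same statement, so `link` serves in
            -- all four cases.
            restricting : ∀ e s → Attached (bit e s first) S x y → excluded e s f h ≡ true → TightCycle (2 + 3 * m) S
            restricting left right link ex = [ (λ c → fromRestriction x y (here refl) link
                (rx MbL (proj₁ (∧-true {f MbL} c))) (ry RbL (proj₂ (∧-true {f MbL} c))))
              , (λ c → fromRestriction y x (there (there (there (here refl)))) link
                (ry RcM (proj₁ (∧-true {h RcM} c))) (rx RcL (proj₂ (∧-true {h RcM} c)))) ]′ (∨-true {f MbL ∧ h RbL} ex)
            restricting right left link ex = [ (λ c → fromRestriction y x (there (here refl)) link
                (ry MbR (proj₁ (∧-true {h MbR} c))) (rx LbR (proj₂ (∧-true {h MbR} c))))
              , (λ c → fromRestriction x y (there (there (here refl))) link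
                (rx LaM (proj₁ (∧-true {f LaM} c))) (ry LaR (proj₂ (∧-true {f LaM} c)))) ]′ (∨-true {h MbR ∧ f LbR} ex)
            cases : ok f ≡ false ⊎ ok h ≡ false ⊎ excluded e s f h ≡ true → TightCycle (2 + 3 * m) S
            cases (inj₁ o)        = conflict f x rx o
            cases (inj₂ (inj₁ o)) = conflict h y ry o
            cases (inj₂ (inj₂ o)) = restricting e s link o

  open ForbiddenTypes

  -- Link edges counted by the types of their ends.

  module LinkTypes where
    open Measure
    open Indices using (extract; SortedI; module Size)

    module CodeTests (L : ℕ) (1≤L : 1 ≤ L) (E : ℕ → ℕ → ℕ → Fin L → Fin L → Fin L → Bool) (B : Role → ℕ → ℕ → Fin L) (b : ℕ) where
      open Degrees L 1≤L E
      open Links L 1≤L E B b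

      bitTest : Bit → ℕ → ℕ → ℕ → V → Bool
      bitTest β i j k v = L ≤ᵇ suc b * linkDeg β i j k v

      matchAt : Role → Type → ℕ → ℕ → ℕ → V → Bool
      matchAt r τ i j k v = component r τ =ᵛ Vec.map (λ β → bitTest β i j k v) (bitsAt r)

      match-bit : ∀ β τ {i j k v} → matchAt (place β) τ i j k v ≡ true → has τ β ≡ bitTest β i j k v
      match-bit β τ {i} {j} {k} {v} h = trans (cong (λ u → Vec.lookup u (slotIndex β)) (=ᵛ-true (component (place β) τ) _ h))
        (trans (Vec.lookup-map (slotIndex β) (λ β → bitTest β i j k v) (bitsAt (place β))) (cong (λ β → bitTest β i j k v) (bitsAt-slotIndex β)))

      match : Type → (tR p tM q tL : ℕ) → V → Bool
      match τ tR p tM q tL v = matchAt left τ p q tL v ∧ (matchAt mid τ p tM q v ∧ matchAt right τ tR p q v)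

      -- The two vertices of a link edge of a base colour in role s have types τ and τ′.
      slotTest : Role → Role → Type → Type → Role → ℕ → ℕ → ℕ → V → Bool
      slotTest left  left  τ τ′ r i j k v = true
      slotTest left  mid   τ τ′ r i j k v = matchAt r τ i j k v
      slotTest left  right τ τ′ r i j k v = matchAt r τ′ i j k v
      slotTest mid   left  τ τ′ r i j k v = matchAt r τ i j k v
      slotTest mid   mid   τ τ′ r i j k v = true
      slotTest mid   right τ τ′ r i j k v = matchAt r τ′ i j k v
      slotTest right left  τ τ′ r i j k v = matchAt r τ i j k v
      slotTest right mid   τ τ′ r i j k v = matchAt r τ′ i j k v
      slotTest right right τ τ′ r i j k v = true

      linkAt : Role → Role → ℕ → ℕ → ℕ → V → V → Bool
      linkAt e s i j k x y = edgeAt s i j k (at s (B e) i j k) x y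

      codeTests : Code → Tests
      codeTests (e , s , τ , τ′) = record
        { F      = λ i j k x y z → linkAt e s i j k (at₃ (fstSlot s) (x , y , z)) (at₃ (sndSlot s) (x , y , z)) ∧
                     (slotTest s left τ τ′ left i j k x ∧ (slotTest s mid τ τ′ mid i j k y ∧ slotTest s right τ τ′ right i j k z))
        ; leftR  = slotTest s left τ τ′ right
        ; leftM  = slotTest s left τ τ′ mid
        ; midR   = slotTest s mid τ τ′ right
        ; midL   = slotTest s mid τ τ′ left
        ; rightM = slotTest s right τ τ′ mid
        ; rightL = slotTest s right τ τ′ left }

      module _ {e s : Role} {τ τ′ : Type} {S : List ℕ} (sys : System (codeTests (e , s , τ , τ′)) S) where

        private
          own : ∀ {i j k} → i ∷ j ∷ k ∷ [] ⊆ S →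
            linkAt e s i j k (at₃ (fstSlot s) (System.X sys i j , System.Y sys i k , System.Z sys j k)) (at₃ (sndSlot s) (System.X sys i j , System.Y sys i k , System.Z sys j k)) ≡ true ×
            slotTest s left τ τ′ left i j k (System.X sys i j) ≡ true × slotTest s mid τ τ′ mid i j k (System.Y sys i k) ≡ true ×
            slotTest s right τ τ′ right i j k (System.Z sys j k) ≡ true
          own {i} {j} {k} p =
            let (a , h)  = ∧-true {linkAt e s i j k (at₃ (fstSlot s) (System.X sys i j , System.Y sys i k , System.Z sys j k)) (at₃ (sndSlot s) (System.X sys i j , System.Y sys i k , System.Z sys j k))} (System.edge sys p)
                (u , h′) = ∧-true {slotTest s left τ τ′ left i j k (System.X sys i j)} h
                (v , w)  = ∧-true {slotTest s mid τ τ′ mid i j k (System.Y sys i k)} h′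
            in a , u , v , w

          passes : ∀ ρ r {i j k} → i ∷ j ∷ k ∷ [] ⊆ S → slotTest s ρ τ τ′ r i j k (at r (slotOf sys ρ) i j k) ≡ true
          passes left  left  p = proj₁ (proj₂ (own p))
          passes left  mid   p = System.testLM sys p
          passes left  right p = System.testLR sys p
          passes mid   left  p = System.testML sys p
          passes mid   mid   p = proj₁ (proj₂ (proj₂ (own p)))
          passes mid   right p = System.testMR sys p
          passes right left  p = System.testRL sys p
          passes right mid   p = System.testRM sys p
          passes right right p = proj₂ (proj₂ (proj₂ (own p)))

          at₃-at : ∀ ρ {i j k} → at₃ ρ (System.X sys i j , System.Y sys i k , System.Z sys j k) ≡ at ρ (slotOf sys ρ) i j k
          at₃-at left  = refl
          at₃-at mid   = refl
          at₃-at right = refl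

          fstTest : ∀ s r {i j k v} → slotTest s (fstSlot s) τ τ′ r i j k v ≡ matchAt r τ i j k v
          fstTest left  r = refl
          fstTest mid   r = refl
          fstTest right r = refl

          sndTest : ∀ s r {i j k v} → slotTest s (sndSlot s) τ τ′ r i j k v ≡ matchAt r τ′ i j k v
          sndTest left  r = refl
          sndTest mid   r = refl
          sndTest right r = refl

        code-link : Attached (bit e s first) S (slotOf sys (fstSlot s)) (slotOf sys (sndSlot s))
        code-link {i} {j} {k} p = trans (cong₂ (linkAt e s i j k) (sym (at₃-at (fstSlot s))) (sym (at₃-at (sndSlot s)))) (proj₁ (own p))

        code-fst : ∀ β → has τ β ≡ true → Rich β S (slotOf sys (fstSlot s))
        code-fst β h p = ≤ᵇ-true (trans (sym (match-bit β τ (trans (sym (fstTest s (place β))) (passes (fstSlot s) (place β) p)))) h)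

        code-snd : ∀ β → has τ′ β ≡ true → Rich β S (slotOf sys (sndSlot s))
        code-snd β h p = ≤ᵇ-true (trans (sym (match-bit β τ′ (trans (sym (sndTest s (place β))) (passes (sndSlot s) (place β) p)))) h)

    ∑-sumFin : ∀ {Ω} (μ : Measure Ω) n (f : Ω → Fin n → ℕ) → ∑ μ (λ ω → sumFin n (f ω)) ≡ sumFin n (λ i → ∑ μ (λ ω → f ω i))
    ∑-sumFin μ zero    f = ∑-0 μ
    ∑-sumFin μ (suc n) f = trans (∑-+ μ _ _) (cong (∑ μ (λ ω → f ω zero) +_) (∑-sumFin μ n (λ ω i → f ω (suc i))))

    -- `weight` separates the tests in the triad ijk from those in other triads. Regrouped by
    -- vertices, the three role tests of each vertex form one `match`.
    slot-weight : ∀ E l l₁ l₂ a c₁ c₂ d d₁ d₂ →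
      ind (l₁ ∧ l₂) * (ind (E ∧ (l ∧ (a ∧ d))) * (ind (c₁ ∧ c₂) * ind (d₁ ∧ d₂))) ≡
      ind E * (ind (l ∧ (l₂ ∧ l₁)) * (ind (c₂ ∧ (a ∧ c₁)) * ind (d₂ ∧ (d₁ ∧ d))))
    slot-weight E l l₁ l₂ a c₁ c₂ d d₁ d₂
      rewrite ind-∧ E (l ∧ (a ∧ d)) | ind-∧ l (a ∧ d) | ind-∧ a d | ind-∧ l (l₂ ∧ l₁) | Bool.∧-comm l₂ l₁
            | ind-∧ c₂ (a ∧ c₁) | ind-∧ a c₁ | ind-∧ c₁ c₂ | ind-∧ d₂ (d₁ ∧ d) | ind-∧ d₁ d₂ | ind-∧ d₁ d
      = e (ind E) (ind l) (ind (l₁ ∧ l₂)) (ind a) (ind d) (ind c₁) (ind c₂) (ind d₁) (ind d₂)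
      where
      e : ∀ E l P a d c₁ c₂ d₁ d₂ → P * (E * (l * (a * d)) * (c₁ * c₂ * (d₁ * d₂))) ≡ E * (l * P * (c₂ * (a * c₁) * (d₂ * (d₁ * d))))
      e = solve-∀

    module LinkCounts (L : ℕ) (1≤L : 1 ≤ L) (E : ℕ → ℕ → ℕ → Fin L → Fin L → Fin L → Bool) (B : Role → ℕ → ℕ → Fin L) (b : ℕ)
      (r t₀ i t₁ j m k l l′ : ℕ) where
      open Degrees L 1≤L E
      open Links L 1≤L E B b
      open CodeTests L 1≤L E B b

      matchSlot : Role → Type → V → Bool
      matchSlot left  τ = match τ t₀ i t₁ j k
      matchSlot mid   τ = match τ r i j k l
      matchSlot right τ = match τ i j m k l′

      matchSlot-total : ∀ ρ v → ∑ types (λ τ → ind (matchSlot ρ τ v)) ≡ 1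
      matchSlot-total left  v = types-point _ _ _
      matchSlot-total mid   v = types-point _ _ _
      matchSlot-total right v = types-point _ _ _

      matchSlot-own : ∀ ρ τ v → matchSlot ρ τ v ≡ true → matchAt ρ τ i j k v ≡ true
      matchSlot-own left  τ v h = proj₁ (∧-true {matchAt left τ i j k v} h)
      matchSlot-own mid   τ v h = proj₁ (∧-true {matchAt mid τ i j k v} (proj₂ (∧-true {matchAt left τ i k l v} h)))
      matchSlot-own right τ v h = proj₂ (∧-true {matchAt mid τ j m k v} (proj₂ (∧-true {matchAt left τ j k l′ v} h)))

      typeCount : Role → Type → ℕ
      typeCount ρ τ = ⟨ (λ v → ind (matchSlot ρ τ v)) ⟩

      link : Role → Role → V → V → ℕ
      link e s x y = ind (linkAt e s i j k x y)

      fstMatch sndMatch : Role → Type → V → ℕ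
      fstMatch s τ x  = ind (matchSlot (fstSlot s) τ x)
      sndMatch s τ′ y = ind (matchSlot (sndSlot s) τ′ y)

      linkCount : Role → Role → Type → Type → ℕ
      linkCount e s τ τ′ = ⟨ (λ x → ⟨ (λ y → link e s x y * (fstMatch s τ x * sndMatch s τ′ y)) ⟩) ⟩

      -- The vertex in role `s` is the prescribed base vertex, so the variable of that slot is free
      -- and contributes the factor L.
      weight-linkCount : ∀ e s τ τ′ → ⟨⟨⟨ weight (codeTests (e , s , τ , τ′)) r t₀ i t₁ j m k l l′ ⟩⟩⟩ ≡ linkCount e s τ τ′ * L
      weight-linkCount e left τ τ′ = trans (∑-cong μ λ x → ∑-cong μ λ y → ∑-cong μ λ z → trans
        (slot-weight (linkAt e left i j k y z) true true true (matchAt mid τ i j k y) (matchAt right τ r i k y) (matchAt left τ i k l y)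
           (matchAt right τ′ i j k z) (matchAt mid τ′ j m k z) (matchAt left τ′ j k l′ z)) (cong (link e left y z *_) (*-identityˡ _)))
        (⟨const⟩ _)
      weight-linkCount e mid τ τ′ = trans (∑-cong μ λ x → trans (∑-cong μ λ y → ∑-cong μ λ z → trans
        (slot-weight (linkAt e mid i j k x z) (matchAt left τ i j k x) (matchAt right τ t₀ i j x) (matchAt mid τ i t₁ j x) true true true
           (matchAt right τ′ i j k z) (matchAt mid τ′ j m k z) (matchAt left τ′ j k l′ z))
        (cong (λ u → link e mid x z * (fstMatch mid τ x * u)) (*-identityˡ _))) (⟨const⟩ _))
        (∑-*ʳ μ _ L)
      weight-linkCount e right τ τ′ = trans (∑-cong μ λ x → trans (∑-cong μ λ y → trans (∑-cong μ λ z → trans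
        (slot-weight (linkAt e right i j k x y) (matchAt left τ i j k x) (matchAt right τ t₀ i j x) (matchAt mid τ i t₁ j x)
           (matchAt mid τ′ i j k y) (matchAt right τ′ r i k y) (matchAt left τ′ i k l y) true true true)
        (cong (λ u → link e right x y * (fstMatch right τ x * u)) (*-identityʳ _))) (⟨const⟩ _)) (∑-*ʳ μ _ L))
        (∑-*ʳ μ _ L)

      linkDegree : Role → Role → ℕ
      linkDegree e s = deg s i j k (at s (B e) i j k)

      private
        product-total : ∀ (f h : Type → ℕ) c → ∑ types f ≡ 1 → ∑ types h ≡ 1 → ∑ types (λ τ → ∑ types (λ τ′ → c * (f τ * h τ′))) ≡ c
        product-total f h c hf hh = trans (∑-cong types λ τ → trans (∑-cong types λ τ′ → sym (*-assoc c (f τ) (h τ′)))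
          (trans (∑-* types (c * f τ) h) (trans (cong (c * f τ *_) hh) (*-identityʳ _)))) (trans (∑-* types c f) (trans (cong (c *_) hf) (*-identityʳ c)))

        exchange : ∀ (f : Type → Type → V → V → ℕ) → ∑ types (λ τ → ∑ types (λ τ′ → ⟨ (λ x → ⟨ (λ y → f τ τ′ x y) ⟩) ⟩)) ≡
          ⟨ (λ x → ⟨ (λ y → ∑ types (λ τ → ∑ types (λ τ′ → f τ τ′ x y))) ⟩) ⟩
        exchange f = trans (∑-cong types λ τ → trans (∑-sumFin types L (λ τ′ x → ⟨ f τ τ′ x ⟩)) (∑-cong μ λ x → ∑-sumFin types L (λ τ′ y → f τ τ′ x y)))
          (trans (∑-sumFin types L (λ τ x → ⟨ (λ y → ∑ types (λ τ′ → f τ τ′ x y)) ⟩)) (∑-cong μ λ x → ∑-sumFin types L (λ τ y → ∑ types (λ τ′ → f τ τ′ x y))))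

      degree-split : ∀ e s → ∑ types (λ τ → ∑ types (λ τ′ → linkCount e s τ τ′)) ≡ linkDegree e s
      degree-split e s = trans (exchange _) (∑-cong μ λ x → ∑-cong μ λ y →
        product-total (λ τ → fstMatch s τ x) (λ τ′ → sndMatch s τ′ y) (link e s x y) (matchSlot-total (fstSlot s) x) (matchSlot-total (sndSlot s) y))

      degree-split′ : ∀ e s → ∑ types (λ τ′ → ∑ types (λ τ → linkCount e s τ τ′)) ≡ linkDegree e s
      degree-split′ e s = trans (exchange (λ τ′ τ x y → link e s x y * (fstMatch s τ x * sndMatch s τ′ y))) (∑-cong μ λ x → ∑-cong μ λ y →
        trans (∑-cong types λ τ′ → ∑-cong types λ τ → cong (link e s x y *_) (*-comm (fstMatch s τ x) (sndMatch s τ′ y)))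
        (product-total (λ τ′ → sndMatch s τ′ y) (λ τ → fstMatch s τ x) (link e s x y) (matchSlot-total (sndSlot s) y) (matchSlot-total (fstSlot s) x)))

      linkCount-product : ∀ e s τ τ′ → linkCount e s τ τ′ ≤ typeCount (fstSlot s) τ * typeCount (sndSlot s) τ′
      linkCount-product e s τ τ′ = ≤-trans (∑-mono μ λ x → ≤-trans (∑-mono μ λ y → ≤-trans (*-monoˡ-≤ (fstMatch s τ x * sndMatch s τ′ y) (ind≤1 (linkAt e s i j k x y)))
        (≤-reflexive (*-identityˡ _))) (≤-reflexive (∑-* μ (fstMatch s τ x) (sndMatch s τ′)))) (≤-reflexive (∑-*ʳ μ (fstMatch s τ) _))

      private
        poor : ∀ β τ → has τ β ≡ false → ∀ v → ind (matchSlot (place β) τ v) * (b * linkDeg β i j k v) ≤ L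
        poor β τ h v = cases (matchSlot (place β) τ v) refl
          where
          cases : ∀ a → matchSlot (place β) τ v ≡ a → ind a * (b * linkDeg β i j k v) ≤ L
          cases false eq = z≤n
          cases true  eq = ≤-trans (≤-reflexive (*-identityˡ _)) (≤-trans (m≤n+m _ (linkDeg β i j k v)) (<⇒≤ (≤ᵇ-false
            (trans (sym (match-bit β τ (matchSlot-own (place β) τ v eq))) h))))

        summed : ∀ β τ (c : ℕ) → c ≤ ⟨ (λ v → ind (matchSlot (place β) τ v) * linkDeg β i j k v) ⟩ → has τ β ≡ false → b * c ≤ L * L
        summed β τ c h p = ≤-trans (*-monoʳ-≤ b h) (≤-trans (≤-reflexive (sym (∑-* μ b _))) (⟨≤⟩ λ v → ≤-trans (≤-reflexive
          (e b (ind (matchSlot (place β) τ v)) (linkDeg β i j k v))) (poor β τ p v)))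
          where
          e : ∀ b m d → b * (m * d) ≡ m * (b * d)
          e = solve-∀

        drop₁ : ∀ c m n → c * (m * ind n) ≤ m * c
        drop₁ c m n = ≤-trans (*-monoʳ-≤ c (≤-trans (*-monoʳ-≤ m (ind≤1 n)) (≤-reflexive (*-identityʳ m)))) (≤-reflexive (*-comm c m))
        drop₂ : ∀ c m n → c * (ind m * n) ≤ n * c
        drop₂ c m n = ≤-trans (*-monoʳ-≤ c (≤-trans (*-monoˡ-≤ n (ind≤1 m)) (≤-reflexive (*-identityˡ n)))) (≤-reflexive (*-comm c n))

      -- A vertex whose type lacks the bit has fewer than L / (b + 1) neighbours in this link.
      linkCount-fst : ∀ e s τ τ′ → has τ (bit e s first) ≡ false → b * linkCount e s τ τ′ ≤ L * L
      linkCount-fst e s τ τ′ = summed (bit e s first) τ (linkCount e s τ τ′) (∑-mono μ λ x → ≤-trans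
        (∑-mono μ λ y → drop₁ (link e s x y) (fstMatch s τ x) (matchSlot (sndSlot s) τ′ y)) (≤-reflexive (∑-* μ (fstMatch s τ x) (link e s x))))

      linkCount-snd : ∀ e s τ τ′ → has τ′ (bit e s second) ≡ false → b * linkCount e s τ τ′ ≤ L * L
      linkCount-snd e s τ τ′ = summed (bit e s second) τ′ (linkCount e s τ τ′) (≤-trans (≤-reflexive (∑-swap L L _)) (∑-mono μ λ y → ≤-trans
        (∑-mono μ λ x → drop₂ (link e s x y) (matchSlot (fstSlot s) τ x) (sndMatch s τ′ y)) (≤-reflexive (∑-* μ (sndMatch s τ′ y) (λ x → link e s x y)))))

  open LinkTypes

  -- Stage two: the bound 4/3 for the nine degrees.

  module LinkDensity where
    open Measure
    open Indices using (extract; SortedI; module Size)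

    sum₃ : (Role → ℕ) → ℕ
    sum₃ f = f left + f mid + f right

    sum₃-mono : ∀ {f h} → (∀ e → f e ≤ h e) → sum₃ f ≤ sum₃ h
    sum₃-mono p = +-mono-≤ (+-mono-≤ (p left) (p mid)) (p right)

    sum₃-* : ∀ k f → sum₃ (λ e → k * f e) ≡ k * sum₃ f
    sum₃-* k f = e k (f left) (f mid) (f right)
      where
      e : ∀ k a b c → k * a + k * b + k * c ≡ k * (a + b + c)
      e = solve-∀

    sum₉ : (Role → Role → ℕ) → ℕ
    sum₉ f = sum₃ (λ e → sum₃ (f e))

    sum₉-mono : ∀ {f h} → (∀ e s → f e s ≤ h e s) → sum₉ f ≤ sum₉ h
    sum₉-mono p = sum₃-mono (λ e → sum₃-mono (p e))

    sum₉-* : ∀ k f → sum₉ (λ e s → k * f e s) ≡ k * sum₉ f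
    sum₉-* k f = trans (cong₂ _+_ (cong₂ _+_ (sum₃-* k (f left)) (sum₃-* k (f mid))) (sum₃-* k (f right))) (sum₃-* k (λ e → sum₃ (f e)))

    sum₉-affine : ∀ b f d → sum₉ (λ e s → b * f e s + d) ≡ b * sum₉ f + 9 * d
    sum₉-affine b f d = trans (cong₂ _+_ (cong₂ _+_ (row (f left)) (row (f mid))) (row (f right))) (e b (sum₃ (f left)) (sum₃ (f mid)) (sum₃ (f right)) d)
      where
      row : ∀ h → sum₃ (λ s → b * h s + d) ≡ b * sum₃ h + 3 * d
      row h = e b (h left) (h mid) (h right) d
        where
        e : ∀ b x y z d → b * x + d + (b * y + d) + (b * z + d) ≡ b * (x + y + z) + 3 * d
        e = solve-∀
      e : ∀ b x y z d → b * x + 3 * d + (b * y + 3 * d) + (b * z + 3 * d) ≡ b * (x + y + z) + 9 * d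
      e = solve-∀

    ∑-sum₃ : ∀ {Ω} (μ : Measure Ω) (f : Role → Ω → ℕ) → ∑ μ (λ ω → sum₃ (λ e → f e ω)) ≡ sum₃ (λ e → ∑ μ (f e))
    ∑-sum₃ μ f = trans (∑-+ μ _ (f right)) (cong (_+ ∑ μ (f right)) (∑-+ μ (f left) (f mid)))

    ∑-sum₉ : ∀ {Ω} (μ : Measure Ω) (f : Role → Role → Ω → ℕ) → ∑ μ (λ ω → sum₉ (λ e s → f e s ω)) ≡ sum₉ (λ e s → ∑ μ (f e s))
    ∑-sum₉ μ f = trans (∑-sum₃ μ (λ e ω → sum₃ (λ s → f e s ω))) (cong₂ _+_ (cong₂ _+_ (∑-sum₃ μ (f left)) (∑-sum₃ μ (f mid))) (∑-sum₃ μ (f right)))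

    orient : Role → Role → BitSet → BitSet → Bool
    orient left  left  f h = allowed left left h f
    orient mid   right f h = allowed mid right h f
    orient right left  f h = allowed right left h f
    orient right mid   f h = allowed right mid h f
    orient e     s     f h = allowed e s f h

    links-orient : ∀ f h → links f h ≡ sum₉ (λ e s → ind (orient e s f h))
    links-orient f h = e (ind (allowed left left h f)) (ind (allowed left mid f h)) (ind (allowed left right f h))
      (ind (allowed mid left f h)) (ind (allowed mid mid f h)) (ind (allowed mid right h f))
      (ind (allowed right left h f)) (ind (allowed right mid h f)) (ind (allowed right right f h))
      where
      e : ∀ ll lm lr ml mm mr rl rm rr → (ll + (lr + (ml + (mr + (rl + rr))))) + mm + (lm + rm) ≡ ll + lm + lr + (ml + mm + mr) + (rl + rm + rr)
      e = solve-∀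

    -- After division by G²b the left side is 4g + 8/40 + 1/400g + 27/40. The first error comes from
    -- rounding up the type weights, the last from nine links with t² sparse pairs of types each.
    -- The constant 40 keeps the total error below 1, the surplus provided by `heavy`.
    numeric₂ : ∀ g t → 1 ≤ g → 1 ≤ t → ∀ {G b} → G ≡ t * (40 * g) → b ≡ t * t * (40 * g) →
      g * (b * (4 * ((G + t) * (G + t))) + 27 * (G * G * (t * t))) < (4 * g + 1) * (G * G * b)
    numeric₂ g t 1≤g 1≤t refl refl = +-cancelʳ-< (160 * (g * g * u)) _ _ (begin-strict
      A + 160 * (g * g * u)        <⟨ +-monoʳ-< A small ⟩
      A + 8000 * (g * (g * g) * u) ≡⟨ e g t ⟩
      (4 * g + 1) * (t * (40 * g) * (t * (40 * g)) * (t * t * (40 * g))) + 160 * (g * g * u) ∎)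
      where
      open ≤-Reasoning
      u = t * t * (t * t)
      A = g * (t * t * (40 * g) * (4 * ((t * (40 * g) + t) * (t * (40 * g) + t))) + 27 * (t * (40 * g) * (t * (40 * g)) * (t * t)))
      e : ∀ g t → g * (t * t * (40 * g) * (4 * ((t * (40 * g) + t) * (t * (40 * g) + t))) + 27 * (t * (40 * g) * (t * (40 * g)) * (t * t))) +
        8000 * (g * (g * g) * (t * t * (t * t))) ≡
        (4 * g + 1) * (t * (40 * g) * (t * (40 * g)) * (t * t * (40 * g))) + 160 * (g * g * (t * t * (t * t)))
      e = solve-∀
      1≤u : 1 ≤ u
      1≤u = *-mono-≤ (*-mono-≤ 1≤t 1≤t) (*-mono-≤ 1≤t 1≤t)
      small : 160 * (g * g * u) < 8000 * (g * (g * g) * u)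
      small = begin-strict
        160 * (g * g * u)              <⟨ *-monoˡ-< (g * g * u) ⦃ >-nonZero (*-mono-≤ (*-mono-≤ 1≤g 1≤g) 1≤u) ⦄ {160} {8000} (≤ᵇ⇒≤ 161 8000 _) ⟩
        8000 * (g * g * u)             ≡⟨ cong (8000 *_) (*-identityˡ (g * g * u)) ⟨
        8000 * (1 * (g * g * u))       ≤⟨ *-monoʳ-≤ 8000 (*-monoˡ-≤ (g * g * u) 1≤g) ⟩
        8000 * (g * (g * g * u))       ≡⟨ cong (8000 *_) (*-assoc g (g * g) u) ⟨
        8000 * (g * (g * g) * u)       ∎

    module Contradiction (L : ℕ) (1≤L : 1 ≤ L) (E : ℕ → ℕ → ℕ → Fin L → Fin L → Fin L → Bool) (B : Role → ℕ → ℕ → Fin L) (b : ℕ)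
      (r t₀ i t₁ j m k l l′ : ℕ) (g G : ℕ) (1≤g : 1 ≤ g) (eG : G ≡ mass types * (40 * g)) (eb : b ≡ mass types * mass types * (40 * g))
      (v : Labels) (heavy : 4 * g + 1 ≤ 3 * total v) (w₀ : Type → ℕ) where
      open Degrees L 1≤L E
      open Links L 1≤L E B b
      open CodeTests L 1≤L E B b
      open LinkCounts L 1≤L E B b r t₀ i t₁ j m k l l′

      module _ (degrees : ∀ e s → label v e s * L² ≤ g * linkDegree e s)
        (lower : ∀ τ → w₀ τ * L ≤ G * typeCount left τ) (upper : ∀ ρ τ → G * typeCount ρ τ ≤ suc (w₀ τ) * L)
        (rare : ∀ c → bad c ≡ true → suc b * ⟨⟨⟨ weight (codeTests c) r t₀ i t₁ j m k l l′ ⟩⟩⟩ ≤ L³) where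

        private
          t = mass types
          D = G * G * (t * t)
          open ≤-Reasoning

          -- Rounded up, w τ · L / G bounds the number of vertices of type τ in all three parts of
          -- the triad; this adds only one unit per type to the total.
          w : Type → ℕ
          w τ = suc (w₀ τ)

          W = ∑ types w

          W≤ : W ≤ G + t
          W≤ = begin
            ∑ types (λ τ → 1 + w₀ τ)   ≡⟨ ∑-+ types (λ _ → 1) w₀ ⟩
            t + ∑ types w₀             ≤⟨ +-monoʳ-≤ t (*-cancelʳ-≤ _ _ L ⦃ >-nonZero 1≤L ⦄ w₀-sum) ⟩
            t + G                      ≡⟨ +-comm t G ⟩
            G + t                      ∎
            where
            w₀-sum : ∑ types w₀ * L ≤ G * L
            w₀-sum = begin
              ∑ types w₀ * L                                              ≡⟨ ∑-*ʳ types w₀ L ⟨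
              ∑ types (λ τ → w₀ τ * L)                                    ≤⟨ ∑-mono types lower ⟩
              ∑ types (λ τ → G * typeCount left τ)                        ≡⟨ ∑-* types G (typeCount left) ⟩
              G * ∑ types (typeCount left)                                ≡⟨ cong (G *_) (trans (∑-sumFin types L (λ τ u → ind (matchSlot left τ u)))
                                                                               (trans (∑-cong μ (matchSlot-total left)) mass-μ)) ⟩
              G * L                                                       ∎

          -- Either one of the two bits is absent, and the degrees in the link are small, or the
          -- code is bad and `rare` applies.
          missing : ∀ e s τ τ′ → allowed e s (has τ) (has τ′) ≡ false → b * linkCount e s τ τ′ ≤ L²
          missing e s τ τ′ n = cases (has τ (bit e s first)) (has τ′ (bit e s second)) refl refl
            where
            cases : ∀ x y → has τ (bit e s first) ≡ x → has τ′ (bit e s second) ≡ y → b * linkCount e s τ τ′ ≤ L²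
            cases false y     hx hy = linkCount-fst e s τ τ′ hx
            cases true  false hx hy = linkCount-snd e s τ τ′ hy
            cases true  true  hx hy = ≤-trans (m≤n+m _ (linkCount e s τ τ′)) (*-cancelʳ-≤ _ _ L ⦃ >-nonZero 1≤L ⦄ (begin
              suc b * linkCount e s τ τ′ * L     ≡⟨ *-assoc (suc b) (linkCount e s τ τ′) L ⟩
              suc b * (linkCount e s τ τ′ * L)   ≡⟨ cong (suc b *_) (weight-linkCount e s τ τ′) ⟨
              suc b * ⟨⟨⟨ weight (codeTests (e , s , τ , τ′)) r t₀ i t₁ j m k l l′ ⟩⟩⟩
                ≤⟨ rare (e , s , τ , τ′) (cong₂ _∧_ hx (cong₂ _∧_ hy (cong not n))) ⟩
              L³                                 ≡⟨ *-comm L L² ⟩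
              L² * L                             ∎))

          bounded : ∀ e s τ τ′ → G * G * (b * linkCount e s τ τ′) ≤ (b * (w τ * w τ′ * ind (allowed e s (has τ) (has τ′))) + G * G) * L²
          bounded e s τ τ′ = cases (allowed e s (has τ) (has τ′)) refl
            where
            cases : ∀ x → allowed e s (has τ) (has τ′) ≡ x → G * G * (b * linkCount e s τ τ′) ≤ (b * (w τ * w τ′ * ind x) + G * G) * L²
            cases false n = begin
              G * G * (b * linkCount e s τ τ′)                  ≤⟨ *-monoʳ-≤ (G * G) (missing e s τ τ′ n) ⟩
              G * G * L²                                        ≤⟨ *-monoˡ-≤ L² (m≤n+m (G * G) (b * (w τ * w τ′ * 0))) ⟩
              (b * (w τ * w τ′ * 0) + G * G) * L²               ∎
            cases true _ = begin
              G * G * (b * linkCount e s τ τ′)                  ≤⟨ *-monoʳ-≤ (G * G) (*-monoʳ-≤ b (linkCount-product e s τ τ′)) ⟩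
              G * G * (b * (typeCount (fstSlot s) τ * typeCount (sndSlot s) τ′))
                ≡⟨ e₁ G b (typeCount (fstSlot s) τ) (typeCount (sndSlot s) τ′) ⟩
              b * (G * typeCount (fstSlot s) τ * (G * typeCount (sndSlot s) τ′))
                ≤⟨ *-monoʳ-≤ b (*-mono-≤ (upper (fstSlot s) τ) (upper (sndSlot s) τ′)) ⟩
              b * (w τ * L * (w τ′ * L))                        ≡⟨ e₂ b (w τ) (w τ′) L ⟩
              b * (w τ * w τ′ * 1) * L²                         ≤⟨ *-monoˡ-≤ L² (m≤m+n (b * (w τ * w τ′ * 1)) (G * G)) ⟩
              (b * (w τ * w τ′ * 1) + G * G) * L²               ∎
              where
              e₁ : ∀ G b x y → G * G * (b * (x * y)) ≡ b * (G * x * (G * y))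
              e₁ = solve-∀
              e₂ : ∀ b x y L → b * (x * L * (y * L)) ≡ b * (x * y * 1) * (L * L)
              e₂ = solve-∀

          ∑∑ : (Type → Type → ℕ) → ℕ
          ∑∑ f = ∑ types (λ τ → ∑ types (f τ))

          ∑∑-mono : ∀ {f h} → (∀ τ τ′ → f τ τ′ ≤ h τ τ′) → ∑∑ f ≤ ∑∑ h
          ∑∑-mono p = ∑-mono types λ τ → ∑-mono types (p τ)
          ∑∑-cong : ∀ {f h} → (∀ τ τ′ → f τ τ′ ≡ h τ τ′) → ∑∑ f ≡ ∑∑ h
          ∑∑-cong p = ∑-cong types λ τ → ∑-cong types (p τ)
          ∑∑-* : ∀ c f → ∑∑ (λ τ τ′ → c * f τ τ′) ≡ c * ∑∑ f
          ∑∑-* c f = trans (∑-cong types λ τ → ∑-* types c (f τ)) (∑-* types c _)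
          ∑∑-affine : ∀ c f d → ∑∑ (λ τ τ′ → c * f τ τ′ + d) ≡ c * ∑∑ f + d * (t * t)
          ∑∑-affine c f d = trans (∑-cong types λ τ → trans (∑-+ types (λ τ′ → c * f τ τ′) (λ _ → d)) (cong₂ _+_ (∑-* types c (f τ)) (∑-const types d)))
            (trans (∑-+ types (λ τ → c * ∑ types (f τ)) (λ _ → d * t)) (cong₂ _+_ (∑-* types c _) (trans (∑-const types (d * t)) (*-assoc d t t))))

          share : Role → Role → ℕ
          share e s = ∑∑ (λ τ τ′ → w τ * w τ′ * ind (orient e s (has τ) (has τ′)))

          summed : ∀ (c : Type → Type → ℕ) (a : Type → Type → ℕ) →
            (∀ τ τ′ → G * G * (b * c τ τ′) ≤ (b * (w τ * w τ′ * a τ τ′) + G * G) * L²) →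
            G * G * (b * ∑∑ c) ≤ (b * ∑∑ (λ τ τ′ → w τ * w τ′ * a τ τ′) + D) * L²
          summed c a h = begin
            G * G * (b * ∑∑ c)                                           ≡⟨ *-assoc (G * G) b (∑∑ c) ⟨
            G * G * b * ∑∑ c                                             ≡⟨ ∑∑-* (G * G * b) c ⟨
            ∑∑ (λ τ τ′ → G * G * b * c τ τ′)
              ≤⟨ ∑∑-mono (λ τ τ′ → ≤-trans (≤-reflexive (*-assoc (G * G) b (c τ τ′))) (≤-trans (h τ τ′) (≤-reflexive (*-comm _ L²)))) ⟩
            ∑∑ (λ τ τ′ → L² * (b * (w τ * w τ′ * a τ τ′) + G * G))        ≡⟨ ∑∑-* L² _ ⟩
            L² * ∑∑ (λ τ τ′ → b * (w τ * w τ′ * a τ τ′) + G * G)          ≡⟨ cong (L² *_) (∑∑-affine b (λ τ τ′ → w τ * w τ′ * a τ τ′) (G * G)) ⟩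
            L² * (b * ∑∑ (λ τ τ′ → w τ * w τ′ * a τ τ′) + D)              ≡⟨ *-comm L² _ ⟩
            (b * ∑∑ (λ τ τ′ → w τ * w τ′ * a τ τ′) + D) * L²              ∎

          direct : ∀ e s → G * G * (b * linkDegree e s) ≤ (b * ∑∑ (λ τ τ′ → w τ * w τ′ * ind (allowed e s (has τ) (has τ′))) + D) * L²
          direct e s = subst (λ d → G * G * (b * d) ≤ (b * ∑∑ (λ τ τ′ → w τ * w τ′ * ind (allowed e s (has τ) (has τ′))) + D) * L²) (degree-split e s)
            (summed (linkCount e s) (λ τ τ′ → ind (allowed e s (has τ) (has τ′))) (bounded e s))

          flipped : ∀ e s → G * G * (b * linkDegree e s) ≤ (b * ∑∑ (λ τ τ′ → w τ * w τ′ * ind (allowed e s (has τ′) (has τ))) + D) * L²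
          flipped e s = subst (λ d → G * G * (b * d) ≤ (b * ∑∑ (λ τ τ′ → w τ * w τ′ * ind (allowed e s (has τ′) (has τ))) + D) * L²) (degree-split′ e s)
            (summed (λ τ τ′ → linkCount e s τ′ τ) (λ τ τ′ → ind (allowed e s (has τ′) (has τ))) (λ τ τ′ → ≤-trans (bounded e s τ′ τ)
              (≤-reflexive (cong (λ z → (b * (z * ind (allowed e s (has τ′) (has τ))) + G * G) * L²) (*-comm (w τ′) (w τ))))))

          degree-bound : ∀ e s → G * G * (b * linkDegree e s) ≤ (b * share e s + D) * L²
          degree-bound left  left  = flipped left left
          degree-bound left  mid   = direct left mid
          degree-bound left  right = direct left right
          degree-bound mid   left  = direct mid left
          degree-bound mid   mid   = direct mid mid
          degree-bound mid   right = flipped mid right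
          degree-bound right left  = flipped right left
          degree-bound right mid   = flipped right mid
          degree-bound right right = direct right right

          label-bound : ∀ e s → G * G * b * label v e s ≤ g * (b * share e s + D)
          label-bound e s = *-cancelʳ-≤ _ _ L² (begin
            G * G * b * label v e s * L²             ≡⟨ *-assoc (G * G * b) (label v e s) L² ⟩
            G * G * b * (label v e s * L²)           ≤⟨ *-monoʳ-≤ (G * G * b) (degrees e s) ⟩
            G * G * b * (g * linkDegree e s)         ≡⟨ e₁ (G * G) b g (linkDegree e s) ⟩
            g * (G * G * (b * linkDegree e s))       ≤⟨ *-monoʳ-≤ g (degree-bound e s) ⟩
            g * ((b * share e s + D) * L²)           ≡⟨ *-assoc g (b * share e s + D) L² ⟨
            g * (b * share e s + D) * L²             ∎)
            where
            e₁ : ∀ x b g d → x * b * (g * d) ≡ g * (x * (b * d))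
            e₁ = solve-∀

          shares : 3 * sum₉ share ≤ 4 * (W * W)
          shares = ≤-trans (≤-reflexive (cong (3 *_) (sym total-share))) (links-bound types has w)
            where
            total-share : ∑∑ (λ τ τ′ → w τ * w τ′ * links (has τ) (has τ′)) ≡ sum₉ share
            total-share = trans (∑∑-cong λ τ τ′ → trans (cong (w τ * w τ′ *_) (links-orient (has τ) (has τ′)))
                (sym (sum₉-* (w τ * w τ′) (λ e s → ind (orient e s (has τ) (has τ′))))))
              (trans (∑-cong types λ τ → ∑-sum₉ types (λ e s τ′ → w τ * w τ′ * ind (orient e s (has τ) (has τ′))))
                (∑-sum₉ types (λ e s τ → ∑ types (λ τ′ → w τ * w τ′ * ind (orient e s (has τ) (has τ′))))))

        contradiction : ⊥
        contradiction = <-irrefl refl (begin-strict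
          (4 * g + 1) * (G * G * b)                                 ≤⟨ *-monoˡ-≤ (G * G * b) heavy ⟩
          3 * total v * (G * G * b)                                 ≡⟨ e₁ (total v) (G * G * b) ⟩
          3 * (G * G * b * sum₉ (label v))                          ≡⟨ cong (3 *_) (sum₉-* (G * G * b) (label v)) ⟨
          3 * sum₉ (λ e s → G * G * b * label v e s)                ≤⟨ *-monoʳ-≤ 3 (sum₉-mono label-bound) ⟩
          3 * sum₉ (λ e s → g * (b * share e s + D))                ≡⟨ cong (3 *_) (trans (sum₉-* g (λ e s → b * share e s + D)) (cong (g *_) (sum₉-affine b share D))) ⟩
          3 * (g * (b * sum₉ share + 9 * D))                        ≡⟨ e₂ g b (sum₉ share) D ⟩
          g * (b * (3 * sum₉ share) + 27 * D)                       ≤⟨ *-monoʳ-≤ g (+-monoˡ-≤ (27 * D) (*-monoʳ-≤ b (≤-trans shares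
                                                                         (*-monoʳ-≤ 4 (*-mono-≤ W≤ W≤))))) ⟩
          g * (b * (4 * ((G + t) * (G + t))) + 27 * (G * G * (t * t))) <⟨ numeric₂ g t 1≤g 1≤types eG eb ⟩
          (4 * g + 1) * (G * G * b)                                 ∎)
          where
          e₁ : ∀ x y → 3 * x * y ≡ 3 * (y * x)
          e₁ = solve-∀
          e₂ : ∀ g b x d → 3 * (g * (b * x + 9 * d)) ≡ g * (b * (3 * x) + 27 * d)
          e₂ = solve-∀

    allTrue-or-allFalse : ∀ {C : Set} {P : C → Bool → Set} (cs : List C) → (∀ c → c ∈ cs → ∃[ a ] P c a) →
      (∃[ c ] P c true) ⊎ (∀ c → c ∈ cs → P c false)
    allTrue-or-allFalse []       h = inj₂ λ _ ()
    allTrue-or-allFalse (c ∷ cs) h with h c (here refl) | allTrue-or-allFalse cs (λ c′ c′∈ → h c′ (there c′∈))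
    ... | true  , p | _           = inj₁ (c , p)
    ... | false , p | inj₁ q      = inj₁ q
    ... | false , p | inj₂ q      = inj₂ λ { c′ (here refl) → p ; c′ (there c′∈) → q c′ c′∈ }

    module StageTwo (m : ℕ) (m≥1 : m ≥ 1) (g G b : ℕ) (1≤g : 1 ≤ g) (eG : G ≡ mass types * (40 * g)) (eb : b ≡ mass types * mass types * (40 * g)) where
      εp = Closing.εp m m≥1 b
      εx = extract (proj₁ εp) b
      -- The extra 9 guarantees a 9-tuple, on which badness of a frequent code, or else the
      -- contradiction, can be read off.
      εc = ramseyFamily {ℕ} Bool._≟_ (true ∷ false ∷ []) codes 9 (proj₁ εx + 9)
      εw = ramseyFamily {ℕ} _≟_ (upTo (suc G)) typeList 5 (proj₁ εc)

      module _ (L : ℕ) (1≤L : 1 ≤ L) (E : ℕ → ℕ → ℕ → Fin L → Fin L → Fin L → Bool) (S : List ℕ) (sorted : SortedI S)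
        (base : Degrees.Base L 1≤L E g S) where
        open Degrees L 1≤L E
        open Base base
        open Links L 1≤L E B b
        open CodeTests L 1≤L E B b
        open Cycle E

        private instance
          L≢0 : NonZero L
          L≢0 = >-nonZero 1≤L

        typeFloor : Type → List ℕ → ℕ
        typeFloor τ (tR ∷ p ∷ tM ∷ q ∷ tL ∷ []) = (G * ⟨ (λ v → ind (match τ tR p tM q tL v)) ⟩) / L
        typeFloor τ _ = 0

        typeFloor-∈ : ∀ τ Q → length Q ≡ 5 → typeFloor τ Q ∈ upTo (suc G)
        typeFloor-∈ τ (tR ∷ p ∷ tM ∷ q ∷ tL ∷ []) refl = ∈-upTo⁺ (s≤s (≤-trans (/-monoˡ-≤ L (*-monoʳ-≤ G
          (≤-trans (⟨≤⟩ (λ v → ind≤1 (match τ tR p tM q tL v))) (≤-reflexive (*-identityˡ L))))) (≤-reflexive (m*n/n≡m G L))))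

        -- Badness is part of the colour: a code homogeneous in colour `true` is thereby known to be
        -- bad, and a bad code homogeneous in colour `false` is rare.
        frequent : Code → List ℕ → Bool
        frequent c (r ∷ t₀ ∷ i ∷ t₁ ∷ j ∷ m ∷ k ∷ l ∷ l′ ∷ []) = bad c ∧ (L³ ≤ᵇ suc b * ⟨⟨⟨ weight (codeTests c) r t₀ i t₁ j m k l l′ ⟩⟩⟩)
        frequent c _ = false

        frequent-∈ : ∀ c Q → length Q ≡ 9 → frequent c Q ∈ true ∷ false ∷ []
        frequent-∈ c Q _ with frequent c Q
        ... | true  = here refl
        ... | false = there (here refl)

        FrequentOn : List ℕ → Code → Bool → Set
        FrequentOn W c a = ∀ Q → Q ⊆ W → length Q ≡ 9 → frequent c Q ≡ a

        module _ {W : List ℕ} (W⊆ : W ⊆ S) (long : length W ≡ proj₁ εx + 9) where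

          some : take 9 W ⊆ W × length (take 9 W) ≡ 9
          some = take-⊆ 9 W , length-take-≡ 9 W (≤-trans (m≤n+m 9 (proj₁ εx)) (≤-reflexive (sym long)))

          cycleFrom : ∀ c → FrequentOn W c true → TightCycle (2 + 3 * m) S
          cycleFrom c@(e , s , τ , τ′) h = finish (proj₂ εx L 1≤L (codeTests c) W (λ p → sorted (⊆-trans p W⊆))
              (≤-trans (m≤m+n (proj₁ εx) 9) (≤-reflexive (sym long))) (λ p → ≤ᵇ-true (proj₂ (∧-true {bad c} (h _ p refl)))))
            where
            isBad : ∀ Q → Q ⊆ W → length Q ≡ 9 → bad c ≡ true
            isBad Q@(r ∷ t₀ ∷ i ∷ t₁ ∷ j ∷ m ∷ k ∷ l ∷ l′ ∷ []) p refl = proj₁ (∧-true {bad c} (h Q p refl))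
            bad₁ : has τ (bit e s first) ≡ true × has τ′ (bit e s second) ∧ not (allowed e s (has τ) (has τ′)) ≡ true
            bad₁ = ∧-true {has τ (bit e s first)} (isBad (take 9 W) (proj₁ some) (proj₂ some))
            bad₂ : has τ′ (bit e s second) ≡ true × not (allowed e s (has τ) (has τ′)) ≡ true
            bad₂ = ∧-true {has τ′ (bit e s second)} (proj₂ bad₁)
            finish : ∃[ U ] (U ⊆ W × length U ≡ proj₁ εp × System (codeTests c) U) → TightCycle (2 + 3 * m) S
            finish (U , U⊆ , lU , sys) = TightCycle-⊆ U⊆S (Closing.fromBad m m≥1 b L 1≤L E B (λ p → sorted (⊆-trans p U⊆S))
                (≤-reflexive (sym lU)) (λ p → triangle (⊆-trans p U⊆S)) e s (has τ) (has τ′) (slotOf sys (fstSlot s)) (slotOf sys (sndSlot s))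
                (proj₁ bad₁) (proj₁ bad₂) (Bool.not-injective (proj₂ bad₂)) (code-link {e} {s} {τ} {τ′} sys) (code-fst {e} {s} {τ} {τ′} sys) (code-snd {e} {s} {τ} {τ′} sys))
              where
              U⊆S : U ⊆ S
              U⊆S = ⊆-trans U⊆ W⊆

          module _ (homogeneous : ∀ τ → τ ∈ typeList → ∃[ a ] ∀ Q → Q ⊆ W → length Q ≡ 5 → typeFloor τ Q ≡ a)
            (rare : ∀ c → c ∈ codes → FrequentOn W c false) where

            impossible : ∀ Q → Q ⊆ W → length Q ≡ 9 → ⊥
            impossible (r ∷ t₀ ∷ i ∷ t₁ ∷ j ∷ m ∷ k ∷ l ∷ l′ ∷ []) p refl =
              Contradiction.contradiction L 1≤L E B b r t₀ i t₁ j m k l l′ g G 1≤g eG eb labels heavy w₀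
                (λ e s → degree e s (⊆-trans sijk W⊆)) (λ τ → proj₁ (bounds left τ)) (λ ρ τ → proj₂ (bounds ρ τ)) infrequent
              where
              open LinkCounts L 1≤L E B b r t₀ i t₁ j m k l l′
              sα : t₀ ∷ i ∷ t₁ ∷ j ∷ k ∷ [] ⊆ W
              sα = ⊆-trans (_ ∷ʳ refl ∷ refl ∷ refl ∷ refl ∷ _ ∷ʳ refl ∷ _ ∷ʳ _ ∷ʳ []) p
              sβ : r ∷ i ∷ j ∷ k ∷ l ∷ [] ⊆ W
              sβ = ⊆-trans (refl ∷ _ ∷ʳ refl ∷ _ ∷ʳ refl ∷ _ ∷ʳ refl ∷ refl ∷ _ ∷ʳ []) p
              sγ : i ∷ j ∷ m ∷ k ∷ l′ ∷ [] ⊆ W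
              sγ = ⊆-trans (_ ∷ʳ _ ∷ʳ refl ∷ _ ∷ʳ refl ∷ refl ∷ refl ∷ _ ∷ʳ refl ∷ []) p
              sijk : i ∷ j ∷ k ∷ [] ⊆ W
              sijk = ⊆-trans (refl ∷ refl ∷ _ ∷ʳ refl ∷ _ ∷ʳ []) sγ
              w₀ : Type → ℕ
              w₀ τ = proj₁ (homogeneous τ (∈-typeList τ))
              bounds : ∀ ρ τ → w₀ τ * L ≤ G * typeCount ρ τ × G * typeCount ρ τ ≤ suc (w₀ τ) * L
              bounds left  τ = floor-bounds G (typeCount left τ) L (proj₂ (homogeneous τ (∈-typeList τ)) _ sα refl)
              bounds mid   τ = floor-bounds G (typeCount mid τ) L (proj₂ (homogeneous τ (∈-typeList τ)) _ sβ refl)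
              bounds right τ = floor-bounds G (typeCount right τ) L (proj₂ (homogeneous τ (∈-typeList τ)) _ sγ refl)
              infrequent : ∀ c → bad c ≡ true → suc b * ⟨⟨⟨ weight (codeTests c) r t₀ i t₁ j m k l l′ ⟩⟩⟩ ≤ L³
              infrequent c hb = <⇒≤ (≤ᵇ-false (trans (cong (_∧ (L³ ≤ᵇ suc b * ⟨⟨⟨ weight (codeTests c) r t₀ i t₁ j m k l l′ ⟩⟩⟩)) (sym hb))
                (rare c (∈-codes c) _ p refl)))

          dichotomy : (∀ τ → τ ∈ typeList → ∃[ a ] ∀ Q → Q ⊆ W → length Q ≡ 5 → typeFloor τ Q ≡ a) →
            (∃[ c ] FrequentOn W c true) ⊎ (∀ c → c ∈ codes → FrequentOn W c false) → TightCycle (2 + 3 * m) S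
          dichotomy hom (inj₁ (c , h)) = cycleFrom c h
          dichotomy hom (inj₂ h)       = ⊥-elim (impossible hom h (take 9 W) (proj₁ some) (proj₂ some))

        run : proj₁ εw ≤ length S → TightCycle (2 + 3 * m) S
        run long = step₁ (proj₂ εw S long typeFloor typeFloor-∈)
          where
          step₂ : ∀ {W} → W ⊆ S → (∀ τ → τ ∈ typeList → ∃[ a ] ∀ Q → Q ⊆ W → length Q ≡ 5 → typeFloor τ Q ≡ a) →
            ∃[ U ] (U ⊆ W × length U ≡ proj₁ εx + 9 × ∀ c → c ∈ codes → ∃[ a ] FrequentOn U c a) → TightCycle (2 + 3 * m) S
          step₂ W⊆ hom (U , U⊆ , lU , h) = dichotomy (⊆-trans U⊆ W⊆) lU
            (λ τ τ∈ → proj₁ (hom τ τ∈) , λ Q p → proj₂ (hom τ τ∈) Q (⊆-trans p U⊆))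
            (allTrue-or-allFalse {P = FrequentOn U} codes h)
          step₁ : ∃[ W ] (W ⊆ S × length W ≡ proj₁ εc × ∀ τ → τ ∈ typeList → ∃[ a ] ∀ Q → Q ⊆ W → length Q ≡ 5 → typeFloor τ Q ≡ a) →
            TightCycle (2 + 3 * m) S
          step₁ (W , W⊆ , lW , hom) = step₂ W⊆ hom (proj₂ εc W (≤-reflexive (sym lW)) frequent frequent-∈)

    abstract
      cycleInBase : ∀ m → m ≥ 1 → ∀ g → 1 ≤ g → ∃[ N ] ∀ L (1≤L : 1 ≤ L) E S → SortedI S → Degrees.Base L 1≤L E g S → N ≤ length S →
        Cycle.TightCycle E (2 + 3 * m) S
      cycleInBase m m≥1 g 1≤g = sized _ _ refl refl
        where
        sized : ∀ G b → G ≡ mass types * (40 * g) → b ≡ mass types * mass types * (40 * g) → ∃[ N ] ∀ L (1≤L : 1 ≤ L) E S → SortedI S →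
          Degrees.Base L 1≤L E g S → N ≤ length S → Cycle.TightCycle E (2 + 3 * m) S
        sized G b eG eb = proj₁ (StageTwo.εw m m≥1 g G b 1≤g eG eb) , StageTwo.run m m≥1 g G b 1≤g eG eb

  open LinkDensity

  -- From partitioned hypergraphs to equal parts, and back to an embedding.

  module Hypergraphs where
    open import Data.Nat.Divisibility using (_∣_; ∣-trans; m≤n⇒m!∣n!; m∣m*n)
    open import Data.Integer as ℤ using (+_; -[1+_])
    import Data.Integer.Properties as ℤ
    open import Data.Rational as ℚ using (ℚ; mkℚ; 0ℚ)
    import Data.Rational.Properties as ℚ
    open import Data.Rational.Unnormalised as ℚᵘ using (mkℚᵘ)
    import Data.Rational.Unnormalised.Properties as ℚᵘ
    import Data.List.Relation.Unary.All.Properties as All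
    open import Data.List.Relation.Unary.AllPairs.Properties using (applyUpTo⁺₁)
    open import Function.Bundles using (Equivalence)
    open Measure
    open Indices using (SortedI)

    denseCycle : ∀ m → m ≥ 1 → ∀ q → 1 ≤ q → ∃[ N ] ∀ L (1≤L : 1 ≤ L) E (let open Degrees L 1≤L E) W → SortedI W → N ≤ length W →
      (∀ {i j k} → i ∷ j ∷ k ∷ [] ⊆ W → (4 * q + 1) * L³ ≤ 27 * q * dens i j k) → Cycle.TightCycle E (2 + 3 * m) W
    denseCycle m m≥1 q 1≤q = proj₁ start , λ L 1≤L E W sorted long dense → finish L 1≤L E sorted (proj₂ start L 1≤L E W sorted long dense)
      where
      1≤60q : 1 ≤ 60 * q
      1≤60q = *-mono-≤ {1} {60} (s≤s z≤n) 1≤q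
      ends = cycleInBase m m≥1 (60 * q) 1≤60q
      start = baseSystem (proj₁ ends) q 1≤q
      finish : ∀ L (1≤L : 1 ≤ L) E {W} → SortedI W → ∃[ S ] (S ⊆ W × length S ≡ proj₁ ends × Degrees.Base L 1≤L E (60 * q) S) →
        Cycle.TightCycle E (2 + 3 * m) W
      finish L 1≤L E sorted (S , S⊆ , lS , b) = Cycle.TightCycle-⊆ E S⊆ (proj₂ ends L 1≤L E S (λ s → sorted (⊆-trans s S⊆)) b (≤-reflexive (sym lS)))

    -- Here q is the denominator of δ. The numerator is at least 1, so δ ≥ 1/q ≥ 1/27q, and 4/27 +
    -- 1/27q equals (4q + 1)/27q.
    density-threshold : ∀ δ → 0ℚ ℚ.< δ → ∃[ q ] (1 ≤ q × ∀ e s → 1 ≤ s → (+ 4 ℚ./ 27) ℚ.+ δ ℚ.≤ e ÷ s → (4 * q + 1) * s ≤ 27 * q * e)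
    density-threshold (mkℚ (+ zero) d c)  (ℚ.*<* (ℤ.+<+ ()))
    density-threshold (mkℚ -[1+ p ] d c)  (ℚ.*<* ())
    density-threshold δ@(mkℚ (+ suc p) d c) _ = suc d , s≤s z≤n , λ { e (suc n) _ h → bound e n h }
      where
      bound : ∀ e n → (+ 4 ℚ./ 27) ℚ.+ δ ℚ.≤ (+ e) ℚ./ suc n → (4 * suc d + 1) * suc n ≤ 27 * suc d * e
      bound e n h = begin
        (4 * suc d + 1) * suc n                 ≤⟨ *-monoˡ-≤ (suc n) (+-monoʳ-≤ (4 * suc d) (s≤s z≤n)) ⟩
        (4 * suc d + suc p * 27) * suc n        ≤⟨ ℤ.drop‿+≤+ (subst₂ ℤ._≤_ eqˡ eqʳ (ℚᵘ.drop-*≤* unnormalised)) ⟩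
        e * (27 * suc d)                        ≡⟨ *-comm e (27 * suc d) ⟩
        27 * suc d * e                          ∎
        where
        open ≤-Reasoning
        unnormalised : mkℚᵘ (+ 4) 26 ℚᵘ.+ mkℚᵘ (+ suc p) d ℚᵘ.≤ mkℚᵘ (+ e) n
        unnormalised = ℚᵘ.≤-respˡ-≃ (ℚ.toℚᵘ-homo-+ (+ 4 ℚ./ 27) δ) (ℚᵘ.≤-respʳ-≃ (ℚ.toℚᵘ-fromℚᵘ (mkℚᵘ (+ e) n)) (ℚ.toℚᵘ-mono-≤ h))
        eqˡ : (+ 4 ℤ.* + suc d ℤ.+ + suc p ℤ.* + 27) ℤ.* + suc n ≡ + ((4 * suc d + suc p * 27) * suc n)
        eqˡ = sym (trans (ℤ.pos-* (4 * suc d + suc p * 27) (suc n)) (cong (ℤ._* + suc n)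
          (trans (ℤ.pos-+ (4 * suc d) (suc p * 27)) (cong₂ ℤ._+_ (ℤ.pos-* 4 (suc d)) (ℤ.pos-* (suc p) 27)))))
        eqʳ : + e ℤ.* + (27 * suc d) ≡ + (e * (27 * suc d))
        eqʳ = sym (ℤ.pos-* e (27 * suc d))

    sumList-copies : ∀ {A : Set} c (xs : List A) f → sumList (concat (replicate c xs)) f ≡ c * sumList xs f
    sumList-copies zero    xs f = refl
    sumList-copies (suc c) xs f = trans (sumList-++ xs _ f) (cong (_+_ (sumList xs f)) (sumList-copies c xs f))

    sumList-filterᵇ : ∀ {A : Set} (p : A → Bool) xs f → sumList (filterᵇ p xs) f ≡ sumList xs (λ x → ind (p x) * f x)
    sumList-filterᵇ p []       f = refl
    sumList-filterᵇ p (x ∷ xs) f with p x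
    ... | true  = cong₂ _+_ (sym (+-identityʳ (f x))) (sumList-filterᵇ p xs f)
    ... | false = sumList-filterᵇ p xs f

    sumList-tabulate : ∀ {A : Set} n (g : Fin n → A) f → sumList (tabulate g) f ≡ sumFin n (f ∘ g)
    sumList-tabulate zero    g f = refl
    sumList-tabulate (suc n) g f = cong (_+_ (f (g zero))) (sumList-tabulate n (g ∘ suc) f)

    sumList-length : ∀ {A : Set} (xs : List A) → sumList xs (λ _ → 1) ≡ length xs
    sumList-length xs = trans (sumList-const xs 1) (*-identityʳ _)

    ∈-copies : ∀ {A : Set} c (xs : List A) {x} → x ∈ concat (replicate c xs) → x ∈ xs
    ∈-copies (suc c) xs x∈ with ∈-++⁻ xs x∈
    ... | inj₁ p = p
    ... | inj₂ p = ∈-copies c xs p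

    pick : ∀ {A : Set} → A → List A → ℕ → A
    pick d []       n       = d
    pick d (x ∷ xs) zero    = x
    pick d (x ∷ xs) (suc n) = pick d xs n

    pick-∈ : ∀ {A : Set} (d : A) xs {n} → n < length xs → pick d xs n ∈ xs
    pick-∈ d (x ∷ xs) {zero}  h       = here refl
    pick-∈ d (x ∷ xs) {suc n} (s≤s h) = there (pick-∈ d xs h)

    sumFin-pick : ∀ {A : Set} (d : A) xs f {L} → length xs ≡ L → sumFin L (λ a → f (pick d xs (toℕ a))) ≡ sumList xs f
    sumFin-pick d []       f refl = refl
    sumFin-pick d (x ∷ xs) f refl = cong (_+_ (f x)) (sumFin-pick d xs f refl)

    term≤sumFin : ∀ n (f : Fin n → ℕ) x → f x ≤ sumFin n f
    term≤sumFin (suc n) f zero    = m≤m+n _ _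
    term≤sumFin (suc n) f (suc x) = ≤-trans (term≤sumFin n (f ∘ suc) x) (m≤n+m _ _)

    ∣! : ∀ {s n} → 1 ≤ s → s ≤ n → s ∣ n !
    ∣! {suc s} _ h = ∣-trans (m∣m*n (s !)) (m≤n⇒m!∣n! h)

    quotient : ℕ → ℕ → ℕ
    quotient m zero    = 0
    quotient m (suc n) = m / suc n

    quotient-* : ∀ {m n} → 1 ≤ n → n ∣ m → quotient m n * n ≡ m
    quotient-* {m} {suc n} _ d = m/n*n≡m d

    AllPairs-⊆ : ∀ {A : Set} {R : A → A → Set} {i j xs} → AllPairs R xs → i ∷ j ∷ [] ⊆ xs → R i j
    AllPairs-⊆ (_ ∷ ps) (_ ∷ʳ s)   = AllPairs-⊆ ps s
    AllPairs-⊆ (p ∷ ps) (refl ∷ s) = All.lookup p (lookup s (here refl))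

    upTo-sorted : ∀ n {i j} → i ∷ j ∷ [] ⊆ upTo n → i < j
    upTo-sorted n = AllPairs-⊆ (applyUpTo⁺₁ id n (λ i<j _ → i<j))

    -- Repeating each vertex of V_pq (M ! / |V_pq|) times keeps the triad densities and makes all parts equally large.
    module BlowUp {n : ℕ} (H : PartitionedHypergraph (2 + n)) where
      open PartitionedHypergraph H

      -- Part sizes lie between 1 and M, so M! is a common multiple of them.
      L : ℕ
      L = M !

      x₀ : Fin M
      x₀ = proj₁ (nonempty zero (suc zero) (s≤s z≤n))

      inPart : Fin (2 + n) → Fin (2 + n) → Fin M → Bool
      inPart p q x = part x ≟ₚ (p , q)

      inPart-true : ∀ {p q x} → T (inPart p q x) → part x ≡ (p , q)
      inPart-true {p} {q} {x} h = toWitness {a? = ≡-dec Fin._≟_ Fin._≟_ (part x) (p , q)} h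

      members : Fin (2 + n) → Fin (2 + n) → List (Fin M)
      members p q = filterᵇ (inPart p q) (allFin M)

      sum-members : ∀ p q f → sumList (members p q) f ≡ sumFin M (λ x → ind (inPart p q x) * f x)
      sum-members p q f = trans (sumList-filterᵇ (inPart p q) (allFin M) f) (sumList-tabulate M id _)

      length-members : ∀ p q → length (members p q) ≡ partSize H p q
      length-members p q = trans (sym (sumList-length (members p q))) (trans (sum-members p q (λ _ → 1)) (∑-cong (uniform M) λ x → *-identityʳ _))

      1≤partSize : ∀ {p q} → p Fin.< q → 1 ≤ partSize H p q
      1≤partSize {p} {q} p<q = ≤-trans (≤-reflexive (sym (cong ind inside))) (term≤sumFin M (ind ∘ inPart p q) x)
        where
        x = proj₁ (nonempty p q p<q)
        inside : inPart p q x ≡ true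
        inside = Equivalence.to Bool.T-≡ (fromWitness {a? = ≡-dec Fin._≟_ Fin._≟_ (part x) (p , q)} (proj₂ (nonempty p q p<q)))

      partSize≤M : ∀ p q → partSize H p q ≤ M
      partSize≤M p q = ≤-trans (sumFin-mono M (λ x → ind≤1 (inPart p q x))) (≤-reflexive (sumFin-1 M))

      ratio : Fin (2 + n) → Fin (2 + n) → ℕ
      ratio p q = quotient L (partSize H p q)

      ratio-size : ∀ {p q} → p Fin.< q → ratio p q * partSize H p q ≡ L
      ratio-size {p} {q} p<q = quotient-* (1≤partSize p<q) (∣! (1≤partSize p<q) (partSize≤M p q))

      copies : Fin (2 + n) → Fin (2 + n) → List (Fin M)
      copies p q = concat (replicate (ratio p q) (members p q))

      length-copies : ∀ {p q} → p Fin.< q → length (copies p q) ≡ L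
      length-copies {p} {q} p<q = trans (sym (sumList-length (copies p q))) (trans (sumList-copies (ratio p q) (members p q) (λ _ → 1))
        (trans (cong (ratio p q *_) (trans (sumList-length (members p q)) (length-members p q))) (ratio-size p<q)))

      vertex : Fin (2 + n) → Fin (2 + n) → Fin L → Fin M
      vertex p q a = pick x₀ (copies p q) (toℕ a)

      vertex-part : ∀ {p q} → p Fin.< q → ∀ a → part (vertex p q a) ≡ (p , q)
      vertex-part {p} {q} p<q a = inPart-true {p} {q} (proj₂ (∈-filter⁻ (T? ∘ inPart p q) {xs = allFin M} (∈-copies (ratio p q) (members p q)
        (pick-∈ x₀ (copies p q) (≤-trans (Fin.toℕ<n a) (≤-reflexive (sym (length-copies p<q))))))))

      sum-vertex : ∀ {p q} → p Fin.< q → ∀ f → sumFin L (f ∘ vertex p q) ≡ ratio p q * sumFin M (λ x → ind (inPart p q x) * f x)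
      sum-vertex {p} {q} p<q f = trans (sumFin-pick x₀ (copies p q) f (length-copies p<q))
        (trans (sumList-copies (ratio p q) (members p q) f) (cong (ratio p q *_) (sum-members p q f)))

      -- Reduction modulo 2 + n merely makes indexing by ℕ total; on indices below 2 + n it is the
      -- identity and preserves order.
      clip : ℕ → Fin (2 + n)
      clip i = i mod (2 + n)

      toℕ-clip : ∀ {i} → i < 2 + n → toℕ (clip i) ≡ i
      toℕ-clip h = trans (Fin.toℕ-fromℕ< _) (m<n⇒m%n≡m h)

      clip-mono : ∀ {i j} → i < j → j < 2 + n → clip i Fin.< clip j
      clip-mono i<j j< = subst₂ _<_ (sym (toℕ-clip (<-trans i<j j<))) (sym (toℕ-clip j<)) i<j

      E : ℕ → ℕ → ℕ → Fin L → Fin L → Fin L → Bool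
      E i j k a b c = edge (vertex (clip i) (clip j) a) (vertex (clip i) (clip k) b) (vertex (clip j) (clip k) c)

      sum-edges : ∀ {p q r} → p Fin.< q → p Fin.< r → q Fin.< r →
        sumFin L (λ a → sumFin L (λ b → sumFin L (λ c → ind (edge (vertex p q a) (vertex p r b) (vertex q r c))))) ≡
        ratio p q * (ratio p r * (ratio q r * triadEdges H p q r))
      sum-edges {p} {q} {r} p<q p<r q<r = begin
        sumFin L (λ a → sumFin L (λ b → sumFin L (λ c → ind (edge (vertex p q a) (vertex p r b) (vertex q r c)))))
          ≡⟨ ∑-cong (uniform L) (λ a → trans (∑-cong (uniform L) λ b → sum-vertex q<r (λ z → ind (edge (vertex p q a) (vertex p r b) z)))
               (sum-vertex p<r (λ y → ratio q r * Z (vertex p q a) y))) ⟩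
        sumFin L (λ a → ratio p r * Y (vertex p q a))
          ≡⟨ sum-vertex p<q (λ x → ratio p r * Y x) ⟩
        ratio p q * sumFin M (λ x → ind (inPart p q x) * (ratio p r * Y x))
          ≡⟨ cong (ratio p q *_) (trans (∑-cong (uniform M) λ x → trans (cong (λ y → ind (inPart p q x) * (ratio p r * y)) (Y-eq x))
               (swap (ind (inPart p q x)) (ratio p r) (ratio q r) _)) (trans (∑-* (uniform M) (ratio p r) _) (cong (ratio p r *_) (∑-* (uniform M) (ratio q r) _)))) ⟩
        ratio p q * (ratio p r * (ratio q r * sumFin M (λ x → ind (inPart p q x) * sumFin M (λ y → ind (inPart p r y) * Z x y))))
          ≡⟨ cong (λ s → ratio p q * (ratio p r * (ratio q r * s))) (∑-cong (uniform M) λ x → trans (sym (∑-* (uniform M) (ind (inPart p q x)) _))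
               (∑-cong (uniform M) λ y → trans (cong (ind (inPart p q x) *_) (sym (∑-* (uniform M) (ind (inPart p r y)) _))) (trans (sym (∑-* (uniform M) (ind (inPart p q x)) _))
                 (∑-cong (uniform M) λ z → sym (collect (inPart p q x) (inPart p r y) (inPart q r z) (edge x y z)))))) ⟩
        ratio p q * (ratio p r * (ratio q r * triadEdges H p q r)) ∎
        where
        open ≡-Reasoning
        Z : Fin M → Fin M → ℕ
        Z x y = sumFin M (λ z → ind (inPart q r z) * ind (edge x y z))
        Y : Fin M → ℕ
        Y x = sumFin M (λ y → ind (inPart p r y) * (ratio q r * Z x y))
        swap : ∀ i s t u → i * (s * (t * u)) ≡ s * (t * (i * u))
        swap = solve-∀
        swap′ : ∀ i t u → i * (t * u) ≡ t * (i * u)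
        swap′ = solve-∀
        Y-eq : ∀ x → Y x ≡ ratio q r * sumFin M (λ y → ind (inPart p r y) * Z x y)
        Y-eq x = trans (∑-cong (uniform M) λ y → swap′ (ind (inPart p r y)) (ratio q r) (Z x y)) (∑-* (uniform M) (ratio q r) _)
        collect : ∀ a b c d → ind (a ∧ (b ∧ (c ∧ d))) ≡ ind a * (ind b * (ind c * ind d))
        collect a b c d = trans (ind-∧ a _) (cong (ind a *_) (trans (ind-∧ b _) (cong (ind b *_) (ind-∧ c d))))

      dense : ∀ {Q q p r s} → p Fin.< r → p Fin.< s → r Fin.< s →
        Q * (partSize H p r * partSize H p s * partSize H r s) ≤ q * triadEdges H p r s →
        Q * (L * (L * L)) ≤ q * sumFin L (λ a → sumFin L (λ b → sumFin L (λ c → ind (edge (vertex p r a) (vertex p s b) (vertex r s c)))))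
      dense {Q} {q} {p} {r} {s} p<r p<s r<s h = begin
        Q * (L * (L * L))
          ≡⟨ cong (Q *_) (cong₂ _*_ (sym (ratio-size p<r)) (cong₂ _*_ (sym (ratio-size p<s)) (sym (ratio-size r<s)))) ⟩
        Q * (ratio p r * partSize H p r * (ratio p s * partSize H p s * (ratio r s * partSize H r s)))
          ≡⟨ e₁ Q (ratio p r) (partSize H p r) (ratio p s) (partSize H p s) (ratio r s) (partSize H r s) ⟩
        ratio p r * (ratio p s * (ratio r s * (Q * (partSize H p r * partSize H p s * partSize H r s))))
          ≤⟨ *-monoʳ-≤ (ratio p r) (*-monoʳ-≤ (ratio p s) (*-monoʳ-≤ (ratio r s) h)) ⟩
        ratio p r * (ratio p s * (ratio r s * (q * triadEdges H p r s)))
          ≡⟨ e₂ (ratio p r) (ratio p s) (ratio r s) q (triadEdges H p r s) ⟩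
        q * (ratio p r * (ratio p s * (ratio r s * triadEdges H p r s)))
          ≡⟨ cong (q *_) (sum-edges p<r p<s r<s) ⟨
        q * sumFin L (λ a → sumFin L (λ b → sumFin L (λ c → ind (edge (vertex p r a) (vertex p s b) (vertex r s c))))) ∎
        where
        open ≤-Reasoning
        e₁ : ∀ Q a x b y c z → Q * (a * x * (b * y * (c * z))) ≡ a * (b * (c * (Q * (x * y * z))))
        e₁ = solve-∀
        e₂ : ∀ a b c q t → a * (b * (c * (q * t))) ≡ q * (a * (b * (c * t)))
        e₂ = solve-∀

      module _ {ℓ : ℕ} .⦃ _ : NonZero ℓ ⦄ (t : Cycle.TightCycle E ℓ (upTo (2 + n))) where
        open Cycle.TightCycle t

        private
          a< : ∀ u → a u < 2 + n
          a< u = ∈-upTo⁻ (a∈ u)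

          A : Fin ℓ → Fin (2 + n)
          A u = clip (a u)

          A-injective : ∀ {u w} → A u ≡ A w → u ≡ w
          A-injective {u} {w} eq = a-inj (trans (sym (toℕ-clip (a< u))) (trans (cong toℕ eq) (toℕ-clip (a< w))))

          V : Fin ℓ → Fin ℓ → Fin M
          V u w = if a u <ᵇ a w then vertex (A u) (A w) (c u w) else vertex (A w) (A u) (c u w)

          V-< : ∀ {u w} → a u < a w → V u w ≡ vertex (A u) (A w) (c u w)
          V-< h rewrite <⇒<ᵇ-true h = refl

          V-> : ∀ {u w} → a w < a u → V u w ≡ vertex (A w) (A u) (c u w)
          V-> {u} {w} h rewrite ≥⇒<ᵇ-false {a u} {a w} (<⇒≤ h) = refl

          V-sym : ∀ {u w} → a u ≢ a w → V u w ≡ V w u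
          V-sym {u} {w} ne with <-cmp (a u) (a w)
          ... | tri< h _ _ = trans (V-< h) (trans (cong (vertex (A u) (A w)) (c-sym u w)) (sym (V-> h)))
          ... | tri≈ _ e _ = ⊥-elim (ne e)
          ... | tri> _ _ h = trans (V-> h) (trans (cong (vertex (A w) (A u)) (c-sym u w)) (sym (V-< h)))

          V-part : ∀ u w → u Fin.< w → part (V u w) ≡ (A u , A w) ⊎ part (V u w) ≡ (A w , A u)
          V-part u w u<w with <-cmp (a u) (a w)
          ... | tri< h _ _ = inj₁ (trans (cong part (V-< h)) (vertex-part (clip-mono h (a< w)) (c u w)))
          ... | tri≈ _ e _ = ⊥-elim (<-irrefl (cong toℕ (a-inj e)) u<w)
          ... | tri> _ _ h = inj₂ (trans (cong part (V-> h)) (vertex-part (clip-mono h (a< u)) (c u w)))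

          VV : Fin ℓ → Fin ℓ → Fin M
          VV u w = if ⌊ u Fin.<? w ⌋ then V u w else V w u

          VV≡V : ∀ {u w} → a u ≢ a w → VV u w ≡ V u w
          VV≡V {u} {w} ne with u Fin.<? w
          ... | yes _ = refl
          ... | no  _ = sym (V-sym ne)

          VV-sym : ∀ {u w} → a u ≢ a w → VV u w ≡ VV w u
          VV-sym ne = trans (VV≡V ne) (trans (V-sym ne) (sym (VV≡V (ne ∘ sym))))

          Joined : Fin ℓ → Fin ℓ → Fin ℓ → Set
          Joined x y z = edge (VV x y) (VV x z) (VV y z) ≡ true

          edge-joined : ∀ {x y z} → Edge x y z → Joined x y z
          edge-joined {x} {y} {z} (xy , yz , h) = trans (cong₃ (trans (VV≡V (<⇒≢ xy)) (V-< xy))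
              (trans (VV≡V (<⇒≢ (<-trans xy yz))) (V-< (<-trans xy yz))) (trans (VV≡V (<⇒≢ yz)) (V-< yz))) h
            where
            cong₃ : ∀ {p p′ q q′ r r′} → p ≡ p′ → q ≡ q′ → r ≡ r′ → edge p q r ≡ edge p′ q′ r′
            cong₃ refl refl refl = refl

          swap₁ : ∀ x y z → a x ≢ a y → Joined x y z → Joined y x z
          swap₁ x y z ne h = trans (cong (λ v → edge v (VV y z) (VV x z)) (VV-sym (ne ∘ sym))) (trans (edgeSym₂ (VV x y) (VV y z) (VV x z)) h)

          swap₂ : ∀ x y z → a y ≢ a z → Joined x y z → Joined x z y
          swap₂ x y z ne h = trans (cong (edge (VV x z) (VV x y)) (VV-sym (ne ∘ sym))) (trans (edgeSym₁ (VV x z) (VV x y) (VV y z)) h)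

          unordered : ∀ x y z → Edge x y z ⊎ Edge x z y ⊎ Edge y x z ⊎ Edge y z x ⊎ Edge z x y ⊎ Edge z y x → Joined x y z
          unordered x y z (inj₁ e) = edge-joined e
          unordered x y z (inj₂ (inj₁ e@(_ , zy , _))) = swap₂ x z y (<⇒≢ zy) (edge-joined e)
          unordered x y z (inj₂ (inj₂ (inj₁ e@(yx , _ , _)))) = swap₁ y x z (<⇒≢ yx) (edge-joined e)
          unordered x y z (inj₂ (inj₂ (inj₂ (inj₁ e@(yz , zx , _))))) = swap₁ y x z (<⇒≢ (<-trans yz zx)) (swap₂ y z x (<⇒≢ zx) (edge-joined e))
          unordered x y z (inj₂ (inj₂ (inj₂ (inj₂ (inj₁ e@(zx , xy , _)))))) = swap₂ x z y (<⇒≢ (<-trans zx xy)) (swap₁ z x y (<⇒≢ zx) (edge-joined e))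
          unordered x y z (inj₂ (inj₂ (inj₂ (inj₂ (inj₂ e@(zy , yx , _)))))) =
            swap₁ y x z (<⇒≢ yx) (swap₂ y z x (<⇒≢ (<-trans zy yx)) (swap₁ z y x (<⇒≢ zy) (edge-joined e)))

        embeds : Embeds H ℓ (tightCycleEdges ℓ)
        embeds = A , A-injective , V , V-part , All.tabulate⁺ (λ u → unordered u _ _ (edges u))

    denseHypergraphs-embed : ∀ m → m ≥ 1 → ∀ δ → 0ℚ ℚ.< δ → ∃[ N ] ((H : PartitionedHypergraph N) → DensityAtLeast H ((+ 4 ℚ./ 27) ℚ.+ δ) →
      Embeds H (2 + 3 * m) (tightCycleEdges (2 + 3 * m)))
    denseHypergraphs-embed m m≥1 δ δ>0 with density-threshold δ δ>0
    ... | q , 1≤q , threshold with denseCycle m m≥1 q 1≤q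
    -- Two indices more than required ensure that a part, and in it the default vertex `x₀`, exists.
    ...   | n , cycles = 2 + n , embedding
      where
      embedding : (H : PartitionedHypergraph (2 + n)) → DensityAtLeast H ((+ 4 ℚ./ 27) ℚ.+ δ) → Embeds H (2 + 3 * m) (tightCycleEdges (2 + 3 * m))
      embedding H dense-H = embeds (cycles L (1≤n! M) E (upTo (2 + n)) (λ s → <⇒<ᵇ-true (upTo-sorted (2 + n) s) , ≥⇒<ᵇ-false (<⇒≤ (upTo-sorted (2 + n) s)))
          (≤-trans (m≤n+m n 2) (≤-reflexive (sym (length-upTo (2 + n))))) triads)
        where
        open PartitionedHypergraph H using (M)
        open BlowUp H
        triads : ∀ {i j k} → i ∷ j ∷ k ∷ [] ⊆ upTo (2 + n) → (4 * q + 1) * (L * (L * L)) ≤ 27 * q * Degrees.dens L (1≤n! M) E i j k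
        triads {i} {j} {k} s = dense {4 * q + 1} {27 * q} {clip i} {clip j} {clip k} ij ik jk (threshold _ _ (*-mono-≤ (*-mono-≤ (1≤partSize ij) (1≤partSize ik)) (1≤partSize jk))
            (dense-H (clip i) (clip j) (clip k) ij jk))
          where
          k< : k < 2 + n
          k< = ∈-upTo⁻ (lookup s (there (there (here refl))))
          i<j : i < j
          i<j = upTo-sorted (2 + n) (⊆-trans (refl ∷ refl ∷ _ ∷ʳ []) s)
          j<k : j < k
          j<k = upTo-sorted (2 + n) (⊆-trans (_ ∷ʳ refl ∷ refl ∷ []) s)
          ij = clip-mono i<j (<-trans j<k k<)
          jk = clip-mono j<k k<
          ik = clip-mono (<-trans i<j j<k) k<

open import Data.Nat using (ℕ; _+_; _*_; _≥_)
open import Data.Integer using (+_)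
open import Data.Rational using (ℚ; 0ℚ; _<_; _≤_; _/_)
open import Data.Product using (Σ; ∃-syntax)
import Data.Rational as Q

theorem30 : (m : ℕ) → m ≥ 1 → (δ : ℚ) → 0ℚ < δ →
    ∃[ N ] ((H : PartitionedHypergraph N) →
    DensityAtLeast H ((+ 4 / 27) Q.+ δ) →
    Embeds H (2 + 3 * m) (tightCycleEdges (2 + 3 * m)))
theorem30 = Development.Hypergraphs.denseHypergraphs-embed
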